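{- For an integer $n\geq 5$, the following hold in the Mutual Failures Variant: \begin{itemize} \item $P_n>\bigstar$, and \item $\text{AW}(P_n)\geq 1$. \end{itemize}
   Context: The Mutual Failures Variant of the Mixed Deletion Game is a partisan combinatorial game played on a finite simple undirected graph by two players, Left and Right, who alternate turns. On her turn Left deletes one vertex together with all its incident edges; on his turn Right deletes one edge. A deletion that would create an isolated vertex ends the game and the player who made it loses (so such deletions are effectively unavailable). In addition, the Mutual Failures Variant imposes the condition that in any graph position Right has no available move if and only if Left has no available move; hence every position is all-small. $P_n$ denotes the game position on the path graph with $n$ vertices. $\bigstar$ denotes far star (a sufficiently large nim heap), $\uparrow=\{0\mid\ast\}$, $\downarrow=\{\ast\mid 0\}$, and $\ast=\{0\mid 0\}$. Two positions $G,H$ are far star equivalent if $G+X+\bigstar$ and $H+X+\bigstar$ have the same outcome for every position $X$; equivalently ${\downarrow}{\bigstar}<G-H<{\uparrow}{\bigstar}$. The atomic weight $\text{AW}(G)$ of $G$ is the integer $n$ such that $G$ is far star equivalent to $n\cdot\uparrow$. -}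

module Defs where

open import Data.Bool using (Bool; true; false; _∧_; _∨_; not; if_then_else_; T)
open import Data.Nat using (ℕ; zero; suc; _+_; _≤_; _≡ᵇ_)
open import Data.Integer using (ℤ; +_; -[1+_])
open import Data.List using (List; []; _∷_; _++_; map; length)
open import Data.Product using (Σ; _×_; _,_; proj₁; proj₂)
open import Relation.Nullary.Decidable using (does)

data Game : Set where
  mk : List Game → List Game → Game

zeroG : Game
zeroG = mk [] []

mutual
  neg : Game → Game
  neg (mk L R) = mk (negs R) (negs L)

  negs : List Game → List Game
  negs [] = []
  negs (g ∷ gs) = neg g ∷ negs gs

mutual
  _⊕_ : Game → Game → Game
  g@(mk GL GR) ⊕ h@(mk HL HR) =
    mk (addL GL h ++ addR g HL) (addL GR h ++ addR g HR)

  addL : List Game → Game → List Game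
  addL [] h = []
  addL (g ∷ gs) h = (g ⊕ h) ∷ addL gs h

  addR : Game → List Game → List Game
  addR g [] = []
  addR g (h ∷ hs) = (g ⊕ h) ∷ addR g hs

infixl 6 _⊕_ _⊖_

_⊖_ : Game → Game → Game
g ⊖ h = g ⊕ neg h

mutual
  leq : Game → Game → Bool
  leq g@(mk GL GR) h@(mk HL HR) = noneAboveL h GL ∧ noneBelowR HR g

  noneAboveL : Game → List Game → Bool
  noneAboveL h [] = true
  noneAboveL h (gl ∷ gs) = not (leq h gl) ∧ noneAboveL h gs

  noneBelowR : List Game → Game → Bool
  noneBelowR [] g = true
  noneBelowR (hr ∷ hs) g = not (leq hr g) ∧ noneBelowR hs g

_≤G_ : Game → Game → Set
g ≤G h = T (leq g h)

_<G_ : Game → Game → Set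
g <G h = T (leq g h ∧ not (leq h g))

mutual
  nim : ℕ → Game
  nim m = mk (heapsBelow m) (heapsBelow m)

  heapsBelow : ℕ → List Game
  heapsBelow zero = []
  heapsBelow (suc m) = nim m ∷ heapsBelow m

star : Game
star = nim 1

up : Game
up = mk (zeroG ∷ []) (star ∷ [])

down : Game
down = mk (star ∷ []) (zeroG ∷ [])

copies : ℕ → Game → Game
copies zero g = zeroG
copies (suc n) g = g ⊕ copies n g

_·↑ : ℤ → Game
(+ n) ·↑ = copies n up
(-[1+ n ]) ·↑ = copies (suc n) down

-- Far star: ★ is a nim heap *m with m sufficiently large.

FarStarGt : Game → Set
FarStarGt g = Σ ℕ λ N → (m : ℕ) → N ≤ m → nim m <G g

FarStarEquiv : Game → Game → Set
FarStarEquiv g h = Σ ℕ λ N → (m : ℕ) → N ≤ m →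
  ((down ⊕ nim m) <G (g ⊖ h)) × ((g ⊖ h) <G (up ⊕ nim m))

HasAtomicWeight : Game → ℤ → Set
HasAtomicWeight g k = FarStarEquiv g (k ·↑)

filterᵇ : {A : Set} → (A → Bool) → List A → List A
filterᵇ p [] = []
filterᵇ p (x ∷ xs) = if p x then x ∷ filterᵇ p xs else filterᵇ p xs

anyᵇ : {A : Set} → (A → Bool) → List A → Bool
anyᵇ p [] = false
anyᵇ p (x ∷ xs) = p x ∨ anyᵇ p xs

allᵇ : {A : Set} → (A → Bool) → List A → Bool
allᵇ p [] = true
allᵇ p (x ∷ xs) = p x ∧ allᵇ p xs

record Graph : Set where
  constructor graph
  field
    verts : List ℕ
    edges : List (ℕ × ℕ)
open Graph public

incident : ℕ → ℕ × ℕ → Bool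
incident v (a , b) = (v ≡ᵇ a) ∨ (v ≡ᵇ b)

noIsolated : Graph → Bool
noIsolated g = allᵇ (λ v → anyᵇ (incident v) (edges g)) (verts g)

deleteVertex : ℕ → Graph → Graph
deleteVertex v g =
  graph (filterᵇ (λ u → not (u ≡ᵇ v)) (verts g)) (filterᵇ (λ e → not (incident v e)) (edges g))

leftMoves : Graph → List Graph
leftMoves g = map (λ v → deleteVertex v g) (verts g)

removeOne : {A : Set} → List A → List (List A)
removeOne [] = []
removeOne (x ∷ xs) = xs ∷ map (x ∷_) (removeOne xs)

rightMoves : Graph → List Graph
rightMoves g = map (graph (verts g)) (removeOne (edges g))

legal : List Graph → List Graph
legal = filterᵇ noIsolated

-- Game value in the Mutual Failures Variant: if either player has no
-- legal move, then neither does (the position is 0).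
-- The fuel argument bounds the number of remaining moves (each move
-- removes a vertex or an edge), so |V|+|E| fuel is always enough.
gameFuel : ℕ → Graph → Game
gameFuel zero g = zeroG
gameFuel (suc k) g with legal (leftMoves g) | legal (rightMoves g)
... | [] | _ = zeroG
... | _ | [] = zeroG
... | L@(_ ∷ _) | R@(_ ∷ _) = mk (map (gameFuel k) L) (map (gameFuel k) R)

gameOf : Graph → Game
gameOf g = gameFuel (length (verts g) + length (edges g)) g

pathEdges : ℕ → List (ℕ × ℕ)
pathEdges zero = []
pathEdges (suc zero) = []
pathEdges (suc (suc n)) = pathEdges (suc n) ++ ((n , suc n) ∷ [])

upToList : ℕ → List ℕ
upToList zero = []
upToList (suc n) = upToList n ++ (n ∷ [])

pathGraph : ℕ → Graph
pathGraph n = graph (upToList n) (pathEdges n)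

P : ℕ → Game
P n = gameOf (pathGraph n)

{-# OPTIONS --safe #-}

-- A position is a disjoint union of paths, recorded as the list ℓ of their lengths, and it is over exactly when all
-- paths have length at most three.  Its rank r, the number of cuts Right would need to end it on his own, is an upper
-- bound for the atomic weight: cutting lowers r by one and no deletion raises it, so in ℓ + (r + 1)·↓ + ★ Right keeps
-- the lead by cutting whenever Left gains a tempo.  For the lower bound Left answers each cut by moving one ↓ to *;
-- this works for every bound w that a cut lowers by at most one, provided Left wins ℓ + *j moving first whenever
-- w ≥ 1.  One may take w = r if some path has length three, since that path is a spare move for Left.  Otherwise w is
-- r minus a defect, which vanishes on single paths except P₄, P₈ and P₁₀; there the upper bound drops too, because
-- P₄ = *, P₄ + P₄ = 0, P₈ can be cut to P₄ + P₄, and P₁₀ to P₄ + P₆.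
module Submission where

-- The Mutual Failures condition is global, so a union of paths is not the sum of its components: P₃
-- is 0 and P₄ is *, but P₃ + P₄ is {0, * | 0} = ↑*, because Left can use P₃ as long as P₄ is alive.
-- Atomic weights do not add up over components, and the strategies below are stated for whole lists
-- of lengths. Since *m is its own negative, the inequalities with far star become outcomes of G +
-- c·↓ + *m. The heap decides when nothing else gains a tempo: the player to move then brings it to
-- 0 or to 1, depending on the position, and needs both within reach; hence the threshold 2 for far
-- star. The lower bound has to look ahead. P₄ has rank 1 but value *, and P₄ + P₄ has rank 2 but
-- value 0, so the rank must be corrected there; and since the cut of P₈ into P₄ + P₄ keeps the rank
-- at 2, P₈ must be corrected too. The excess is a potential that keeps track of such wasteful cuts.

open import Defs
open import Data.Bool using (Bool; true; false; _∧_; not; T; if_then_else_)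
open import Data.Bool.Properties using (T-∧; T-∨)
open import Data.Empty using (⊥-elim)
open import Data.List using (List; []; _∷_; _++_; map; length)
open import Data.List.Membership.Propositional using (_∈_)
open import Data.List.Membership.Propositional.Properties using (∈-++⁻; ∈-++⁺ˡ; ∈-++⁺ʳ; ∈-map⁺; ∈-map⁻)
open import Data.List.Properties using (++-assoc; ++-identityʳ)
open import Data.List.Relation.Unary.All as All using (All; []; _∷_)
open import Data.List.Relation.Unary.Any using (here; there)
open import Data.Nat using (ℕ; zero; suc; _+_; _∸_; _*_; _≤_; _<_; _≤ᵇ_; _≡ᵇ_; z≤n; s≤s; _≤?_)
open import Data.Nat.Properties
open import Data.Nat.Tactic.RingSolver using (solve-∀)
open import Data.Product using (Σ; ∃-syntax; _×_; _,_; proj₁; proj₂)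
open import Data.Sum using (_⊎_; inj₁; inj₂; [_,_]′)
open import Data.Unit using (tt)
open import Function using (_∘_)
open import Function.Bundles using (Equivalence)
open import Relation.Binary.PropositionalEquality using (_≡_; _≢_; refl; sym; trans; cong; cong₂; subst)
open import Relation.Nullary using (¬_; yes; no)

-- The partially ordered group of games

data Player : Set where
  Lft Rgt : Player

options : Player → Game → List Game
options Lft (mk L R) = L
options Rgt (mk L R) = R

T-not⁺ : ∀ {b} → ¬ T b → T (not b)
T-not⁺ {true}  f = f tt
T-not⁺ {false} f = tt

T-not⁻ : ∀ {b} → T (not b) → ¬ T b
T-not⁻ {true}  p q = p
T-not⁻ {false} p q = q

-- Unlike _≤G_, this wrapper does not compute, so that both games can be inferred from its type.
infix 4 _≼_
record _≼_ (g h : Game) : Set where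
  constructor ≼⟨_⟩
  field
    holds : g ≤G h
open _≼_ public

noneAboveL⁺ : ∀ {h} gs → (∀ {x} → x ∈ gs → ¬ h ≤G x) → T (noneAboveL h gs)
noneAboveL⁺ []       f = tt
noneAboveL⁺ (g ∷ gs) f =
  Equivalence.from T-∧ (T-not⁺ (f (here refl)) , noneAboveL⁺ gs (f ∘ there))

noneAboveL⁻ : ∀ {h x gs} → T (noneAboveL h gs) → x ∈ gs → ¬ h ≤G x
noneAboveL⁻ t (here refl) = T-not⁻ (proj₁ (Equivalence.to T-∧ t))
noneAboveL⁻ t (there x∈)  = noneAboveL⁻ (proj₂ (Equivalence.to T-∧ t)) x∈

noneBelowR⁺ : ∀ {g} hs → (∀ {y} → y ∈ hs → ¬ y ≤G g) → T (noneBelowR hs g)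
noneBelowR⁺ []       f = tt
noneBelowR⁺ (h ∷ hs) f =
  Equivalence.from T-∧ (T-not⁺ (f (here refl)) , noneBelowR⁺ hs (f ∘ there))

noneBelowR⁻ : ∀ {g y hs} → T (noneBelowR hs g) → y ∈ hs → ¬ y ≤G g
noneBelowR⁻ t (here refl) = T-not⁻ (proj₁ (Equivalence.to T-∧ t))
noneBelowR⁻ t (there y∈)  = noneBelowR⁻ (proj₂ (Equivalence.to T-∧ t)) y∈

≼-intro : ∀ g h → (∀ {x} → x ∈ options Lft g → ¬ h ≼ x) →
          (∀ {y} → y ∈ options Rgt h → ¬ y ≼ g) → g ≼ h
≼-intro (mk GL GR) (mk HL HR) f k =
  ≼⟨ Equivalence.from T-∧ (noneAboveL⁺ GL (λ x∈ → f x∈ ∘ ≼⟨_⟩) , noneBelowR⁺ HR (λ y∈ → k y∈ ∘ ≼⟨_⟩)) ⟩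

≼-elimˡ : ∀ {g h x} → g ≼ h → x ∈ options Lft g → ¬ h ≼ x
≼-elimˡ {mk _ _} {mk _ _} ≼⟨ t ⟩ x∈ = noneAboveL⁻ (proj₁ (Equivalence.to T-∧ t)) x∈ ∘ holds

≼-elimʳ : ∀ {g h y} → g ≼ h → y ∈ options Rgt h → ¬ y ≼ g
≼-elimʳ {mk _ _} {mk _ _} ≼⟨ t ⟩ y∈ = noneBelowR⁻ (proj₂ (Equivalence.to T-∧ t)) y∈ ∘ holds

mutual
  size : Game → ℕ
  size (mk L R) = suc (sizes L + sizes R)

  sizes : List Game → ℕ
  sizes []       = 0
  sizes (g ∷ gs) = size g + sizes gs

size≤sizes : ∀ {x gs} → x ∈ gs → size x ≤ sizes gs
size≤sizes {gs = g ∷ gs} (here refl) = m≤m+n (size g) (sizes gs)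
size≤sizes {gs = g ∷ gs} (there x∈)  = ≤-trans (size≤sizes x∈) (m≤n+m (sizes gs) (size g))

size-option : ∀ p {g x} → x ∈ options p g → size x < size g
size-option Lft {mk L R} x∈ = s≤s (≤-trans (size≤sizes x∈) (m≤m+n (sizes L) (sizes R)))
size-option Rgt {mk L R} x∈ = s≤s (≤-trans (size≤sizes x∈) (m≤n+m (sizes R) (sizes L)))

-- A numeric bound on the size replaces structural recursion, because an option reached through list
-- membership is not visibly a subterm.
≼-refl′ : ∀ n g → size g ≤ n → g ≼ g
≼-refl′ zero    (mk L R) ()
≼-refl′ (suc n) g sz = ≼-intro g g
  (λ x∈ g≤x → ≼-elimˡ g≤x x∈ (≼-refl′ n _ (≤-pred (≤-trans (size-option Lft x∈) sz))))
  (λ y∈ y≤g → ≼-elimʳ y≤g y∈ (≼-refl′ n _ (≤-pred (≤-trans (size-option Rgt y∈) sz))))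

≼-refl : ∀ g → g ≼ g
≼-refl g = ≼-refl′ (size g) g ≤-refl

rotate : ∀ x b c → b + c + x ≡ x + b + c
rotate = solve-∀

transpose : ∀ x b c → b + x + c ≡ x + b + c
transpose = solve-∀

decrease : ∀ {x y n} b c → x < y → y + b + c ≤ suc n → x + b + c ≤ n
decrease b c x<y y≤ = ≤-pred (≤-trans (+-monoˡ-≤ c (+-monoˡ-≤ b x<y)) y≤)

-- Each recursive call shrinks one game and permutes the three cyclically, so the induction runs on
-- the sum of the sizes.
≼-trans′ : ∀ n {g h k} → size g + size h + size k ≤ n → g ≼ h → h ≼ k → g ≼ k
≼-trans′ zero    {mk _ _} ()
≼-trans′ (suc n) {g} {h} {k} sz g≤h h≤k = ≼-intro g k
  (λ {x} x∈ k≤x → ≼-elimˡ g≤h x∈ (≼-trans′ n (lowerˡ x∈) h≤k k≤x))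
  (λ {y} y∈ y≤g → ≼-elimʳ h≤k y∈ (≼-trans′ n (lowerʳ y∈) y≤g g≤h))
  where
  lowerˡ : ∀ {x} → x ∈ options Lft g → size h + size k + size x ≤ n
  lowerˡ {x} x∈ = ≤-trans (≤-reflexive (rotate (size x) (size h) (size k)))
    (decrease (size h) (size k) (size-option Lft x∈) sz)
  lowerʳ : ∀ {y} → y ∈ options Rgt k → size y + size g + size h ≤ n
  lowerʳ y∈ = decrease (size g) (size h) (size-option Rgt y∈)
    (≤-trans (≤-reflexive (sym (rotate (size k) (size g) (size h)))) sz)

≼-trans : ∀ {g h k} → g ≼ h → h ≼ k → g ≼ k
≼-trans = ≼-trans′ _ ≤-refl

-- Left, moving first, wins h - x by a move in h or by one in - x.
beatsˡ : ∀ {x h h′} → h′ ∈ options Lft h → x ≼ h′ → ¬ h ≼ x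
beatsˡ h′∈ x≤h′ h≤x = ≼-elimˡ h≤x h′∈ x≤h′

beatsʳ : ∀ {x h x′} → x′ ∈ options Rgt x → x′ ≼ h → ¬ h ≼ x
beatsʳ x′∈ x′≤h h≤x = ≼-elimʳ h≤x x′∈ x′≤h

infix 4 _≈_
_≈_ : Game → Game → Set
g ≈ h = g ≼ h × h ≼ g

≈-refl : ∀ g → g ≈ g
≈-refl g = ≼-refl g , ≼-refl g

≈-sym : ∀ {g h} → g ≈ h → h ≈ g
≈-sym (p , q) = q , p

≈-trans : ∀ {g h k} → g ≈ h → h ≈ k → g ≈ k
≈-trans (p , q) (p′ , q′) = ≼-trans p p′ , ≼-trans q′ q

≈-reflexive : ∀ {g h} → g ≡ h → g ≈ h
≈-reflexive {g} refl = ≈-refl g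

Matches : List Game → List Game → Set
Matches gs hs = (∀ {x} → x ∈ gs → ∃[ y ] y ∈ hs × x ≈ y) × (∀ {y} → y ∈ hs → ∃[ x ] x ∈ gs × x ≈ y)

≈-by-options : ∀ g h → (∀ p → Matches (options p g) (options p h)) → g ≈ h
≈-by-options g h m =
  ≼-intro g h
    (λ x∈ → let (y , y∈ , x≤y , _) = proj₁ (m Lft) x∈ in beatsˡ y∈ x≤y)
    (λ y∈ → let (x , x∈ , x≤y , _) = proj₂ (m Rgt) y∈ in beatsʳ x∈ x≤y) ,
  ≼-intro h g
    (λ y∈ → let (x , x∈ , _ , y≤x) = proj₂ (m Lft) y∈ in beatsˡ x∈ y≤x)
    (λ x∈ → let (y , y∈ , _ , y≤x) = proj₁ (m Rgt) x∈ in beatsʳ y∈ y≤x)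

-- Sums of games

∈-addL⁻ : ∀ {gs h x} → x ∈ addL gs h → ∃[ y ] y ∈ gs × x ≡ y ⊕ h
∈-addL⁻ {g ∷ gs} (here refl) = g , here refl , refl
∈-addL⁻ {g ∷ gs} (there x∈)  = let (y , y∈ , eq) = ∈-addL⁻ x∈ in y , there y∈ , eq

∈-addL⁺ : ∀ {gs h y} → y ∈ gs → y ⊕ h ∈ addL gs h
∈-addL⁺ (here refl) = here refl
∈-addL⁺ (there y∈)  = there (∈-addL⁺ y∈)

∈-addR⁻ : ∀ {g hs x} → x ∈ addR g hs → ∃[ y ] y ∈ hs × x ≡ g ⊕ y
∈-addR⁻ {hs = h ∷ hs} (here refl) = h , here refl , refl
∈-addR⁻ {hs = h ∷ hs} (there x∈)  = let (y , y∈ , eq) = ∈-addR⁻ x∈ in y , there y∈ , eq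

∈-addR⁺ : ∀ {g hs y} → y ∈ hs → g ⊕ y ∈ addR g hs
∈-addR⁺ (here refl) = here refl
∈-addR⁺ (there y∈)  = there (∈-addR⁺ y∈)

options-⊕ : ∀ p g h → options p (g ⊕ h) ≡ addL (options p g) h ++ addR g (options p h)
options-⊕ Lft (mk _ _) (mk _ _) = refl
options-⊕ Rgt (mk _ _) (mk _ _) = refl

∈-⊕⁻ : ∀ p g h {x} → x ∈ options p (g ⊕ h) →
       (∃[ y ] y ∈ options p g × x ≡ y ⊕ h) ⊎ (∃[ y ] y ∈ options p h × x ≡ g ⊕ y)
∈-⊕⁻ p g h {x} x∈ with ∈-++⁻ (addL (options p g) h) (subst (x ∈_) (options-⊕ p g h) x∈)
... | inj₁ x∈ˡ = inj₁ (∈-addL⁻ x∈ˡ)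
... | inj₂ x∈ʳ = inj₂ (∈-addR⁻ x∈ʳ)

∈-⊕⁺ˡ : ∀ p g h {y} → y ∈ options p g → y ⊕ h ∈ options p (g ⊕ h)
∈-⊕⁺ˡ p g h {y} y∈ = subst (y ⊕ h ∈_) (sym (options-⊕ p g h)) (∈-++⁺ˡ (∈-addL⁺ y∈))

∈-⊕⁺ʳ : ∀ p g h {y} → y ∈ options p h → g ⊕ y ∈ options p (g ⊕ h)
∈-⊕⁺ʳ p g h {y} y∈ =
  subst (g ⊕ y ∈_) (sym (options-⊕ p g h)) (∈-++⁺ʳ (addL (options p g) h) (∈-addR⁺ y∈))

game-induction : (Q : Game → Set) →
  (∀ g → (∀ p {x} → x ∈ options p g → Q x) → Q g) → ∀ g → Q g
game-induction Q step g = go (size g) g ≤-refl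
  where
  go : ∀ n g → size g ≤ n → Q g
  go zero    (mk _ _) ()
  go (suc n) g sz = step g (λ p x∈ → go n _ (≤-pred (≤-trans (size-option p x∈) sz)))

⊕-comm : ∀ g h → g ⊕ h ≈ h ⊕ g
⊕-comm = game-induction (λ g → ∀ h → g ⊕ h ≈ h ⊕ g) λ g ihg →
  game-induction (λ h → g ⊕ h ≈ h ⊕ g) λ h ihh →
  ≈-by-options (g ⊕ h) (h ⊕ g) λ p →
    (λ x∈ → [ (λ { (y , y∈ , refl) → h ⊕ y , ∈-⊕⁺ʳ p h g y∈ , ihg p y∈ h })
            , (λ { (y , y∈ , refl) → y ⊕ g , ∈-⊕⁺ˡ p h g y∈ , ihh p y∈ }) ]′ (∈-⊕⁻ p g h x∈)) ,
    (λ x∈ → [ (λ { (y , y∈ , refl) → g ⊕ y , ∈-⊕⁺ʳ p g h y∈ , ihh p y∈ })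
            , (λ { (y , y∈ , refl) → y ⊕ h , ∈-⊕⁺ˡ p g h y∈ , ihg p y∈ h }) ]′ (∈-⊕⁻ p h g x∈))

⊕-assoc : ∀ g h k → (g ⊕ h) ⊕ k ≈ g ⊕ (h ⊕ k)
⊕-assoc = game-induction (λ g → ∀ h k → (g ⊕ h) ⊕ k ≈ g ⊕ (h ⊕ k)) λ g ihg →
  game-induction (λ h → ∀ k → (g ⊕ h) ⊕ k ≈ g ⊕ (h ⊕ k)) λ h ihh →
  game-induction (λ k → (g ⊕ h) ⊕ k ≈ g ⊕ (h ⊕ k)) λ k ihk →
  ≈-by-options ((g ⊕ h) ⊕ k) (g ⊕ (h ⊕ k)) λ p →
    (λ x∈ → [ (λ { (y , y∈ , refl) →
                 [ (λ { (z , z∈ , refl) → z ⊕ (h ⊕ k) , ∈-⊕⁺ˡ p g (h ⊕ k) z∈ , ihg p z∈ h k })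
                 , (λ { (z , z∈ , refl) → g ⊕ (z ⊕ k) , ∈-⊕⁺ʳ p g (h ⊕ k) (∈-⊕⁺ˡ p h k z∈) , ihh p z∈ k }) ]′
                 (∈-⊕⁻ p g h y∈) })
            , (λ { (y , y∈ , refl) → g ⊕ (h ⊕ y) , ∈-⊕⁺ʳ p g (h ⊕ k) (∈-⊕⁺ʳ p h k y∈) , ihk p y∈ }) ]′
            (∈-⊕⁻ p (g ⊕ h) k x∈)) ,
    (λ x∈ → [ (λ { (z , z∈ , refl) → (z ⊕ h) ⊕ k , ∈-⊕⁺ˡ p (g ⊕ h) k (∈-⊕⁺ˡ p g h z∈) , ihg p z∈ h k })
            , (λ { (y , y∈ , refl) →
                 [ (λ { (z , z∈ , refl) → (g ⊕ z) ⊕ k , ∈-⊕⁺ˡ p (g ⊕ h) k (∈-⊕⁺ʳ p g h z∈) , ihh p z∈ k })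
                 , (λ { (z , z∈ , refl) → (g ⊕ h) ⊕ z , ∈-⊕⁺ʳ p (g ⊕ h) k z∈ , ihk p z∈ }) ]′
                 (∈-⊕⁻ p h k y∈) }) ]′
            (∈-⊕⁻ p g (h ⊕ k) x∈))

noOption : ∀ p {x} → ¬ x ∈ options p zeroG
noOption Lft ()
noOption Rgt ()

⊕-identityˡ : ∀ g → zeroG ⊕ g ≈ g
⊕-identityˡ = game-induction (λ g → zeroG ⊕ g ≈ g) λ g ih → ≈-by-options (zeroG ⊕ g) g λ p →
  (λ x∈ → [ (λ { (y , y∈ , refl) → ⊥-elim (noOption p y∈) })
          , (λ { (y , y∈ , refl) → y , y∈ , ih p y∈ }) ]′ (∈-⊕⁻ p zeroG g x∈)) ,
  (λ {y} y∈ → zeroG ⊕ y , ∈-⊕⁺ʳ p zeroG g y∈ , ih p y∈)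

⊕-identityʳ : ∀ g → g ⊕ zeroG ≈ g
⊕-identityʳ g = ≈-trans (⊕-comm g zeroG) (⊕-identityˡ g)

-- Monotonicity at smaller games gives cancellation, which in turn gives monotonicity.
mutual
  ⊕-monoˡ′ : ∀ n {g g′} h → size g + size g′ + size h ≤ n → g ≼ g′ → g ⊕ h ≼ g′ ⊕ h
  ⊕-monoˡ′ zero    {mk _ _} h ()
  ⊕-monoˡ′ (suc n) {g} {g′} h sz g≤g′ = ≼-intro (g ⊕ h) (g′ ⊕ h)
    (λ x∈ le → [ (λ { (y , y∈ , refl) → ≼-elimˡ g≤g′ y∈ (⊕-cancelʳ′ n h (lower₁ y∈) le) })
               , (λ { (z , z∈ , refl) → ≼-elimˡ le (∈-⊕⁺ʳ Lft g′ h z∈) (⊕-monoˡ′ n z (lower₂ Lft z∈) g≤g′) }) ]′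
               (∈-⊕⁻ Lft g h x∈))
    (λ y∈ le → [ (λ { (y , y∈ , refl) → ≼-elimʳ g≤g′ y∈ (⊕-cancelʳ′ n h (lower₃ y∈) le) })
               , (λ { (z , z∈ , refl) → ≼-elimʳ le (∈-⊕⁺ʳ Rgt g h z∈) (⊕-monoˡ′ n z (lower₂ Rgt z∈) g≤g′) }) ]′
               (∈-⊕⁻ Rgt g′ h y∈))
    where
    lower₁ : ∀ {y} → y ∈ options Lft g → size g′ + size y + size h ≤ n
    lower₁ {y} y∈ = ≤-trans (≤-reflexive (transpose (size y) (size g′) (size h)))
      (decrease (size g′) (size h) (size-option Lft y∈) sz)
    lower₂ : ∀ p {z} → z ∈ options p h → size g + size g′ + size z ≤ n
    lower₂ p {z} z∈ = ≤-trans (≤-reflexive (rotate (size z) (size g) (size g′)))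
      (decrease (size g) (size g′) (size-option p z∈) (≤-trans (≤-reflexive (sym (rotate (size h) (size g) (size g′)))) sz))
    lower₃ : ∀ {y} → y ∈ options Rgt g′ → size y + size g + size h ≤ n
    lower₃ y∈ = decrease (size g) (size h) (size-option Rgt y∈)
      (≤-trans (≤-reflexive (sym (transpose (size g′) (size g) (size h)))) sz)

  ⊕-cancelʳ′ : ∀ n {g g′} h → size g + size g′ + size h ≤ n → g ⊕ h ≼ g′ ⊕ h → g ≼ g′
  ⊕-cancelʳ′ zero    {mk _ _} h ()
  ⊕-cancelʳ′ (suc n) {g} {g′} h sz le = ≼-intro g g′
    (λ x∈ g′≤x → ≼-elimˡ le (∈-⊕⁺ˡ Lft g h x∈) (⊕-monoˡ′ n h (lower₁ x∈) g′≤x))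
    (λ y∈ y≤g → ≼-elimʳ le (∈-⊕⁺ˡ Rgt g′ h y∈) (⊕-monoˡ′ n h (lower₃ y∈) y≤g))
    where
    lower₁ : ∀ {y} → y ∈ options Lft g → size g′ + size y + size h ≤ n
    lower₁ {y} y∈ = ≤-trans (≤-reflexive (transpose (size y) (size g′) (size h)))
      (decrease (size g′) (size h) (size-option Lft y∈) sz)
    lower₃ : ∀ {y} → y ∈ options Rgt g′ → size y + size g + size h ≤ n
    lower₃ y∈ = decrease (size g) (size h) (size-option Rgt y∈)
      (≤-trans (≤-reflexive (sym (transpose (size g′) (size g) (size h)))) sz)

⊕-monoˡ : ∀ {g g′} h → g ≼ g′ → g ⊕ h ≼ g′ ⊕ h
⊕-monoˡ h = ⊕-monoˡ′ _ h ≤-refl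

⊕-cancelʳ : ∀ {g g′} h → g ⊕ h ≼ g′ ⊕ h → g ≼ g′
⊕-cancelʳ h = ⊕-cancelʳ′ _ h ≤-refl

⊕-monoʳ : ∀ {h h′} g → h ≼ h′ → g ⊕ h ≼ g ⊕ h′
⊕-monoʳ {h} {h′} g le =
  ≼-trans (proj₁ (⊕-comm g h)) (≼-trans (⊕-monoˡ g le) (proj₁ (⊕-comm h′ g)))

⊕-cong : ∀ {g g′ h h′} → g ≈ g′ → h ≈ h′ → g ⊕ h ≈ g′ ⊕ h′
⊕-cong {g} {g′} {h} {h′} (p , p′) (q , q′) =
  ≼-trans (⊕-monoˡ h p) (⊕-monoʳ g′ q) , ≼-trans (⊕-monoˡ h′ p′) (⊕-monoʳ g q′)

-- Sums of ↓ and nim heaps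

-- The nim sum of the argument with 1.
flip : ℕ → ℕ
flip 0             = 1
flip 1             = 0
flip (suc (suc j)) = suc (suc (flip j))

flip-flip : ∀ j → flip (flip j) ≡ j
flip-flip 0             = refl
flip-flip 1             = refl
flip-flip (suc (suc j)) = cong (suc ∘ suc) (flip-flip j)

-- The nim sum with 1 only exchanges 2k and 2k + 1, so the order can fail only inside such a pair.
flip-< : ∀ {i j} → i < j → flip i < flip j ⊎ flip i ≡ j
flip-< {0} {1} _ = inj₂ refl
flip-< {1} {suc zero} (s≤s ())
flip-< {0} {suc (suc j)} _ = inj₁ (s≤s (s≤s z≤n))
flip-< {1} {suc (suc j)} _ = inj₁ (s≤s z≤n)
flip-< {suc (suc i)} {suc zero} (s≤s ())
flip-< {suc (suc i)} {suc (suc j)} (s≤s (s≤s i<j)) with flip-< i<j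
... | inj₁ lt = inj₁ (s≤s (s≤s lt))
... | inj₂ eq = inj₂ (cong (suc ∘ suc) eq)

flip≥2 : ∀ {j} → 2 ≤ j → 2 ≤ flip j
flip≥2 (s≤s (s≤s _)) = s≤s (s≤s z≤n)

flip≤ : ∀ j → flip j ≤ suc j
flip≤ 0 = s≤s z≤n
flip≤ 1 = z≤n
flip≤ (suc (suc j)) = s≤s (s≤s (flip≤ j))

-- downs c j has the value of c·↓ + *j: Left's move from ↓ to * flips the last bit of j.
mutual
  downs : ℕ → ℕ → Game
  downs zero    j = mk (downsBelow zero j) (downsBelow zero j)
  downs (suc c) j = mk (downs c (flip j) ∷ downsBelow (suc c) j) (downs c j ∷ downsBelow (suc c) j)

  downsBelow : ℕ → ℕ → List Game
  downsBelow c zero    = []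
  downsBelow c (suc j) = downs c j ∷ downsBelow c j

∈-downsBelow⁺ : ∀ {c i j} → i < j → downs c i ∈ downsBelow c j
∈-downsBelow⁺ {c} {i} {suc j} (s≤s i≤j) with m≤n⇒m<n∨m≡n i≤j
... | inj₁ i<j  = there (∈-downsBelow⁺ i<j)
... | inj₂ refl = here refl

∈-downsBelow⁻ : ∀ {c j x} → x ∈ downsBelow c j → ∃[ i ] i < j × x ≡ downs c i
∈-downsBelow⁻ {c} {suc j} (here refl) = j , ≤-refl , refl
∈-downsBelow⁻ {c} {suc j} (there x∈)  = let (i , i<j , eq) = ∈-downsBelow⁻ x∈ in i , m≤n⇒m≤1+n i<j , eq

afterDown : Player → ℕ → ℕ
afterDown Lft j = flip j
afterDown Rgt j = j

∈-downs-nim : ∀ p c {i j} → i < j → downs c i ∈ options p (downs c j)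
∈-downs-nim Lft zero    i<j = ∈-downsBelow⁺ i<j
∈-downs-nim Rgt zero    i<j = ∈-downsBelow⁺ i<j
∈-downs-nim Lft (suc c) i<j = there (∈-downsBelow⁺ i<j)
∈-downs-nim Rgt (suc c) i<j = there (∈-downsBelow⁺ i<j)

∈-downs-down : ∀ p c j → downs c (afterDown p j) ∈ options p (downs (suc c) j)
∈-downs-down Lft c j = here refl
∈-downs-down Rgt c j = here refl

data DownsOption (p : Player) : ℕ → ℕ → Game → Set where
  down-move : ∀ {c j} → DownsOption p (suc c) j (downs c (afterDown p j))
  nim-move  : ∀ {c i j} → i < j → DownsOption p c j (downs c i)

∈-downs⁻ : ∀ p c j {x} → x ∈ options p (downs c j) → DownsOption p c j x
∈-downs⁻ Lft zero j x∈ with ∈-downsBelow⁻ x∈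
... | i , i<j , refl = nim-move i<j
∈-downs⁻ Rgt zero j x∈ with ∈-downsBelow⁻ x∈
... | i , i<j , refl = nim-move i<j
∈-downs⁻ Lft (suc c) j (here refl) = down-move
∈-downs⁻ Rgt (suc c) j (here refl) = down-move
∈-downs⁻ Lft (suc c) j (there x∈) with ∈-downsBelow⁻ x∈
... | i , i<j , refl = nim-move i<j
∈-downs⁻ Rgt (suc c) j (there x∈) with ∈-downsBelow⁻ x∈
... | i , i<j , refl = nim-move i<j

nim-decreases : ∀ c {i j n} → i < j → c + c + j ≤ n → c + c + i < n
nim-decreases c i<j sz = ≤-trans (+-monoʳ-< (c + c) i<j) sz

-- Each ↓ counts two in c + c + j, because Left's replacing it by * may enlarge the heap by one.
down-decreases : ∀ p c j {n} → suc c + suc c + j ≤ n → c + c + afterDown p j < n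
down-decreases p c j sz = ≤-trans (s≤s (≤-trans (+-monoʳ-≤ (c + c) (afterDown≤ p)) (≤-reflexive (shift c j)))) sz
  where
  afterDown≤ : ∀ p → afterDown p j ≤ suc j
  afterDown≤ Lft = flip≤ j
  afterDown≤ Rgt = n≤1+n j
  shift : ∀ c j → c + c + suc j ≡ c + suc c + j
  shift = solve-∀

afterDown-flip : ∀ p j → afterDown p (flip j) ≡ flip (afterDown p j)
afterDown-flip Lft j = refl
afterDown-flip Rgt j = refl

star-option : ∀ p → zeroG ∈ options p star
star-option Lft = here refl
star-option Rgt = here refl

∈-star⁻ : ∀ p {x} → x ∈ options p star → x ≡ zeroG
∈-star⁻ Lft (here refl) = refl
∈-star⁻ Rgt (here refl) = refl

-- What `≼-intro` demands of an option x of player p when one side of the inequality is h; it lets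
-- one argument serve both directions of an equivalence.
Away : Player → Game → Game → Set
Away Lft h x = ¬ h ≼ x
Away Rgt h x = ¬ x ≼ h

opponent : Player → Player
opponent Lft = Rgt
opponent Rgt = Lft

away-option : ∀ p {h h′ x} → h′ ∈ options p h → x ≈ h′ → Away p h x
away-option Lft h′∈ (x≼h′ , _) h≼x = ≼-elimˡ h≼x h′∈ x≼h′
away-option Rgt h′∈ (_ , h′≼x) x≼h = ≼-elimʳ x≼h h′∈ h′≼x

away-reply : ∀ p {h x x′} → x′ ∈ options (opponent p) x → x′ ≈ h → Away p h x
away-reply Lft x′∈ (x′≼h , _) h≼x = ≼-elimʳ h≼x x′∈ x′≼h
away-reply Rgt x′∈ (_ , h≼x′) x≼h = ≼-elimˡ x≼h x′∈ h≼x′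

flip-≢ : ∀ j → flip j < j ⊎ j < flip j
flip-≢ 0             = inj₂ (s≤s z≤n)
flip-≢ 1             = inj₁ (s≤s z≤n)
flip-≢ (suc (suc j)) with flip-≢ j
... | inj₁ lt = inj₁ (s≤s (s≤s lt))
... | inj₂ gt = inj₂ (s≤s (s≤s gt))

-- When flip j < j the option * + *(flip j) = *j of * + *j is not an option of *(flip j), but it reverses to it.
star⊕downs : ∀ n c j → c + c + j < n → star ⊕ downs c j ≈ downs c (flip j)
star⊕downs zero c j ()
star⊕downs (suc n) c j (s≤s sz) =
  ≼-intro (star ⊕ downs c j) (downs c (flip j)) (fwd Lft) (bwd Rgt) ,
  ≼-intro (downs c (flip j)) (star ⊕ downs c j) (bwd Lft) (fwd Rgt)
  where
  ih-nim : ∀ {i} → i < j → star ⊕ downs c i ≈ downs c (flip i)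
  ih-nim {i} i<j = star⊕downs n c i (nim-decreases c i<j sz)
  ih-down : ∀ p {c′} → c ≡ suc c′ → star ⊕ downs c′ (afterDown p j) ≈ downs c′ (flip (afterDown p j))
  ih-down p {c′} refl = star⊕downs n c′ (afterDown p j) (down-decreases p c′ j sz)
  fwd : ∀ p {x} → x ∈ options p (star ⊕ downs c j) → Away p (downs c (flip j)) x
  fwd p x∈ with ∈-⊕⁻ p star (downs c j) x∈
  fwd p x∈ | inj₁ (y , y∈ , refl) rewrite ∈-star⁻ p y∈ with flip-≢ j
  ... | inj₁ lt = away-reply p (∈-⊕⁺ʳ (opponent p) zeroG (downs c j) (∈-downs-nim (opponent p) c lt)) (⊕-identityˡ _)
  ... | inj₂ gt = away-option p (∈-downs-nim p c gt) (⊕-identityˡ _)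
  fwd p x∈ | inj₂ (y , y∈ , refl) with ∈-downs⁻ p c j y∈
  ... | down-move {c′} = away-option p
    (subst (λ k → downs c′ k ∈ options p (downs c (flip j))) (afterDown-flip p j) (∈-downs-down p c′ (flip j)))
    (ih-down p refl)
  ... | nim-move {i = i} i<j with flip-< i<j
  ... | inj₁ lt = away-option p (∈-downs-nim p c lt) (ih-nim i<j)
  ... | inj₂ refl = away-reply p
    (∈-⊕⁺ˡ (opponent p) star (downs c i) (star-option (opponent p)))
    (≈-trans (⊕-identityˡ _) (≈-reflexive (cong (downs c) (sym (flip-flip i)))))
  bwd : ∀ p {x} → x ∈ options p (downs c (flip j)) → Away p (star ⊕ downs c j) x
  bwd p x∈ with ∈-downs⁻ p c (flip j) x∈
  ... | down-move {c′} = away-option p (∈-⊕⁺ʳ p star (downs c j) (∈-downs-down p c′ j))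
    (≈-sym (≈-trans (ih-down p refl) (≈-reflexive (cong (downs c′) (sym (afterDown-flip p j))))))
  ... | nim-move {i = i} lt with flip-< lt
  ... | inj₂ eq = away-option p (∈-⊕⁺ˡ p star (downs c j) (star-option p))
    (≈-sym (≈-trans (⊕-identityˡ _) (≈-reflexive (cong (downs c) (trans (sym (flip-flip j)) (trans (cong flip (sym eq)) (flip-flip i)))))))
  ... | inj₁ gt = away-option p (∈-⊕⁺ʳ p star (downs c j) (∈-downs-nim p c fi<j))
    (≈-sym (≈-trans (ih-nim fi<j) (≈-reflexive (cong (downs c) (flip-flip i)))))
    where
    fi<j : flip i < j
    fi<j = subst (flip i <_) (flip-flip j) gt

downOption : Player → Game
downOption Lft = star
downOption Rgt = zeroG

∈-down⁺ : ∀ p → downOption p ∈ options p down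
∈-down⁺ Lft = here refl
∈-down⁺ Rgt = here refl

∈-down⁻ : ∀ p {x} → x ∈ options p down → x ≡ downOption p
∈-down⁻ Lft (here refl) = refl
∈-down⁻ Rgt (here refl) = refl

downOption⊕downs : ∀ p c j → downOption p ⊕ downs c j ≈ downs c (afterDown p j)
downOption⊕downs Lft c j = star⊕downs _ c j ≤-refl
downOption⊕downs Rgt c j = ⊕-identityˡ _

-- Every option has a match up to `≈`; only Left's move of the added ↓ to * needs `star⊕downs`.
down⊕downs : ∀ n c j → c + c + j < n → down ⊕ downs c j ≈ downs (suc c) j
down⊕downs zero c j ()
down⊕downs (suc n) c j (s≤s sz) = ≈-by-options (down ⊕ downs c j) (downs (suc c) j) λ p → fwd p , bwd p
  where
  ih-nim : ∀ {i} → i < j → down ⊕ downs c i ≈ downs (suc c) i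
  ih-nim {i} i<j = down⊕downs n c i (nim-decreases c i<j sz)
  ih-down : ∀ p {c′} → c ≡ suc c′ → down ⊕ downs c′ (afterDown p j) ≈ downs (suc c′) (afterDown p j)
  ih-down p {c′} refl = down⊕downs n c′ (afterDown p j) (down-decreases p c′ j sz)
  fwd : ∀ p {x} → x ∈ options p (down ⊕ downs c j) → ∃[ y ] y ∈ options p (downs (suc c) j) × x ≈ y
  fwd p x∈ with ∈-⊕⁻ p down (downs c j) x∈
  ... | inj₁ (y , y∈ , refl) rewrite ∈-down⁻ p y∈ = _ , ∈-downs-down p c j , downOption⊕downs p c j
  ... | inj₂ (y , y∈ , refl) with ∈-downs⁻ p c j y∈
  ... | down-move    = _ , ∈-downs-down p c j , ih-down p refl
  ... | nim-move i<j = _ , ∈-downs-nim p (suc c) i<j , ih-nim i<j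
  bwd : ∀ p {y} → y ∈ options p (downs (suc c) j) → ∃[ x ] x ∈ options p (down ⊕ downs c j) × x ≈ y
  bwd p y∈ with ∈-downs⁻ p (suc c) j y∈
  ... | down-move    = _ , ∈-⊕⁺ˡ p down (downs c j) (∈-down⁺ p) , downOption⊕downs p c j
  ... | nim-move i<j = _ , ∈-⊕⁺ʳ p down (downs c j) (∈-downs-nim p c i<j) , ih-nim i<j

mutual
  nim≡downs : ∀ j → nim j ≡ downs 0 j
  nim≡downs j rewrite heapsBelow≡downsBelow j = refl

  heapsBelow≡downsBelow : ∀ j → heapsBelow j ≡ downsBelow 0 j
  heapsBelow≡downsBelow zero    = refl
  heapsBelow≡downsBelow (suc j) = cong₂ _∷_ (nim≡downs j) (heapsBelow≡downsBelow j)

-- Replaces the literal sum by `downs`, whose options are listed explicitly and whose heap has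
-- absorbed every *.
copies⊕nim : ∀ c j → copies c down ⊕ nim j ≈ downs c j
copies⊕nim zero    j = ≈-trans (⊕-identityˡ _) (≈-reflexive (nim≡downs j))
copies⊕nim (suc c) j = ≈-trans (⊕-assoc down (copies c down) (nim j))
  (≈-trans (⊕-cong (≈-refl down) (copies⊕nim c j)) (down⊕downs _ c j ≤-refl))

-- Mirror strategy: a move in one heap is copied in the other.
nim⊕nim : ∀ n j → j < n → downs 0 j ⊕ downs 0 j ≈ zeroG
nim⊕nim zero    j ()
nim⊕nim (suc n) j (s≤s j≤n) =
  ≼-intro _ _ (away Lft) (λ ()) , ≼-intro _ _ (λ ()) (away Rgt)
  where
  away : ∀ p {x} → x ∈ options p (downs 0 j ⊕ downs 0 j) → Away p zeroG x
  away p x∈ with ∈-⊕⁻ p (downs 0 j) (downs 0 j) x∈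
  ... | inj₁ (y , y∈ , refl) with ∈-downs⁻ p 0 j y∈
  ... | nim-move {i = i} i<j = away-reply p
    (∈-⊕⁺ʳ (opponent p) (downs 0 i) (downs 0 j) (∈-downs-nim (opponent p) 0 i<j)) (nim⊕nim n i (≤-trans i<j j≤n))
  away p x∈ | inj₂ (y , y∈ , refl) with ∈-downs⁻ p 0 j y∈
  ... | nim-move {i = i} i<j = away-reply p
    (∈-⊕⁺ˡ (opponent p) (downs 0 j) (downs 0 i) (∈-downs-nim (opponent p) 0 i<j)) (nim⊕nim n i (≤-trans i<j j≤n))

nim-self : ∀ j → nim j ⊕ nim j ≈ zeroG
nim-self j = subst (λ g → g ⊕ g ≈ zeroG) (sym (nim≡downs j)) (nim⊕nim _ j ≤-refl)

mutual
  neg-⊕ : ∀ g h → neg (g ⊕ h) ≡ neg g ⊕ neg h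
  neg-⊕ (mk GL GR) (mk HL HR) = cong₂ mk
    (trans (negs-++ (addL GR (mk HL HR)) _) (cong₂ _++_ (negs-addL GR (mk HL HR)) (negs-addR (mk GL GR) HR)))
    (trans (negs-++ (addL GL (mk HL HR)) _) (cong₂ _++_ (negs-addL GL (mk HL HR)) (negs-addR (mk GL GR) HL)))

  negs-addL : ∀ gs h → negs (addL gs h) ≡ addL (negs gs) (neg h)
  negs-addL []       h = refl
  negs-addL (g ∷ gs) h = cong₂ _∷_ (neg-⊕ g h) (negs-addL gs h)

  negs-addR : ∀ g hs → negs (addR g hs) ≡ addR (neg g) (negs hs)
  negs-addR g []       = refl
  negs-addR g (h ∷ hs) = cong₂ _∷_ (neg-⊕ g h) (negs-addR g hs)

  negs-++ : ∀ gs hs → negs (gs ++ hs) ≡ negs gs ++ negs hs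
  negs-++ []       hs = refl
  negs-++ (g ∷ gs) hs = cong (neg g ∷_) (negs-++ gs hs)

neg-copies-up : ∀ k → neg (copies k up) ≡ copies k down
neg-copies-up zero    = refl
neg-copies-up (suc k) = trans (neg-⊕ up (copies k up)) (cong (down ⊕_) (neg-copies-up k))

-- Outcomes of G + c·↓ + *j

position : Game → ℕ → ℕ → Game
position G c j = G ⊕ downs c j

-- “Holds” is winning when the opponent moves first, “Wins” is winning when moving first.
LeftHolds RightHolds LeftWins RightWins : Game → ℕ → ℕ → Set
LeftHolds  G c j = zeroG ≼ position G c j
RightHolds G c j = position G c j ≼ zeroG
LeftWins   G c j = ¬ RightHolds G c j
RightWins  G c j = ¬ LeftHolds G c j

left-plays-component : ∀ {G H} c j → H ∈ options Lft G → LeftHolds H c j → LeftWins G c j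
left-plays-component {G} c j H∈ h le = ≼-elimˡ le (∈-⊕⁺ˡ Lft G (downs c j) H∈) h

left-plays-down : ∀ {G} c j → LeftHolds G c (flip j) → LeftWins G (suc c) j
left-plays-down {G} c j h le = ≼-elimˡ le (∈-⊕⁺ʳ Lft G (downs (suc c) j) (∈-downs-down Lft c j)) h

left-plays-nim : ∀ {G} c {i j} → i < j → LeftHolds G c i → LeftWins G c j
left-plays-nim {G} c {j = j} i<j h le = ≼-elimˡ le (∈-⊕⁺ʳ Lft G (downs c j) (∈-downs-nim Lft c i<j)) h

right-plays-component : ∀ {G H} c j → H ∈ options Rgt G → RightHolds H c j → RightWins G c j
right-plays-component {G} c j H∈ h le = ≼-elimʳ le (∈-⊕⁺ˡ Rgt G (downs c j) H∈) h

right-plays-down : ∀ {G} c j → RightHolds G c j → RightWins G (suc c) j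
right-plays-down {G} c j h le = ≼-elimʳ le (∈-⊕⁺ʳ Rgt G (downs (suc c) j) (∈-downs-down Rgt c j)) h

right-plays-nim : ∀ {G} c {i j} → i < j → RightHolds G c i → RightWins G c j
right-plays-nim {G} c {j = j} i<j h le = ≼-elimʳ le (∈-⊕⁺ʳ Rgt G (downs c j) (∈-downs-nim Rgt c i<j)) h

-- Zero has no Left option, so only Right's three kinds of move need an answer.
left-holds : ∀ G c j → (∀ {H} → H ∈ options Rgt G → LeftWins H c j) →
             (∀ {c′} → c ≡ suc c′ → LeftWins G c′ j) →
             (∀ {i} → i < j → LeftWins G c i) → LeftHolds G c j
left-holds G c j component down nim = ≼-intro zeroG (position G c j) (λ ()) λ x∈ →
  [ (λ { (H , H∈ , refl) → component H∈ })
  , (λ { (y , y∈ , refl) → fromDowns (∈-downs⁻ Rgt c j y∈) down nim }) ]′ (∈-⊕⁻ Rgt G (downs c j) x∈)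
  where
  fromDowns : ∀ {c j y} → DownsOption Rgt c j y → (∀ {c′} → c ≡ suc c′ → LeftWins G c′ j) →
              (∀ {i} → i < j → LeftWins G c i) → ¬ (G ⊕ y ≼ zeroG)
  fromDowns down-move      down nim = down refl
  fromDowns (nim-move i<j) down nim = nim i<j

right-holds : ∀ G c j → (∀ {H} → H ∈ options Lft G → RightWins H c j) →
              (∀ {c′} → c ≡ suc c′ → RightWins G c′ (flip j)) →
              (∀ {i} → i < j → RightWins G c i) → RightHolds G c j
right-holds G c j component down nim = ≼-intro (position G c j) zeroG (λ x∈ →
  [ (λ { (H , H∈ , refl) → component H∈ })
  , (λ { (y , y∈ , refl) → fromDowns (∈-downs⁻ Lft c j y∈) down nim }) ]′ (∈-⊕⁻ Lft G (downs c j) x∈))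
  (λ ())
  where
  fromDowns : ∀ {c j y} → DownsOption Lft c j y → (∀ {c′} → c ≡ suc c′ → RightWins G c′ (flip j)) →
              (∀ {i} → i < j → RightWins G c i) → ¬ (zeroG ≼ G ⊕ y)
  fromDowns down-move      down nim = down refl
  fromDowns (nim-move i<j) down nim = nim i<j

-- The far star inequalities as outcomes

<G-intro : ∀ {g h} → g ≼ h → ¬ h ≼ g → g <G h
<G-intro p q = Equivalence.from T-∧ (holds p , T-not⁺ (q ∘ ≼⟨_⟩))

farStarGt : ∀ {G m} → LeftHolds G 0 m → LeftWins G 0 m → nim m <G G
farStarGt {G} {m} h w rewrite nim≡downs m = <G-intro
  (⊕-cancelʳ (downs 0 m) (≼-trans (proj₁ cancel) h))
  (λ le → w (≼-trans (⊕-monoˡ (downs 0 m) le) (proj₁ cancel)))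
  where
  cancel : downs 0 m ⊕ downs 0 m ≈ zeroG
  cancel = nim⊕nim _ m ≤-refl

-- Adding *m and cancelling one ↓ on both sides leaves G + k·↓ + *m > 0; the cancelled ↓ is why k is
-- one less than the number of ↑.
down<difference : ∀ {G k m} → LeftHolds G k m → LeftWins G k m → (down ⊕ nim m) <G (G ⊖ copies (suc k) up)
down<difference {G} {k} {m} h w rewrite neg-copies-up (suc k) = <G-intro
  (⊕-cancelʳ (nim m) (≼-trans (proj₁ lhs) (≼-trans h′ (proj₂ rhs))))
  (λ le → w (⊕-cancelʳ down (≼-trans (proj₂ rhs)
    (≼-trans (⊕-monoˡ (nim m) le) (≼-trans (proj₁ lhs) (proj₂ (⊕-identityˡ down)))))))
  where
  lhs : (down ⊕ nim m) ⊕ nim m ≈ down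
  lhs = ≈-trans (⊕-assoc down (nim m) (nim m))
    (≈-trans (⊕-cong (≈-refl down) (nim-self m)) (⊕-identityʳ down))
  rhs : (G ⊕ (down ⊕ copies k down)) ⊕ nim m ≈ position G k m ⊕ down
  rhs = ≈-trans (⊕-assoc G (down ⊕ copies k down) (nim m))
    (≈-trans (⊕-cong (≈-refl G) (≈-trans (⊕-assoc down (copies k down) (nim m))
      (≈-trans (⊕-comm down _) (⊕-cong (copies⊕nim k m) (≈-refl down)))))
    (≈-sym (⊕-assoc G (downs k m) down)))
  h′ : down ≼ position G k m ⊕ down
  h′ = ≼-trans (proj₂ (⊕-identityˡ down)) (⊕-monoˡ down h)

-- Both inequalities are settled by evaluating `leq`.
up⊕down : up ⊕ down ≈ zeroG
up⊕down = ≼⟨ _ ⟩ , ≼⟨ _ ⟩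

-- Adding ↓ + *m turns the right-hand side into 0 and raises the number of ↓ on the left from k to k
-- + 1.
difference<up : ∀ {G k m} → RightHolds G (suc k) m → RightWins G (suc k) m → (G ⊖ copies k up) <G (up ⊕ nim m)
difference<up {G} {k} {m} h w rewrite neg-copies-up k = <G-intro
  (⊕-cancelʳ (down ⊕ nim m) (≼-trans (proj₁ lhs) (≼-trans h (proj₂ rhs))))
  (λ le → w (≼-trans (proj₂ rhs) (≼-trans (⊕-monoˡ (down ⊕ nim m) le) (proj₁ lhs))))
  where
  lhs : (G ⊕ copies k down) ⊕ (down ⊕ nim m) ≈ position G (suc k) m
  lhs = ≈-trans (⊕-assoc G (copies k down) (down ⊕ nim m)) (⊕-cong (≈-refl G)
    (≈-trans (≈-sym (⊕-assoc (copies k down) down (nim m)))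
      (≈-trans (⊕-cong (⊕-comm (copies k down) down) (≈-refl (nim m))) (copies⊕nim (suc k) m))))
  rhs : (up ⊕ nim m) ⊕ (down ⊕ nim m) ≈ zeroG
  rhs = ≈-trans (⊕-assoc up (nim m) (down ⊕ nim m))
    (≈-trans (⊕-cong (≈-refl up) (≈-trans (⊕-comm (nim m) (down ⊕ nim m))
      (≈-trans (⊕-assoc down (nim m) (nim m))
        (≈-trans (⊕-cong (≈-refl down) (nim-self m)) (⊕-identityʳ down)))))
    up⊕down)

-- Graph positions as lists of path lengths

-- ρ n = ⌈ n / 3 ⌉ - 1 (and ρ 0 = 0): the number of cuts Right needs, playing alone, to finish off a path with n vertices.
ρ : ℕ → ℕ
ρ 0 = 0
ρ 1 = 0
ρ 2 = 0
ρ 3 = 0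
ρ (suc (suc (suc (suc n)))) = suc (ρ (suc n))

total : (ℕ → ℕ) → List ℕ → ℕ
total f []      = 0
total f (n ∷ ℓ) = f n + total f ℓ

rank : List ℕ → ℕ
rank = total ρ

-- Deleting an end vertex leaves a path of length 0 in the list, so that every move splits one entry
-- into two.
data Step : Player → List ℕ → List ℕ → Set where
  delete : ∀ a b {ℓ} → a ≢ 1 → b ≢ 1 → 3 ≤ suc (a + b) → Step Lft (suc (a + b) ∷ ℓ) (a ∷ b ∷ ℓ)
  cut    : ∀ a b {ℓ} → 2 ≤ a → 2 ≤ b → Step Rgt (a + b ∷ ℓ) (a ∷ b ∷ ℓ)
  skip   : ∀ {p n ℓ ℓ′} → Step p ℓ ℓ′ → Step p (n ∷ ℓ) (n ∷ ℓ′)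

-- In `live`, options and steps match in both directions. In `over`, the value is 0 even if a P₃
-- still offers Left a deletion: this is the Mutual Failures condition.
data Plays : List ℕ → Game → Set where
  over : ∀ {ℓ} → rank ℓ ≡ 0 → Plays ℓ zeroG
  live : ∀ {ℓ G} → 1 ≤ rank ℓ →
         (∀ p {x} → x ∈ options p G → ∃[ ℓ′ ] Step p ℓ ℓ′ × Plays ℓ′ x) →
         (∀ p {ℓ′} → Step p ℓ ℓ′ → ∃[ x ] x ∈ options p G × Plays ℓ′ x) → Plays ℓ G

-- Path graphs as sorted lists of segments

range : ℕ → ℕ → List ℕ
range s zero    = []
range s (suc n) = s ∷ range (suc s) n

chain : ℕ → ℕ → List (ℕ × ℕ)
chain s zero          = []
chain s (suc zero)    = []
chain s (suc (suc n)) = (s , suc s) ∷ chain (suc s) (suc n)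

-- A segment (s , n) is the path on the vertices s , … , s + n - 1.
Segments : Set
Segments = List (ℕ × ℕ)

vertices : Segments → List ℕ
vertices []            = []
vertices ((s , n) ∷ S) = range s n ++ vertices S

links : Segments → List (ℕ × ℕ)
links []            = []
links ((s , n) ∷ S) = chain s n ++ links S

graphOf : Segments → Graph
graphOf S = graph (vertices S) (links S)

lengths : Segments → List ℕ
lengths = map proj₂

-- Segments are disjoint and increasing but may touch, since a cut leaves no gap in the vertices.
data Sorted : ℕ → Segments → Set where
  []  : ∀ {lo} → Sorted lo []
  _∷_ : ∀ {lo s n S} → lo ≤ s → Sorted (s + n) S → Sorted lo ((s , n) ∷ S)

∈-range : ∀ s n {v} → v ∈ range s n → s ≤ v × v < s + n
∈-range s (suc n) (here refl) = ≤-refl , m<m+n s (s≤s z≤n)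
∈-range s (suc n) (there v∈) with ∈-range (suc s) n v∈
... | s<v , v< = <⇒≤ s<v , ≤-trans v< (≤-reflexive (sym (+-suc s n)))

∈-chain : ∀ s n {x y} → (x , y) ∈ chain s n → y ≡ suc x × s ≤ x × suc x < s + n
∈-chain s (suc (suc n)) (here refl) =
  refl , ≤-refl , ≤-trans (s≤s (s≤s (m≤m+n s n))) (≤-reflexive (sym (trans (+-suc s (suc n)) (cong suc (+-suc s n)))))
∈-chain s (suc (suc n)) (there e∈) with ∈-chain (suc s) (suc n) e∈
... | eq , s<x , x< = eq , <⇒≤ s<x , ≤-trans x< (≤-reflexive (sym (+-suc s (suc n))))

∈-vertices : ∀ {lo S v} → Sorted lo S → v ∈ vertices S → lo ≤ v
∈-vertices {S = (s , n) ∷ S} (lo≤s ∷ so) v∈ with ∈-++⁻ (range s n) v∈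
... | inj₁ v∈ˡ = ≤-trans lo≤s (proj₁ (∈-range s n v∈ˡ))
... | inj₂ v∈ʳ = ≤-trans lo≤s (≤-trans (m≤m+n s n) (∈-vertices so v∈ʳ))

∈-links : ∀ {lo S x y} → Sorted lo S → (x , y) ∈ links S → y ≡ suc x × lo ≤ x
∈-links {S = (s , n) ∷ S} (lo≤s ∷ so) e∈ with ∈-++⁻ (chain s n) e∈
... | inj₁ e∈ˡ = let (eq , s≤x , _) = ∈-chain s n e∈ˡ in eq , ≤-trans lo≤s s≤x
... | inj₂ e∈ʳ = let (eq , lo≤x) = ∈-links so e∈ʳ in eq , ≤-trans lo≤s (≤-trans (m≤m+n s n) lo≤x)

≢⇒T : ∀ m n → m ≢ n → T (not (m ≡ᵇ n))
≢⇒T m n m≢n = T-not⁺ (m≢n ∘ ≡ᵇ⇒≡ m n)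

incident⁻ : ∀ v x y → T (incident v (x , y)) → v ≡ x ⊎ v ≡ y
incident⁻ v x y t with Equivalence.to (T-∨ {v ≡ᵇ x}) t
... | inj₁ p = inj₁ (≡ᵇ⇒≡ v x p)
... | inj₂ p = inj₂ (≡ᵇ⇒≡ v y p)

incident⁺ : ∀ v x y → v ≡ x ⊎ v ≡ y → T (incident v (x , y))
incident⁺ v x y (inj₁ p) = Equivalence.from (T-∨ {v ≡ᵇ x}) (inj₁ (≡⇒≡ᵇ v x p))
incident⁺ v x y (inj₂ p) = Equivalence.from (T-∨ {v ≡ᵇ x}) (inj₂ (≡⇒≡ᵇ v y p))

anyᵇ⁻ : ∀ {A : Set} {p : A → Bool} xs → T (anyᵇ p xs) → ∃[ x ] x ∈ xs × T (p x)
anyᵇ⁻ {p = p} (x ∷ xs) t with Equivalence.to (T-∨ {p x}) t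
... | inj₁ px = x , here refl , px
... | inj₂ ts = let (y , y∈ , py) = anyᵇ⁻ xs ts in y , there y∈ , py

anyᵇ⁺ : ∀ {A : Set} {p : A → Bool} {x xs} → x ∈ xs → T (p x) → T (anyᵇ p xs)
anyᵇ⁺ {p = p} {xs = y ∷ ys} (here refl) px = Equivalence.from (T-∨ {p y}) (inj₁ px)
anyᵇ⁺ {p = p} {xs = y ∷ ys} (there x∈)  px = Equivalence.from (T-∨ {p y}) (inj₂ (anyᵇ⁺ x∈ px))

allᵇ⁻ : ∀ {A : Set} {p : A → Bool} {x xs} → T (allᵇ p xs) → x ∈ xs → T (p x)
allᵇ⁻ t (here refl) = proj₁ (Equivalence.to T-∧ t)
allᵇ⁻ t (there x∈)  = allᵇ⁻ (proj₂ (Equivalence.to T-∧ t)) x∈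

allᵇ⁺ : ∀ {A : Set} {p : A → Bool} xs → (∀ {x} → x ∈ xs → T (p x)) → T (allᵇ p xs)
allᵇ⁺ []       f = tt
allᵇ⁺ (x ∷ xs) f = Equivalence.from T-∧ (f (here refl) , allᵇ⁺ xs (f ∘ there))

∈-filterᵇ⁻ : ∀ {A : Set} {p : A → Bool} {x} xs → x ∈ filterᵇ p xs → x ∈ xs × T (p x)
∈-filterᵇ⁻ {p = p} (y ∷ ys) x∈ with p y in eq
∈-filterᵇ⁻ (y ∷ ys) (here refl) | true = here refl , subst T (sym eq) tt
∈-filterᵇ⁻ (y ∷ ys) (there x∈)  | true = let (x∈′ , px) = ∈-filterᵇ⁻ ys x∈ in there x∈′ , px
∈-filterᵇ⁻ (y ∷ ys) x∈          | false = let (x∈′ , px) = ∈-filterᵇ⁻ ys x∈ in there x∈′ , px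

∈-filterᵇ⁺ : ∀ {A : Set} {p : A → Bool} {x xs} → x ∈ xs → T (p x) → x ∈ filterᵇ p xs
∈-filterᵇ⁺ {p = p} {x} {y ∷ ys} (here refl) px with p x | px
... | true | _ = here refl
∈-filterᵇ⁺ {p = p} {x} {y ∷ ys} (there x∈) px with p y
... | true  = there (∈-filterᵇ⁺ x∈ px)
... | false = ∈-filterᵇ⁺ x∈ px

filterᵇ-++ : ∀ {A : Set} (p : A → Bool) xs ys → filterᵇ p (xs ++ ys) ≡ filterᵇ p xs ++ filterᵇ p ys
filterᵇ-++ p []       ys = refl
filterᵇ-++ p (x ∷ xs) ys with p x
... | true  = cong (x ∷_) (filterᵇ-++ p xs ys)
... | false = filterᵇ-++ p xs ys

filterᵇ-all : ∀ {A : Set} (p : A → Bool) xs → (∀ {x} → x ∈ xs → T (p x)) → filterᵇ p xs ≡ xs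
filterᵇ-all p []       f = refl
filterᵇ-all p (x ∷ xs) f with p x | f (here refl)
... | true | _ = cong (x ∷_) (filterᵇ-all p xs (f ∘ there))

filterᵇ-reject : ∀ {A : Set} (p : A → Bool) {x xs} → ¬ T (p x) → filterᵇ p (x ∷ xs) ≡ filterᵇ p xs
filterᵇ-reject p {x} ¬px with p x
... | true  = ⊥-elim (¬px tt)
... | false = refl

filterᵇ-accept : ∀ {A : Set} (p : A → Bool) {x xs} → T (p x) → filterᵇ p (x ∷ xs) ≡ x ∷ filterᵇ p xs
filterᵇ-accept p {x} px with p x
... | true = refl

-- Induction along the sorted list: links of earlier segments stay below the current one, links of
-- later segments start above it, and a segment of length one has no link of its own.
noIsolated⇒≢1 : ∀ {lo S} → Sorted lo S → T (noIsolated (graphOf S)) → All (_≢ 1) (lengths S)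
noIsolated⇒≢1 {S = S₀} so t = covered⇒≢1 so touched
  where
  touched : ∀ {v} → v ∈ vertices S₀ → ∃[ x ] ∃[ y ] (x , y) ∈ links S₀ × (v ≡ x ⊎ v ≡ y)
  touched {v} v∈ with anyᵇ⁻ {p = incident v} (links S₀) (allᵇ⁻ {p = λ u → anyᵇ (incident u) (links S₀)} t v∈)
  ... | (x , y) , e∈ , inc = x , y , e∈ , incident⁻ v x y inc
  covered⇒≢1 : ∀ {lo S} → Sorted lo S →
    (∀ {v} → v ∈ vertices S → ∃[ x ] ∃[ y ] (x , y) ∈ links S × (v ≡ x ⊎ v ≡ y)) → All (_≢ 1) (lengths S)
  covered⇒≢1 [] f = []
  covered⇒≢1 {S = (s , n) ∷ S} (lo≤s ∷ so) f = n≢1 so f ∷ covered⇒≢1 so later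
    where
    n≢1 : ∀ {n} → Sorted (s + n) S →
      (∀ {v} → v ∈ range s n ++ vertices S → ∃[ x ] ∃[ y ] (x , y) ∈ chain s n ++ links S × (v ≡ x ⊎ v ≡ y)) → n ≢ 1
    n≢1 so f refl with f (here refl)
    ... | x , y , e∈ , inc with ∈-links so e∈
    ... | refl , s<x with inc
    ... | inj₁ refl = m+1+n≰m x s<x
    ... | inj₂ refl = m+1+n≰m x (≤-trans (+-monoˡ-≤ 1 (n≤1+n x)) s<x)
    later : ∀ {v} → v ∈ vertices S → ∃[ x ] ∃[ y ] (x , y) ∈ links S × (v ≡ x ⊎ v ≡ y)
    later v∈ with f (∈-++⁺ʳ (range s n) v∈)
    ... | x , y , e∈ , inc with ∈-++⁻ (chain s n) e∈
    ... | inj₂ e∈ʳ = x , y , e∈ʳ , inc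
    ... | inj₁ e∈ˡ with ∈-chain s n e∈ˡ | ∈-vertices so v∈ | inc
    ... | refl , _ , x< | le | inj₁ refl = ⊥-elim (<-irrefl refl (≤-trans (<⇒≤ x<) le))
    ... | refl , _ , x< | le | inj₂ refl = ⊥-elim (<-irrefl refl (≤-trans x< le))

≢1⇒noIsolated : ∀ S → All (_≢ 1) (lengths S) → T (noIsolated (graphOf S))
≢1⇒noIsolated S ok = allᵇ⁺ (vertices S) λ v∈ →
  let (e , e∈ , inc) = covered S ok v∈ in anyᵇ⁺ e∈ inc
  where
  covered-range : ∀ s n {v} → v ∈ range s (suc (suc n)) → ∃[ e ] e ∈ chain s (suc (suc n)) × T (incident v e)
  covered-range s n (here refl) = _ , here refl , incident⁺ s s (suc s) (inj₁ refl)
  covered-range s n (there (here refl)) = _ , here refl , incident⁺ (suc s) s (suc s) (inj₂ refl)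
  covered-range s (suc n) (there (there v∈)) =
    let (e , e∈ , inc) = covered-range (suc s) n (there v∈) in e , there e∈ , inc
  covered : ∀ S → All (_≢ 1) (lengths S) → ∀ {v} → v ∈ vertices S → ∃[ e ] e ∈ links S × T (incident v e)
  covered ((s , n) ∷ S) (n≢1 ∷ ok) v∈ with ∈-++⁻ (range s n) v∈
  covered ((s , 1) ∷ S) (n≢1 ∷ ok) v∈ | inj₁ v∈ˡ = ⊥-elim (n≢1 refl)
  covered ((s , suc (suc n)) ∷ S) (n≢1 ∷ ok) v∈ | inj₁ v∈ˡ =
    let (e , e∈ , inc) = covered-range s n v∈ˡ in e , ∈-++⁺ˡ e∈ , inc
  covered ((s , n) ∷ S) (n≢1 ∷ ok) v∈ | inj₂ v∈ʳ =
    let (e , e∈ , inc) = covered S ok v∈ʳ in e , ∈-++⁺ʳ (chain s n) e∈ , inc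

-- Deletions and cuts of segments

data Delete : ℕ → Segments → Segments → Set where
  delete : ∀ s a b {S} → Delete (s + a) ((s , suc (a + b)) ∷ S) ((s , a) ∷ (suc (s + a) , b) ∷ S)
  skip   : ∀ {v g S S′} → Delete v S S′ → Delete v (g ∷ S) (g ∷ S′)

data Cut : Segments → Segments → Set where
  cut  : ∀ s a b {S} → Cut ((s , suc a + suc b) ∷ S) ((s , suc a) ∷ (s + suc a , suc b) ∷ S)
  skip : ∀ {g S S′} → Cut S S′ → Cut (g ∷ S) (g ∷ S′)

range-++ : ∀ s a b → range s (a + b) ≡ range s a ++ range (s + a) b
range-++ s zero    b = cong (λ t → range t b) (sym (+-identityʳ s))
range-++ s (suc a) b = cong (s ∷_) (trans (range-++ (suc s) a b) (cong (λ t → range (suc s) a ++ range t b) (sym (+-suc s a))))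

delete-sorted : ∀ {lo v S S′} → Delete v S S′ → Sorted lo S → Sorted lo S′
delete-sorted (delete s a b {S}) (lo≤s ∷ so) =
  lo≤s ∷ (n≤1+n (s + a) ∷ subst (λ t → Sorted t S) (trans (+-suc s (a + b)) (cong suc (sym (+-assoc s a b)))) so)
delete-sorted (skip d) (lo≤s ∷ so) = lo≤s ∷ delete-sorted d so

cut-sorted : ∀ {lo S S′} → Cut S S′ → Sorted lo S → Sorted lo S′
cut-sorted (cut s a b {S}) (lo≤s ∷ so) =
  lo≤s ∷ (≤-refl ∷ subst (λ t → Sorted t S) (sym (+-assoc s (suc a) (suc b))) so)
cut-sorted (skip d) (lo≤s ∷ so) = lo≤s ∷ cut-sorted d so

∈-delete : ∀ {v S S′} → Delete v S S′ → v ∈ vertices S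
∈-delete (delete s a b {S}) = ∈-++⁺ˡ (subst (s + a ∈_) (sym eq) (∈-++⁺ʳ (range s a) (here refl)))
  where
  eq : range s (suc (a + b)) ≡ range s a ++ range (s + a) (suc b)
  eq = trans (cong (range s) (sym (+-suc a b))) (range-++ s a (suc b))
∈-delete (skip {g = s , n} d) = ∈-++⁺ʳ (range s n) (∈-delete d)

split-range : ∀ s n {v} → v ∈ range s n → ∃[ a ] ∃[ b ] n ≡ suc (a + b) × v ≡ s + a
split-range s (suc n) (here refl) = 0 , n , refl , sym (+-identityʳ s)
split-range s (suc n) (there v∈) with split-range (suc s) n v∈
... | a , b , refl , refl = suc a , b , refl , sym (+-suc s a)

∈⇒delete : ∀ S {v} → v ∈ vertices S → ∃[ S′ ] Delete v S S′
∈⇒delete ((s , n) ∷ S) v∈ with ∈-++⁻ (range s n) v∈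
... | inj₂ v∈ʳ = let (S′ , d) = ∈⇒delete S v∈ʳ in _ , skip d
... | inj₁ v∈ˡ with split-range s n v∈ˡ
... | a , b , refl , refl = _ , delete s a b

-- The filters respect the order of the lists, so the result is literally the graph of the new
-- segments: everything below and above v survives, and only v with its at most two links goes.
deleteVertex-graphOf : ∀ {lo v S S′} → Delete v S S′ → Sorted lo S → deleteVertex v (graphOf S) ≡ graphOf S′
deleteVertex-graphOf d so = cong₂ graph (onVertices d so) (onLinks d so)
  where
  other : ℕ → ℕ → Bool
  other v u = not (u ≡ᵇ v)
  away : ℕ → ℕ × ℕ → Bool
  away v e = not (incident v e)
  above : ∀ {lo v S} → Sorted lo S → v < lo → filterᵇ (other v) (vertices S) ≡ vertices S
  above {lo} {v} {S} so v<lo = filterᵇ-all (other v) (vertices S) λ {u} u∈ → ≢⇒T u v λ { refl → <-irrefl refl (≤-trans v<lo (∈-vertices so u∈)) }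
  awayAbove : ∀ {v x} → v < x → T (away v (x , suc x))
  awayAbove {v} {x} v<x = T-not⁺ λ t → [ (λ { refl → <-irrefl refl v<x }) , (λ { refl → <-irrefl refl (<-trans (n<1+n _) v<x) }) ]′ (incident⁻ v x (suc x) t)
  awayBelow : ∀ {v x} → suc x < v → T (away v (x , suc x))
  awayBelow {v} {x} x<v = T-not⁺ λ t → [ (λ { refl → <-irrefl refl (<-trans (n<1+n _) x<v) }) , (λ { refl → <-irrefl refl x<v }) ]′ (incident⁻ v x (suc x) t)
  aboveLinks : ∀ {lo v S} → Sorted lo S → v < lo → filterᵇ (away v) (links S) ≡ links S
  aboveLinks {lo} {v} {S} so v<lo = filterᵇ-all (away v) (links S) keep
    where
    keep : ∀ {e} → e ∈ links S → T (away v e)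
    keep {x , y} e∈ with ∈-links so e∈
    ... | refl , lo≤x = awayAbove (≤-trans v<lo lo≤x)
  within : ∀ s a b → filterᵇ (other (s + a)) (range s (suc (a + b))) ≡ range s a ++ range (suc (s + a)) b
  within s a b = trans (cong (filterᵇ (other (s + a))) (trans (cong (range s) (sym (+-suc a b))) (range-++ s a (suc b))))
    (trans (filterᵇ-++ (other (s + a)) (range s a) (range (s + a) (suc b))) (cong₂ _++_
      (filterᵇ-all (other (s + a)) (range s a) λ {u} u∈ → ≢⇒T u (s + a) λ { refl → <-irrefl refl (proj₂ (∈-range s a u∈)) })
      (trans (filterᵇ-reject (other (s + a)) {s + a} {range (suc (s + a)) b} (λ t → T-not⁻ t (≡⇒≡ᵇ (s + a) (s + a) refl)))
        (filterᵇ-all (other (s + a)) (range (suc (s + a)) b) λ {u} u∈ → ≢⇒T u (s + a) λ { refl → <-irrefl refl (proj₁ (∈-range (suc (s + a)) b u∈)) }))))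
  atStart : ∀ s b → filterᵇ (away s) (chain s (suc b)) ≡ chain (suc s) b
  atStart s zero    = refl
  atStart s (suc b) = trans (filterᵇ-reject (away s) {s , suc s} {chain (suc s) (suc b)} (λ t → T-not⁻ t (incident⁺ s s (suc s) (inj₁ refl))))
    (filterᵇ-all (away s) (chain (suc s) (suc b)) keep)
    where
    keep : ∀ {e} → e ∈ chain (suc s) (suc b) → T (away s e)
    keep {x , y} e∈ with ∈-chain (suc s) (suc b) e∈
    ... | refl , s<x , _ = awayAbove s<x
  -- v stays fixed while s grows and a shrinks, until the link that ends in v comes first.
  withinLinks : ∀ s a b {v} → v ≡ s + a → filterᵇ (away v) (chain s (suc (a + b))) ≡ chain s a ++ chain (suc v) b
  withinLinks s zero    b eq rewrite trans eq (+-identityʳ s) = atStart s b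
  withinLinks s (suc zero) b eq rewrite trans eq (+-comm s 1) =
    trans (filterᵇ-reject (away (suc s)) {s , suc s} {chain (suc s) (suc b)}
      (λ t → T-not⁻ t (incident⁺ (suc s) s (suc s) (inj₂ refl)))) (atStart (suc s) b)
  withinLinks s (suc (suc a)) b {v} eq = trans
    (filterᵇ-accept (away v) {s , suc s} {chain (suc s) (suc (suc a + b))} (awayBelow
      (≤-trans (s≤s (s≤s (m≤m+n s a))) (≤-reflexive (sym (trans eq (trans (+-suc s (suc a)) (cong suc (+-suc s a)))))))))
    (cong ((s , suc s) ∷_) (withinLinks (suc s) (suc a) b (trans eq (+-suc s (suc a)))))
  bound : ∀ s a b → s + a < s + suc (a + b)
  bound s a b = +-monoʳ-< s (s≤s (m≤m+n a b))
  onVertices : ∀ {lo v S S′} → Delete v S S′ → Sorted lo S → filterᵇ (other v) (vertices S) ≡ vertices S′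
  onVertices (delete s a b {S}) (lo≤s ∷ so) = trans (filterᵇ-++ (other (s + a)) (range s (suc (a + b))) (vertices S))
    (trans (cong₂ _++_ (within s a b) (above so (bound s a b))) (++-assoc (range s a) _ _))
  onVertices {v = v} (skip {g = s , n} {S = S} d) (lo≤s ∷ so) = trans (filterᵇ-++ (other v) (range s n) (vertices S))
    (cong₂ _++_ (filterᵇ-all (other v) (range s n) λ {u} u∈ → ≢⇒T u v λ { refl →
         <-irrefl refl (≤-trans (proj₂ (∈-range s n u∈)) (∈-vertices so (∈-delete d))) })
      (onVertices d so))
  onLinks : ∀ {lo v S S′} → Delete v S S′ → Sorted lo S → filterᵇ (away v) (links S) ≡ links S′
  onLinks (delete s a b {S}) (lo≤s ∷ so) = trans (filterᵇ-++ (away (s + a)) (chain s (suc (a + b))) (links S))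
    (trans (cong₂ _++_ (withinLinks s a b refl) (aboveLinks so (bound s a b))) (++-assoc (chain s a) _ _))
  onLinks {v = v} (skip {g = s , n} {S = S} d) (lo≤s ∷ so) = trans (filterᵇ-++ (away v) (chain s n) (links S))
    (cong₂ _++_ (filterᵇ-all (away v) (chain s n) keep) (onLinks d so))
    where
    keep : ∀ {e} → e ∈ chain s n → T (away v e)
    keep {x , y} e∈ with ∈-chain s n e∈
    ... | refl , _ , x< = awayBelow (≤-trans x< (∈-vertices so (∈-delete d)))

cut-vertices : ∀ {S S′} → Cut S S′ → vertices S′ ≡ vertices S
cut-vertices (cut s a b {S}) =
  trans (sym (++-assoc (range s (suc a)) _ _)) (cong (_++ vertices S) (sym (range-++ s (suc a) (suc b))))
cut-vertices (skip {g = s , n} d) = cong (range s n ++_) (cut-vertices d)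

∈-removeOne-++⁻ : ∀ {A : Set} (xs : List A) {ys zs} → zs ∈ removeOne (xs ++ ys) →
  (∃[ xs′ ] xs′ ∈ removeOne xs × zs ≡ xs′ ++ ys) ⊎ (∃[ ys′ ] ys′ ∈ removeOne ys × zs ≡ xs ++ ys′)
∈-removeOne-++⁻ []       zs∈ = inj₂ (_ , zs∈ , refl)
∈-removeOne-++⁻ (x ∷ xs) (here refl) = inj₁ (xs , here refl , refl)
∈-removeOne-++⁻ (x ∷ xs) (there zs∈) with ∈-map⁻ (x ∷_) zs∈
... | ws , ws∈ , refl with ∈-removeOne-++⁻ xs ws∈
... | inj₁ (xs′ , xs′∈ , refl) = inj₁ (x ∷ xs′ , there (∈-map⁺ (x ∷_) xs′∈) , refl)
... | inj₂ (ys′ , ys′∈ , refl) = inj₂ (ys′ , ys′∈ , refl)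

∈-removeOne-++⁺ˡ : ∀ {A : Set} {xs xs′ : List A} ys → xs′ ∈ removeOne xs → xs′ ++ ys ∈ removeOne (xs ++ ys)
∈-removeOne-++⁺ˡ {xs = x ∷ xs} ys (here refl) = here refl
∈-removeOne-++⁺ˡ {xs = x ∷ xs} ys (there xs′∈) with ∈-map⁻ (x ∷_) xs′∈
... | ws , ws∈ , refl = there (∈-map⁺ (x ∷_) (∈-removeOne-++⁺ˡ ys ws∈))

∈-removeOne-++⁺ʳ : ∀ {A : Set} (xs : List A) {ys ys′} → ys′ ∈ removeOne ys → xs ++ ys′ ∈ removeOne (xs ++ ys)
∈-removeOne-++⁺ʳ []       ys′∈ = ys′∈
∈-removeOne-++⁺ʳ (x ∷ xs) ys′∈ = there (∈-map⁺ (x ∷_) (∈-removeOne-++⁺ʳ xs ys′∈))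

∈-removeOne-chain⁻ : ∀ s n {es} → es ∈ removeOne (chain s n) →
  ∃[ a ] ∃[ b ] n ≡ suc a + suc b × es ≡ chain s (suc a) ++ chain (s + suc a) (suc b)
∈-removeOne-chain⁻ s (suc (suc n)) (here refl) = 0 , n , refl , cong (λ t → chain t (suc n)) (+-comm 1 s)
∈-removeOne-chain⁻ s (suc (suc n)) (there es∈) with ∈-map⁻ ((s , suc s) ∷_) es∈
... | ws , ws∈ , refl with ∈-removeOne-chain⁻ (suc s) (suc n) ws∈
... | a , b , refl , refl = suc a , b , refl ,
  cong (λ t → (s , suc s) ∷ chain (suc s) (suc a) ++ chain t (suc b)) (sym (+-suc s (suc a)))

∈-removeOne-chain⁺ : ∀ s a b → chain s (suc a) ++ chain (s + suc a) (suc b) ∈ removeOne (chain s (suc a + suc b))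
∈-removeOne-chain⁺ s zero    b = here (cong (λ t → chain t (suc b)) (+-comm s 1))
∈-removeOne-chain⁺ s (suc a) b = there (∈-map⁺ ((s , suc s) ∷_)
  (subst (λ t → chain (suc s) (suc a) ++ chain t (suc b) ∈ removeOne (chain (suc s) (suc a + suc b))) (sym (+-suc s (suc a)))
    (∈-removeOne-chain⁺ (suc s) a b)))

cut-links⁺ : ∀ {S S′} → Cut S S′ → links S′ ∈ removeOne (links S)
cut-links⁺ (cut s a b {S}) = subst (_∈ removeOne (chain s (suc a + suc b) ++ links S)) (++-assoc (chain s (suc a)) _ _)
  (∈-removeOne-++⁺ˡ (links S) (∈-removeOne-chain⁺ s a b))
cut-links⁺ (skip {g = s , n} d) = ∈-removeOne-++⁺ʳ (chain s n) (cut-links⁺ d)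

cut-links⁻ : ∀ S {es} → es ∈ removeOne (links S) → ∃[ S′ ] Cut S S′ × es ≡ links S′
cut-links⁻ ((s , n) ∷ S) es∈ with ∈-removeOne-++⁻ (chain s n) es∈
... | inj₂ (es′ , es′∈ , refl) = let (S′ , d , eq) = cut-links⁻ S es′∈ in _ , skip d , cong (chain s n ++_) eq
... | inj₁ (es′ , es′∈ , refl) with ∈-removeOne-chain⁻ s n es′∈
... | a , b , refl , refl = _ , cut s a b , ++-assoc (chain s (suc a)) _ _

lengths-delete : ∀ {v S S′} → Delete v S S′ → All (_≢ 1) (lengths S) → All (_≢ 1) (lengths S′) →
                        Step Lft (lengths S) (lengths S′)
lengths-delete (delete s a b) (n≢1 ∷ _) (a≢1 ∷ b≢1 ∷ _) = delete a b a≢1 b≢1 (3≤ a b n≢1 a≢1 b≢1)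
  where
  3≤ : ∀ a b → suc (a + b) ≢ 1 → a ≢ 1 → b ≢ 1 → 3 ≤ suc (a + b)
  3≤ zero zero n≢1 _ _ = ⊥-elim (n≢1 refl)
  3≤ zero (suc zero) _ _ b≢1 = ⊥-elim (b≢1 refl)
  3≤ zero (suc (suc b)) _ _ _ = s≤s (s≤s (s≤s z≤n))
  3≤ (suc zero) b _ a≢1 _ = ⊥-elim (a≢1 refl)
  3≤ (suc (suc a)) b _ _ _ = s≤s (s≤s (s≤s z≤n))
lengths-delete (skip d) (_ ∷ ok) (_ ∷ ok′) = skip (lengths-delete d ok ok′)

lengths-cut : ∀ {S S′} → Cut S S′ → All (_≢ 1) (lengths S′) → Step Rgt (lengths S) (lengths S′)
lengths-cut (cut s a b) (a≢1 ∷ b≢1 ∷ _) = cut (suc a) (suc b) (2≤ a a≢1) (2≤ b b≢1)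
  where
  2≤ : ∀ a → suc a ≢ 1 → 2 ≤ suc a
  2≤ zero    a≢1 = ⊥-elim (a≢1 refl)
  2≤ (suc a) _   = s≤s (s≤s z≤n)
lengths-cut (skip d) (_ ∷ ok) = skip (lengths-cut d ok)

delete⁻ : ∀ S {ℓ′} → Step Lft (lengths S) ℓ′ → All (_≢ 1) (lengths S) →
          ∃[ v ] ∃[ S′ ] Delete v S S′ × lengths S′ ≡ ℓ′ × All (_≢ 1) (lengths S′)
delete⁻ ((s , _) ∷ S) (delete a b a≢1 b≢1 _) (_ ∷ ok) = s + a , _ , delete s a b , refl , a≢1 ∷ b≢1 ∷ ok
delete⁻ ((s , n) ∷ S) (skip st) (n≢1 ∷ ok) with delete⁻ S st ok
... | v , S′ , d , refl , ok′ = v , _ , skip d , refl , n≢1 ∷ ok′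

cut⁻ : ∀ S {ℓ′} → Step Rgt (lengths S) ℓ′ → All (_≢ 1) (lengths S) →
       ∃[ S′ ] Cut S S′ × lengths S′ ≡ ℓ′ × All (_≢ 1) (lengths S′)
cut⁻ ((s , _) ∷ S) (cut (suc a) (suc b) (s≤s (s≤s _)) (s≤s (s≤s _))) (_ ∷ ok) = _ , cut s a b , refl , (λ ()) ∷ (λ ()) ∷ ok
cut⁻ ((s , n) ∷ S) (skip st) (n≢1 ∷ ok) with cut⁻ S st ok
... | S′ , d , refl , ok′ = _ , skip d , refl , n≢1 ∷ ok′

-- The game of a graph follows its path lengths

moves : Player → Graph → List Graph
moves Lft = leftMoves
moves Rgt = rightMoves

∈-legal⁻ : ∀ p {lo} S → Sorted lo S → All (_≢ 1) (lengths S) → ∀ {g} → g ∈ legal (moves p (graphOf S)) →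
  ∃[ S′ ] g ≡ graphOf S′ × Sorted lo S′ × All (_≢ 1) (lengths S′) × Step p (lengths S) (lengths S′)
∈-legal⁻ Lft S so ok g∈ with ∈-filterᵇ⁻ (leftMoves (graphOf S)) g∈
... | g∈′ , iso with ∈-map⁻ (λ v → deleteVertex v (graphOf S)) g∈′
... | v , v∈ , refl with ∈⇒delete S v∈
... | S′ , d = S′ , eq , so′ , ok′ , lengths-delete d ok ok′
  where
  eq = deleteVertex-graphOf d so
  so′ = delete-sorted d so
  ok′ = noIsolated⇒≢1 so′ (subst (T ∘ noIsolated) eq iso)
∈-legal⁻ Rgt S so ok g∈ with ∈-filterᵇ⁻ (rightMoves (graphOf S)) g∈
... | g∈′ , iso with ∈-map⁻ (graph (vertices S)) g∈′
... | es , es∈ , refl with cut-links⁻ S es∈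
... | S′ , d , refl = S′ , eq , so′ , ok′ , lengths-cut d ok′
  where
  eq = cong (λ vs → graph vs (links S′)) (sym (cut-vertices d))
  so′ = cut-sorted d so
  ok′ = noIsolated⇒≢1 so′ (subst (T ∘ noIsolated) eq iso)

∈-legal⁺ : ∀ p {lo} S → Sorted lo S → All (_≢ 1) (lengths S) → ∀ {ℓ′} → Step p (lengths S) ℓ′ →
  ∃[ S′ ] graphOf S′ ∈ legal (moves p (graphOf S)) × Sorted lo S′ × All (_≢ 1) (lengths S′) × lengths S′ ≡ ℓ′
∈-legal⁺ Lft S so ok st with delete⁻ S st ok
... | v , S′ , d , eq , ok′ = S′ ,
  ∈-filterᵇ⁺ {p = noIsolated}
    (subst (_∈ leftMoves (graphOf S)) (deleteVertex-graphOf d so) (∈-map⁺ (λ v → deleteVertex v (graphOf S)) (∈-delete d)))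
    (≢1⇒noIsolated S′ ok′) ,
  delete-sorted d so , ok′ , eq
∈-legal⁺ Rgt S so ok st with cut⁻ S st ok
... | S′ , d , eq , ok′ = S′ ,
  ∈-filterᵇ⁺ {p = noIsolated}
    (subst (λ vs → graph vs (links S′) ∈ rightMoves (graphOf S)) (sym (cut-vertices d)) (∈-map⁺ (graph (vertices S)) (cut-links⁺ d)))
    (≢1⇒noIsolated S′ ok′) ,
  cut-sorted d so , ok′ , eq

-- The vertices plus edges of a path: the fuel in `gameOf`, and a quantity that every move lowers in
-- the later inductions.
weight : ℕ → ℕ
weight n = n + (n ∸ 1)

step-weight : ∀ {p ℓ ℓ′} → Step p ℓ ℓ′ → total weight ℓ′ < total weight ℓ
step-weight (delete a b {ℓ} _ _ _) = ≤-trans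
  (s≤s (≤-reflexive (sym (+-assoc (weight a) (weight b) (total weight ℓ)))))
  (+-monoˡ-≤ (total weight ℓ) (≤-trans (s≤s (+-mono-≤ (+-monoʳ-≤ a (m∸n≤m a 1)) (+-monoʳ-≤ b (m∸n≤m b 1))))
    (≤-reflexive (rearrange a b))))
  where
  rearrange : ∀ a b → suc (a + a + (b + b)) ≡ suc (a + b) + (a + b)
  rearrange = solve-∀
step-weight (cut (suc a) (suc b) {ℓ} _ _) = ≤-trans
  (s≤s (≤-reflexive (sym (+-assoc (weight (suc a)) (weight (suc b)) (total weight ℓ)))))
  (+-monoˡ-≤ (total weight ℓ) (≤-reflexive (rearrange a b)))
  where
  rearrange : ∀ a b → suc (suc a + a + (suc b + b)) ≡ suc (a + suc b) + (a + suc b)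
  rearrange = solve-∀
step-weight (skip {n = n} st) = +-monoʳ-< (weight n) (step-weight st)

gameFuel-live : ∀ k g {x y} → x ∈ legal (leftMoves g) → y ∈ legal (rightMoves g) →
  ∀ p → options p (gameFuel (suc k) g) ≡ map (gameFuel k) (legal (moves p g))
gameFuel-live k g x∈ y∈ p with legal (leftMoves g) in eqL | legal (rightMoves g) in eqR
gameFuel-live k g () y∈ p | [] | _
gameFuel-live k g x∈ () p | _ ∷ _ | []
gameFuel-live k g x∈ y∈ Lft | _ ∷ _ | _ ∷ _ rewrite eqL = refl
gameFuel-live k g x∈ y∈ Rgt | _ ∷ _ | _ ∷ _ rewrite eqR = refl

gameFuel-over : ∀ k g → (∀ {y} → ¬ y ∈ legal (rightMoves g)) → gameFuel k g ≡ zeroG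
gameFuel-over zero    g none = refl
gameFuel-over (suc k) g none with legal (leftMoves g) | legal (rightMoves g)
... | []    | _      = refl
... | _ ∷ _ | []     = refl
... | _ ∷ _ | _ ∷ _  = ⊥-elim (none (here refl))

-- A path of length at least four offers a move to both players, so the Mutual Failures clause ends
-- the game only at rank 0.
rank≥1⇒step : ∀ p ℓ → 1 ≤ rank ℓ → ∃[ ℓ′ ] Step p ℓ ℓ′
rank≥1⇒step Lft (suc (suc (suc (suc n))) ∷ ℓ) _ = _ , delete 0 (3 + n) (λ ()) (λ ()) (s≤s (s≤s (s≤s z≤n)))
rank≥1⇒step Rgt (suc (suc (suc (suc n))) ∷ ℓ) _ = _ , cut 2 (2 + n) (s≤s (s≤s z≤n)) (s≤s (s≤s z≤n))
rank≥1⇒step p (0 ∷ ℓ) r≥1 = let (_ , st) = rank≥1⇒step p ℓ r≥1 in _ , skip st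
rank≥1⇒step p (1 ∷ ℓ) r≥1 = let (_ , st) = rank≥1⇒step p ℓ r≥1 in _ , skip st
rank≥1⇒step p (2 ∷ ℓ) r≥1 = let (_ , st) = rank≥1⇒step p ℓ r≥1 in _ , skip st
rank≥1⇒step p (3 ∷ ℓ) r≥1 = let (_ , st) = rank≥1⇒step p ℓ r≥1 in _ , skip st

cut-rank : ∀ {ℓ ℓ′} → Step Rgt ℓ ℓ′ → 1 ≤ rank ℓ
cut-rank (cut (suc (suc a)) (suc (suc b)) {ℓ} (s≤s (s≤s _)) (s≤s (s≤s _))) =
  ≤-trans (subst (λ t → 1 ≤ ρ t) (cong (suc ∘ suc) (sym (trans (+-suc a (suc b)) (cong suc (+-suc a b))))) (s≤s z≤n)) (m≤m+n _ (rank ℓ))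
cut-rank (skip {n = n} st) = ≤-trans (cut-rank st) (m≤n+m _ (ρ n))

-- Fuel cannot run out early: at positive rank some step exists and lowers the weight, which is
-- impossible when the weight is already 0.
plays : ∀ k {lo} S → Sorted lo S → All (_≢ 1) (lengths S) → total weight (lengths S) ≤ k →
        Plays (lengths S) (gameFuel k (graphOf S))
plays k S so ok w≤k with rank (lengths S) in eq
... | zero = subst (Plays (lengths S)) (sym (gameFuel-over k (graphOf S) none)) (over eq)
  where
  none : ∀ {y} → ¬ y ∈ legal (rightMoves (graphOf S))
  none y∈ with ∈-legal⁻ Rgt S so ok y∈
  ... | _ , _ , _ , _ , st = 1+n≰n (subst (1 ≤_) eq (cut-rank st))
plays zero S so ok w≤k | suc r with rank≥1⇒step Lft (lengths S) (subst (1 ≤_) (sym eq) (s≤s z≤n))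
... | _ , st = ⊥-elim (n≮0 (≤-trans (step-weight st) w≤k))
plays (suc k) S so ok w≤k | suc r = live r≥1 sound complete
  where
  r≥1 : 1 ≤ rank (lengths S)
  r≥1 = subst (1 ≤_) (sym eq) (s≤s z≤n)
  opts : ∀ p → options p (gameFuel (suc k) (graphOf S)) ≡ map (gameFuel k) (legal (moves p (graphOf S)))
  opts = gameFuel-live k (graphOf S)
    (proj₁ (proj₂ (∈-legal⁺ Lft S so ok (proj₂ (rank≥1⇒step Lft _ r≥1)))))
    (proj₁ (proj₂ (∈-legal⁺ Rgt S so ok (proj₂ (rank≥1⇒step Rgt _ r≥1)))))
  sound : ∀ p {x} → x ∈ options p (gameFuel (suc k) (graphOf S)) → ∃[ ℓ′ ] Step p (lengths S) ℓ′ × Plays ℓ′ x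
  sound p {x} x∈ with ∈-map⁻ (gameFuel k) (subst (x ∈_) (opts p) x∈)
  ... | g , g∈ , refl with ∈-legal⁻ p S so ok g∈
  ... | S′ , refl , so′ , ok′ , st = lengths S′ , st , plays k S′ so′ ok′ (≤-pred (≤-trans (step-weight st) w≤k))
  complete : ∀ p {ℓ′} → Step p (lengths S) ℓ′ → ∃[ x ] x ∈ options p (gameFuel (suc k) (graphOf S)) × Plays ℓ′ x
  complete p st with ∈-legal⁺ p S so ok st
  ... | S′ , g∈ , so′ , ok′ , refl =
    gameFuel k (graphOf S′) , subst (gameFuel k (graphOf S′) ∈_) (sym (opts p)) (∈-map⁺ (gameFuel k) g∈) ,
    plays k S′ so′ ok′ (≤-pred (≤-trans (step-weight st) w≤k))

upToList≡range : ∀ n → upToList n ≡ range 0 n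
upToList≡range zero    = refl
upToList≡range (suc n) = trans (cong (_++ n ∷ []) (upToList≡range n))
  (trans (sym (range-++ 0 n 1)) (cong (range 0) (+-comm n 1)))

chain-snoc : ∀ s n → chain s (suc (suc n)) ≡ chain s (suc n) ++ (s + n , suc (s + n)) ∷ []
chain-snoc s zero    = cong (λ t → (t , suc t) ∷ []) (sym (+-identityʳ s))
chain-snoc s (suc n) = cong ((s , suc s) ∷_) (trans (chain-snoc (suc s) n)
  (cong (λ t → chain (suc s) (suc n) ++ (t , suc t) ∷ []) (sym (+-suc s n))))

pathEdges≡chain : ∀ n → pathEdges n ≡ chain 0 n
pathEdges≡chain 0             = refl
pathEdges≡chain 1             = refl
pathEdges≡chain (suc (suc n)) = trans (cong (_++ (n , suc n) ∷ []) (pathEdges≡chain (suc n))) (sym (chain-snoc 0 n))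

length-range : ∀ s n → length (range s n) ≡ n
length-range s zero    = refl
length-range s (suc n) = cong suc (length-range (suc s) n)

length-chain : ∀ s n → length (chain s n) ≡ n ∸ 1
length-chain s 0             = refl
length-chain s 1             = refl
length-chain s (suc (suc n)) = cong suc (length-chain (suc s) (suc n))

plays-P : ∀ n → n ≢ 1 → Plays (n ∷ []) (P n)
plays-P n n≢1 = subst (Plays (n ∷ [])) (sym eq)
  (plays (weight n) ((0 , n) ∷ []) (z≤n ∷ []) (n≢1 ∷ []) (≤-reflexive (+-identityʳ (weight n))))
  where
  path : pathGraph n ≡ graphOf ((0 , n) ∷ [])
  path = cong₂ graph (trans (upToList≡range n) (sym (++-identityʳ _))) (trans (pathEdges≡chain n) (sym (++-identityʳ _)))
  eq : P n ≡ gameFuel (weight n) (graphOf ((0 , n) ∷ []))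
  eq = trans (cong (λ k → gameFuel k (pathGraph n)) (cong₂ _+_
         (trans (cong length (upToList≡range n)) (length-range 0 n))
         (trans (cong length (pathEdges≡chain n)) (length-chain 0 n))))
       (cong (gameFuel (weight n)) path)

-- Right's strategy

-- Removal of one entry; describing positions by what remains makes the order of the list
-- irrelevant.
data Pick (n : ℕ) : List ℕ → List ℕ → Set where
  here  : ∀ {ℓ} → Pick n (n ∷ ℓ) ℓ
  there : ∀ {m ℓ s} → Pick n ℓ s → Pick n (m ∷ ℓ) (m ∷ s)

pick-total : ∀ f {n ℓ s} → Pick n ℓ s → total f ℓ ≡ f n + total f s
pick-total f here = refl
pick-total f {n} (there {m} {ℓ} {s} p) = trans (cong (f m +_) (pick-total f p)) (exchange (f m) (f n) (total f s))
  where
  exchange : ∀ x y z → x + (y + z) ≡ y + (x + z)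
  exchange = solve-∀

pick-all : ∀ {Q : ℕ → Set} {n ℓ s} → Pick n ℓ s → Q n → All Q s → All Q ℓ
pick-all here      q qs       = q ∷ qs
pick-all (there p) q (q′ ∷ qs) = q′ ∷ pick-all p q qs

pick-swap : ∀ {m n ℓ s t} → Pick m ℓ s → Pick n s t → ∃[ s′ ] Pick n ℓ s′ × Pick m s′ t
pick-swap here      q         = _ , there q , here
pick-swap (there p) here      = _ , here , p
pick-swap (there p) (there q) = let (_ , q′ , p′) = pick-swap p q in _ , there q′ , there p′

pick-delete : ∀ a b {ℓ s} → a ≢ 1 → b ≢ 1 → 3 ≤ suc (a + b) → Pick (suc (a + b)) ℓ s →
              ∃[ ℓ′ ] ∃[ t ] Step Lft ℓ ℓ′ × Pick a ℓ′ t × Pick b t s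
pick-delete a b a≢1 b≢1 le here      = _ , _ , delete a b a≢1 b≢1 le , here , here
pick-delete a b a≢1 b≢1 le (there p) =
  let (_ , _ , st , pa , pb) = pick-delete a b a≢1 b≢1 le p in _ , _ , skip st , there pa , there pb

pick-cut : ∀ a b {ℓ s} → 2 ≤ a → 2 ≤ b → Pick (a + b) ℓ s →
           ∃[ ℓ′ ] ∃[ t ] Step Rgt ℓ ℓ′ × Pick a ℓ′ t × Pick b t s
pick-cut a b 2≤a 2≤b here      = _ , _ , cut a b 2≤a 2≤b , here , here
pick-cut a b 2≤a 2≤b (there p) =
  let (_ , _ , st , pa , pb) = pick-cut a b 2≤a 2≤b p in _ , _ , skip st , there pa , there pb

pick-total₂ : ∀ f {a b ℓ t s} → Pick a ℓ t → Pick b t s → total f ℓ ≡ f a + (f b + total f s)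
pick-total₂ f {a} p q = trans (pick-total f p) (cong (f a +_) (pick-total f q))

rank≥1⇒pick : ∀ ℓ → 1 ≤ rank ℓ → ∃[ n ] ∃[ s ] Pick (4 + n) ℓ s
rank≥1⇒pick (0 ∷ ℓ) r≥1 = let (_ , _ , p) = rank≥1⇒pick ℓ r≥1 in _ , _ , there p
rank≥1⇒pick (1 ∷ ℓ) r≥1 = let (_ , _ , p) = rank≥1⇒pick ℓ r≥1 in _ , _ , there p
rank≥1⇒pick (2 ∷ ℓ) r≥1 = let (_ , _ , p) = rank≥1⇒pick ℓ r≥1 in _ , _ , there p
rank≥1⇒pick (3 ∷ ℓ) r≥1 = let (_ , _ , p) = rank≥1⇒pick ℓ r≥1 in _ , _ , there p
rank≥1⇒pick (suc (suc (suc (suc n))) ∷ ℓ) r≥1 = n , ℓ , here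

ρ-suc : ∀ n → ρ (suc n) ≤ suc (ρ n)
ρ-suc 0 = z≤n
ρ-suc 1 = z≤n
ρ-suc 2 = z≤n
ρ-suc 3 = ≤-refl
ρ-suc (suc (suc (suc (suc n)))) = s≤s (ρ-suc (suc n))

ρ-mono-suc : ∀ n → ρ n ≤ ρ (suc n)
ρ-mono-suc 0 = z≤n
ρ-mono-suc 1 = z≤n
ρ-mono-suc 2 = z≤n
ρ-mono-suc 3 = z≤n
ρ-mono-suc (suc (suc (suc (suc n)))) = s≤s (ρ-mono-suc (suc n))

ρ-+3 : ∀ n → ρ (3 + n) ≤ suc (ρ n)
ρ-+3 0       = z≤n
ρ-+3 (suc n) = ≤-refl

ρ-delete : ∀ a b → ρ a + ρ b ≤ ρ (suc (a + b))
ρ-delete 0 b = ρ-mono-suc b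
ρ-delete 1 b = ≤-trans (ρ-mono-suc b) (ρ-mono-suc (suc b))
ρ-delete 2 b = ≤-trans (ρ-mono-suc b) (≤-trans (ρ-mono-suc (suc b)) (ρ-mono-suc (suc (suc b))))
ρ-delete 3 b = ≤-trans (n≤1+n _) (s≤s (ρ-mono-suc b))
ρ-delete (suc (suc (suc (suc a)))) b = s≤s (ρ-delete (suc a) b)

delete-rank : ∀ {ℓ ℓ′} → Step Lft ℓ ℓ′ → rank ℓ′ ≤ rank ℓ
delete-rank (delete a b {ℓ} _ _ _) = ≤-trans (≤-reflexive (sym (+-assoc (ρ a) (ρ b) (rank ℓ)))) (+-monoˡ-≤ (rank ℓ) (ρ-delete a b))
delete-rank (skip {n = n} st) = +-monoʳ-≤ (ρ n) (delete-rank st)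

-- Cutting off three vertices lowers ⌈n / 3⌉ by one. In P₄ this would isolate a vertex, so P₄ is
-- halved.
lowering-cut : ∀ ℓ → 1 ≤ rank ℓ → ∃[ ℓ′ ] Step Rgt ℓ ℓ′ × rank ℓ ≡ suc (rank ℓ′)
lowering-cut ℓ r≥1 with rank≥1⇒pick ℓ r≥1
... | zero , s , p = let (ℓ′ , t , st , pa , pb) = pick-cut 2 2 (s≤s (s≤s z≤n)) (s≤s (s≤s z≤n)) p in
  ℓ′ , st , trans (pick-total ρ p) (cong suc (sym (pick-total₂ ρ pa pb)))
... | suc n , s , p = let (ℓ′ , t , st , pa , pb) = pick-cut 3 (2 + n) (s≤s (s≤s z≤n)) (s≤s (s≤s z≤n)) p in
  ℓ′ , st , trans (pick-total ρ p) (cong suc (sym (pick-total₂ ρ pa pb)))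

rank0⇒zeroG : ∀ {ℓ G} → Plays ℓ G → rank ℓ ≡ 0 → G ≡ zeroG
rank0⇒zeroG (over _)       eq = refl
rank0⇒zeroG (live r≥1 _ _) eq = ⊥-elim (1+n≰n (subst (1 ≤_) eq r≥1))

plays-option : ∀ p {ℓ G x} → Plays ℓ G → x ∈ options p G → ∃[ ℓ′ ] Step p ℓ ℓ′ × Plays ℓ′ x
plays-option Lft (over _) ()
plays-option Rgt (over _) ()
plays-option p (live _ f _) x∈ = f p x∈

plays-step : ∀ p {ℓ ℓ′ G} → Plays ℓ G → 1 ≤ rank ℓ → Step p ℓ ℓ′ → ∃[ x ] x ∈ options p G × Plays ℓ′ x
plays-step p (over eq) r≥1 st = ⊥-elim (1+n≰n (subst (1 ≤_) eq r≥1))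
plays-step p (live _ _ g) r≥1 st = g p st

measure : List ℕ → ℕ → ℕ → ℕ
measure ℓ c j = total weight ℓ + (c + c + j)

measure-step : ∀ {p ℓ ℓ′ n} c j → Step p ℓ ℓ′ → measure ℓ c j < suc n → measure ℓ′ c j < n
measure-step c j st (s≤s m≤n) = ≤-trans (+-monoˡ-≤ (c + c + j) (step-weight st)) m≤n

measure-nim : ∀ {n} ℓ c {i j} → i < j → measure ℓ c j < suc n → measure ℓ c i < n
measure-nim ℓ c {i} i<j (s≤s m≤n) = ≤-trans (+-monoʳ-< (total weight ℓ) (+-monoʳ-< (c + c) i<j)) m≤n

measure-down : ∀ {n} ℓ c {i j} → i ≤ suc j → measure ℓ (suc c) j < suc n → measure ℓ c i < n
measure-down ℓ c {i} {j} i≤ (s≤s m≤n) =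
  ≤-trans (+-monoʳ-< (total weight ℓ) (s≤s (≤-trans (+-monoʳ-≤ (c + c) i≤) (≤-reflexive (shift c j))))) m≤n
  where
  shift : ∀ c j → c + c + suc j ≡ c + suc c + j
  shift = solve-∀

-- Dead remains: paths of length at most two admit no move of either player.
Light : List ℕ → Set
Light = All (_≤ 2)

Fours : List ℕ → Set
Fours = All (λ n → n ≡ 4 ⊎ n ≤ 2)

Short : List ℕ → Set
Short = All (_≤ 5)

total-light : ∀ f → f 0 ≡ 0 → f 1 ≡ 0 → f 2 ≡ 0 → ∀ {ℓ} → Light ℓ → total f ℓ ≡ 0
total-light f f0 f1 f2 [] = refl
total-light f f0 f1 f2 {n ∷ ℓ} (n≤2 ∷ li) = trans (cong₂ _+_ (small n n≤2) (total-light f f0 f1 f2 li)) refl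
  where
  small : ∀ n → n ≤ 2 → f n ≡ 0
  small 0 _ = f0
  small 1 _ = f1
  small 2 _ = f2
  small (suc (suc (suc _))) (s≤s (s≤s ()))

rank-light : ∀ {ℓ} → Light ℓ → rank ℓ ≡ 0
rank-light = total-light ρ refl refl refl

light⇒fours : ∀ {ℓ} → Light ℓ → Fours ℓ
light⇒fours = All.map inj₂

light⇒short : ∀ {ℓ} → Light ℓ → Short ℓ
light⇒short = All.map λ n≤2 → ≤-trans n≤2 (s≤s (s≤s z≤n))

-- Only an end vertex of P₄ can be deleted without isolating another vertex, and the resulting P₃
-- has rank 0.
fours-delete : ∀ {ℓ ℓ′} → Fours ℓ → Step Lft ℓ ℓ′ → rank ℓ ≡ suc (rank ℓ′)
fours-delete (inj₁ eq ∷ _) (delete a b {ℓ} a≢1 b≢1 _) = split a b {ℓ} a≢1 b≢1 (suc-injective eq)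
  where
  split : ∀ a b {ℓ} → a ≢ 1 → b ≢ 1 → a + b ≡ 3 → ρ (suc (a + b)) + rank ℓ ≡ suc (ρ a + (ρ b + rank ℓ))
  split 0 _ _ _ refl = refl
  split 1 _ a≢1 _ _ = ⊥-elim (a≢1 refl)
  split 2 1 _ b≢1 _ = ⊥-elim (b≢1 refl)
  split 3 0 _ _ _ = refl
fours-delete (inj₂ n≤2 ∷ _) (delete a b _ _ 3≤n) = ⊥-elim (1+n≰n (≤-trans 3≤n n≤2))
fours-delete {n ∷ ℓ} (_ ∷ fs) (skip {ℓ′ = ℓ′} st) = trans (cong (ρ n +_) (fours-delete fs st)) (+-suc (ρ n) (rank ℓ′))

-- P₄ and P₅ have rank 1, and a cut leaves pieces with at most three vertices.
short-cut : ∀ {ℓ ℓ′} → Short ℓ → Step Rgt ℓ ℓ′ → rank ℓ ≡ suc (rank ℓ′)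
short-cut (n≤5 ∷ _) (cut a b {ℓ} 2≤a 2≤b) = split a b {ℓ} 2≤a 2≤b n≤5
  where
  split : ∀ a b {ℓ} → 2 ≤ a → 2 ≤ b → a + b ≤ 5 → ρ (a + b) + rank ℓ ≡ suc (ρ a + (ρ b + rank ℓ))
  split 1 b (s≤s ()) _ _
  split a 1 _ (s≤s ()) _
  split 2 2 _ _ _ = refl
  split 2 3 _ _ _ = refl
  split 2 (suc (suc (suc (suc b)))) _ _ (s≤s (s≤s (s≤s (s≤s (s≤s ())))))
  split 3 2 _ _ _ = refl
  split 3 (suc (suc (suc b))) _ _ (s≤s (s≤s (s≤s (s≤s (s≤s ())))))
  split (suc (suc (suc (suc a)))) (suc (suc b)) _ _ (s≤s (s≤s (s≤s (s≤s le)))) = ⊥-elim (1+n≰n {1} (≤-trans (≤-trans (s≤s (s≤s z≤n)) (m≤n+m (suc (suc b)) a)) le))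
short-cut {n ∷ ℓ} (_ ∷ fs) (skip {ℓ′ = ℓ′} st) = trans (cong (ρ n +_) (short-cut fs st)) (+-suc (ρ n) (rank ℓ′))

-- The atomic weight of ℓ is at most u: the rank, except for P₄, P₄ + P₄, P₄ + P₆, P₈ and P₁₀.
data Upper (ℓ : List ℕ) (u : ℕ) : Set where
  general : rank ℓ ≤ u → Upper ℓ u
  four    : Fours ℓ → rank ℓ ≡ 1 → Upper ℓ u
  fours   : Fours ℓ → rank ℓ ≡ 2 → Upper ℓ u
  six     : ∀ {s} → Pick 6 ℓ s → Fours s → rank s ≡ 1 → 1 ≤ u → Upper ℓ u
  eight   : ∀ {s} → Pick 8 ℓ s → Light s → 1 ≤ u → Upper ℓ u
  ten     : ∀ {s} → Pick 10 ℓ s → Light s → 2 ≤ u → Upper ℓ u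

-- In most cases the rank exceeds the bound by at most one, so the rank itself serves after the
-- deletion. In `fours` the rank 2 may face the bound 0, but there every deletion lowers the rank.
upper-delete : ∀ {ℓ ℓ′ u} → Upper ℓ u → Step Lft ℓ ℓ′ → Upper ℓ′ (suc u)
upper-delete up st = general (bound up st)
  where
  bound : ∀ {ℓ ℓ′ u} → Upper ℓ u → Step Lft ℓ ℓ′ → rank ℓ′ ≤ suc u
  bound (general r≤u) st = m≤n⇒m≤1+n (≤-trans (delete-rank st) r≤u)
  bound (four _ r≡1) st = ≤-trans (delete-rank st) (≤-trans (≤-reflexive r≡1) (s≤s z≤n))
  bound (fours fs r≡2) st = ≤-trans (≤-reflexive (suc-injective (trans (sym (fours-delete fs st)) r≡2))) (s≤s z≤n)
  bound (six p _ r≡1 1≤u) st = ≤-trans (delete-rank st) (≤-trans (≤-reflexive (trans (pick-total ρ p) (cong suc r≡1))) (s≤s 1≤u))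
  bound (eight p li 1≤u) st = ≤-trans (delete-rank st) (≤-trans (≤-reflexive (trans (pick-total ρ p) (cong (2 +_) (rank-light li)))) (s≤s 1≤u))
  bound (ten p li 2≤u) st = ≤-trans (delete-rank st) (≤-trans (≤-reflexive (trans (pick-total ρ p) (cong (3 +_) (rank-light li)))) (s≤s 2≤u))

data RightPlan (ℓ : List ℕ) : ℕ → Set where
  done   : ∀ {u} → rank ℓ ≡ 0 → RightPlan ℓ u
  four   : ∀ {u} → Fours ℓ → rank ℓ ≡ 1 → RightPlan ℓ u
  fours  : ∀ {u} → Fours ℓ → rank ℓ ≡ 2 → RightPlan ℓ u
  lower  : ∀ {u ℓ′} → 1 ≤ rank ℓ → Step Rgt ℓ ℓ′ → Upper ℓ′ u → RightPlan ℓ (suc u)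

rightPlan : ∀ {ℓ u} → Upper ℓ u → RightPlan ℓ u
rightPlan {ℓ} (general r≤u) with rank ℓ in eq
... | zero = done eq
rightPlan {ℓ} {suc u} (general (s≤s r≤u)) | suc r with lowering-cut ℓ (subst (1 ≤_) (sym eq) (s≤s z≤n))
... | ℓ′ , st , eq′ = lower (cut-rank st) st (general (≤-trans (≤-reflexive (suc-injective (trans (sym eq′) eq))) r≤u))
rightPlan (four fs r≡1)  = four fs r≡1
rightPlan (fours fs r≡2) = fours fs r≡2
-- Cutting P₆ into P₄ + P₂ keeps the rank at 2 but reaches two copies of P₄, for which every bound
-- is valid.
rightPlan (six p fs r≡1 (s≤s _)) = let (_ , _ , st , pa , pb) = pick-cut 4 2 (s≤s (s≤s z≤n)) (s≤s (s≤s z≤n)) p in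
  lower (cut-rank st) st (fours (pick-all pa (inj₁ refl) (pick-all pb (inj₂ ≤-refl) fs)) (trans (pick-total₂ ρ pa pb) (cong suc r≡1)))
rightPlan (eight p li (s≤s _)) = let (_ , _ , st , pa , pb) = pick-cut 4 4 (s≤s (s≤s z≤n)) (s≤s (s≤s z≤n)) p in
  lower (cut-rank st) st (fours (pick-all pa (inj₁ refl) (pick-all pb (inj₁ refl) (light⇒fours li)))
    (trans (pick-total₂ ρ pa pb) (cong (2 +_) (rank-light li))))
rightPlan (ten p li (s≤s 1≤u)) = let (_ , _ , st , pa , pb) = pick-cut 6 4 (s≤s (s≤s z≤n)) (s≤s (s≤s z≤n)) p in
  lower (cut-rank st) st (six pa (pick-all pb (inj₁ refl) (light⇒fours li)) (trans (pick-total ρ pb) (cong suc (rank-light li))) 1≤u)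

-- Left can only turn a ↓ into *, which Right removes at once.
right-holds-done : ∀ {ℓ G} c → Plays ℓ G → rank ℓ ≡ 0 → RightHolds G c 0
right-holds-done {G = G} c pl eq = right-holds G c 0
  (λ H∈ → ⊥-elim (noOption Lft (subst (_ ∈_) (cong (options Lft) (rank0⇒zeroG pl eq)) H∈)))
  (λ { {c′} refl → right-plays-nim c′ (s≤s z≤n) (right-holds-done c′ pl eq) })
  (λ ())

right-wins-rank1 : ∀ {ℓ G} c → Plays ℓ G → rank ℓ ≡ 1 → RightWins G c 0
right-wins-rank1 {ℓ} c pl eq =
  let r≥1 = ≤-reflexive (sym eq)
      (ℓ′ , st , eq′) = lowering-cut ℓ r≥1
      (_ , x∈ , pl′) = plays-step Rgt pl r≥1 st
  in right-plays-component c 0 x∈ (right-holds-done c pl′ (suc-injective (trans (sym eq′) eq)))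

-- P₄ and the heap cancel as * + *: when Left spends one, Right spends the other. A ↓ turned into *
-- cancels the heap instead, and Right cuts P₄.
right-holds-four : ∀ {ℓ G} c → Plays ℓ G → Fours ℓ → rank ℓ ≡ 1 → RightHolds G c 1
right-holds-four {G = G} c pl fs eq = right-holds G c 1
  (λ H∈ → let (_ , st , pl′) = plays-option Lft pl H∈ in
    right-plays-nim c (s≤s z≤n) (right-holds-done c pl′ (suc-injective (trans (sym (fours-delete fs st)) eq))))
  (λ { {c′} refl → right-wins-rank1 c′ pl eq })
  (λ { {zero} _ → right-wins-rank1 c pl eq ; {suc i} (s≤s ()) })

right-holds-fours : ∀ {ℓ G} c → Plays ℓ G → Fours ℓ → rank ℓ ≡ 2 → RightHolds G c 0
right-holds-fours {G = G} c pl fs eq = right-holds G c 0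
  (λ H∈ → let (_ , st , pl′) = plays-option Lft pl H∈ in
    right-wins-rank1 c pl′ (suc-injective (trans (sym (fours-delete fs st)) eq)))
  (λ { {c′} refl → right-plays-nim c′ (s≤s z≤n) (right-holds-fours c′ pl fs eq) })
  (λ ())

-- Right's lead is c - u. A cut by plan raises it by one, Left's deletion or use of a ↓ lowers it by
-- one, and heap moves keep it. A lead of one before Right's move suffices for every heap; with a
-- heap of at least 2 a lead of zero does, and a Left move that makes the heap smaller costs Left
-- the tempo.
mutual
  right-holds-two : ∀ n {ℓ G u} c j → measure ℓ c j < n → Plays ℓ G → Upper ℓ u → 2 + u ≤ c → RightHolds G c j
  right-holds-two (suc n) {ℓ} {G} c j m pl up 2+u≤c = right-holds G c j
    (λ H∈ → let (_ , st , pl′) = plays-option Lft pl H∈ in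
      right-wins-one n c j (measure-step c j st m) pl′ (upper-delete up st) 2+u≤c)
    (λ { {c′} refl → right-wins-one n c′ (flip j) (measure-down ℓ c′ (flip≤ j) m) pl up (≤-pred 2+u≤c) })
    (λ {i} i<j → right-wins-one n c i (measure-nim ℓ c i<j m) pl up (≤-trans (n≤1+n _) 2+u≤c))

  right-holds-one : ∀ n {ℓ G u} c j → measure ℓ c j < n → Plays ℓ G → Upper ℓ u → 1 + u ≤ c → 2 ≤ j → RightHolds G c j
  right-holds-one (suc n) {ℓ} {G} c j m pl up 1+u≤c 2≤j = right-holds G c j
    (λ H∈ → let (_ , st , pl′) = plays-option Lft pl H∈ in
      right-wins-level n c j (measure-step c j st m) pl′ (upper-delete up st) 1+u≤c 2≤j)
    (λ { {c′} refl → right-wins-level n c′ (flip j) (measure-down ℓ c′ (flip≤ j) m) pl up (≤-pred 1+u≤c) (flip≥2 2≤j) })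
    (λ {i} i<j → right-wins-one n c i (measure-nim ℓ c i<j m) pl up 1+u≤c)

  right-wins-one : ∀ n {ℓ G u} c j → measure ℓ c j < n → Plays ℓ G → Upper ℓ u → 1 + u ≤ c → RightWins G c j
  right-wins-one (suc n) (suc c) j m pl up (s≤s u≤c) with rightPlan up
  -- The lead guarantees a ↓, which serves as a waiting move when neither a cut nor a heap is left.
  right-wins-one (suc n) (suc c) zero m pl up (s≤s u≤c) | done eq = right-plays-down c zero (right-holds-done c pl eq)
  right-wins-one (suc n) (suc c) (suc j) m pl up (s≤s u≤c) | done eq =
    right-plays-nim (suc c) (s≤s z≤n) (right-holds-done (suc c) pl eq)
  right-wins-one (suc n) (suc c) zero m pl up (s≤s u≤c) | four fs eq = right-wins-rank1 (suc c) pl eq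
  right-wins-one (suc n) (suc c) (suc zero) m pl up (s≤s u≤c) | four fs eq = right-plays-down c 1 (right-holds-four c pl fs eq)
  right-wins-one (suc n) (suc c) (suc (suc j)) m pl up (s≤s u≤c) | four fs eq =
    right-plays-nim (suc c) (s≤s (s≤s z≤n)) (right-holds-four (suc c) pl fs eq)
  right-wins-one (suc n) (suc c) zero m pl up (s≤s u≤c) | fours fs eq = right-plays-down c zero (right-holds-fours c pl fs eq)
  right-wins-one (suc n) (suc c) (suc j) m pl up (s≤s u≤c) | fours fs eq =
    right-plays-nim (suc c) (s≤s z≤n) (right-holds-fours (suc c) pl fs eq)
  ... | lower r≥1 st up′ = let (_ , x∈ , pl′) = plays-step Rgt pl r≥1 st in
    right-plays-component (suc c) j x∈ (right-holds-two n (suc c) j (measure-step (suc c) j st m) pl′ up′ (s≤s u≤c))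

  right-wins-level : ∀ n {ℓ G u} c j → measure ℓ c j < n → Plays ℓ G → Upper ℓ u → u ≤ c → 2 ≤ j → RightWins G c j
  right-wins-level (suc n) c j m pl up u≤c 2≤j with rightPlan up
  ... | done eq     = right-plays-nim c (≤-trans (s≤s z≤n) 2≤j) (right-holds-done c pl eq)
  -- P₄ = * has to be balanced by a heap of size 1, which is in reach only from j ≥ 2.
  ... | four fs eq  = right-plays-nim c 2≤j (right-holds-four c pl fs eq)
  ... | fours fs eq = right-plays-nim c (≤-trans (s≤s z≤n) 2≤j) (right-holds-fours c pl fs eq)
  ... | lower r≥1 st up′ = let (_ , x∈ , pl′) = plays-step Rgt pl r≥1 st in
    right-plays-component c j x∈ (right-holds-one n c j (measure-step c j st m) pl′ up′ u≤c 2≤j)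

-- The lower bound and Right's cuts

τ : ℕ → ℕ
τ 3 = 1
τ _ = 0

-- For n ≥ 4 the residue of n modulo 3 decides how wasteful cuts are: residues 1, 2, 0 weigh 5, 2, 0.  A cut that
-- lowers the rank never increases the total weight, and any other cut increases it by at most 8.
ε : ℕ → ℕ
ε 4 = 5
ε 5 = 2
ε (suc (suc (suc n@(suc (suc (suc (suc _))))))) = ε n
ε _ = 0

-- Rank and excess alone do not separate P₇ from P₄ + P₆, which need different defects; the number
-- of paths that can still be cut does.
κ : ℕ → ℕ
κ (suc (suc (suc (suc _)))) = 1
κ _ = 0

threes excess count : List ℕ → ℕ
threes = total τ
excess = total ε
count  = total κ

-- The thresholds are 8 apart, so a wasteful cut raises the defect by at most one. The first one is
-- the largest excess of a single path, and the cap 2 leaves a bound of at least two from rank four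
-- on.
baseDefect : ℕ → ℕ
baseDefect e = if e ≤ᵇ 5 then 0 else if e ≤ᵇ 13 then 1 else 2

-- The arguments are rank, excess and count.  The entries 1 5 1, 2 10 2, 2 5 2, 2 2 1, 3 5 1 and 2 7 2 belong to the
-- positions P₄, P₄ + P₄, P₄ + P₆, P₈, P₁₀ and P₄ + P₅.  The other two belong to no position: they only make
-- value-change true for all triples that satisfy its inequalities.
defect : ℕ → ℕ → ℕ → ℕ
defect 1 5  1 = 1
defect 2 10 2 = 2
defect 2 5  2 = 1
defect 2 2  1 = 1
defect 2 7  2 = 0
defect 2 3  1 = 1
defect 3 5  1 = 1
defect 3 4  1 = 1
defect _ e  _ = baseDefect e

value : ℕ → ℕ → ℕ → ℕ
value r e c = r ∸ defect r e c

-- The atomic weight of ℓ is at least w.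
data Lower (ℓ : List ℕ) (w : ℕ) : Set where
  some-three : 1 ≤ threes ℓ → w ≤ rank ℓ → Lower ℓ w
  no-three   : threes ℓ ≡ 0 → w ≤ value (rank ℓ) (excess ℓ) (count ℓ) → Lower ℓ w

lower-≤ : ∀ {ℓ w w′} → w′ ≤ w → Lower ℓ w → Lower ℓ w′
lower-≤ w′≤w (some-three t le) = some-three t (≤-trans w′≤w le)
lower-≤ w′≤w (no-three t le)   = no-three t (≤-trans w′≤w le)

lower-rank : ∀ {ℓ w} → Lower ℓ w → w ≤ rank ℓ
lower-rank (some-three _ le)   = le
lower-rank {ℓ} (no-three _ le) = ≤-trans le (m∸n≤m (rank ℓ) (defect (rank ℓ) (excess ℓ) (count ℓ)))

-- The effects on rank, excess and count of the cuts that create no path of length three.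
data Change (r e c : ℕ) : ℕ → ℕ → ℕ → Set where
  even  : ∀ {r′} → r ≡ suc r′ → Change r e c r′ e (suc c)
  even′ : ∀ {r′ e′} → r ≡ suc r′ → e ≡ suc e′ → Change r e c r′ e′ (suc c)
  waste : Change r e c r (7 + e) (suc c)
  waste′ : Change r e c r (8 + e) (suc c)
  trim  : Change r e c r (5 + e) c
  trim′ : ∀ {r′ e′} → r ≡ suc r′ → e ≡ 3 + e′ → Change r e c r′ e′ c
  trim″ : ∀ {r′ e′} → r ≡ suc r′ → e ≡ 2 + e′ → Change r e c r′ e′ c
  clear : ∀ {r′ e′ c′} → r ≡ suc r′ → e ≡ 5 + e′ → c ≡ suc c′ → Change r e c r′ e′ c′

change-suc : ∀ {r e c r′ e′ c′} → Change r e c r′ e′ c′ → Change (suc r) e c (suc r′) e′ c′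
change-suc (even refl)            = even refl
change-suc (even′ refl refl)      = even′ refl refl
change-suc waste                  = waste
change-suc waste′                 = waste′
change-suc trim                   = trim
change-suc (trim′ refl refl)      = trim′ refl refl
change-suc (trim″ refl refl)      = trim″ refl refl
change-suc (clear refl refl refl) = clear refl refl refl

change-+ : ∀ {r e c r′ e′ c′} x y z → Change r e c r′ e′ c′ → Change (r + x) (e + y) (c + z) (r′ + x) (e′ + y) (c′ + z)
change-+ x y z (even refl)            = even refl
change-+ x y z (even′ refl refl)      = even′ refl refl
change-+ x y z waste                  = waste
change-+ x y z waste′                 = waste′
change-+ x y z trim                   = trim
change-+ x y z (trim′ refl refl)      = trim′ refl refl
change-+ x y z (trim″ refl refl)      = trim″ refl refl
change-+ x y z (clear refl refl refl) = clear refl refl refl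

change-+ʳ : ∀ {r e c r′ e′ c′} x y z → Change r e c r′ e′ c′ → Change (x + r) (y + e) (z + c) (x + r′) (y + e′) (z + c′)
change-+ʳ {r} {e} {c} {r′} {e′} {c′} x y z ch
  rewrite +-comm x r | +-comm y e | +-comm z c | +-comm x r′ | +-comm y e′ | +-comm z c′ = change-+ x y z ch

-- Adding three to a piece of length at least four raises `ρ` by one and keeps `ε` and `κ`, so only
-- pieces of length 2, 4, 5 and 6 need separate treatment.
change-cut : ∀ a b → 2 ≤ a → 2 ≤ b → τ a ≡ 0 → τ b ≡ 0 →
  Change (ρ (a + b)) (ε (a + b)) (κ (a + b)) (ρ a + ρ b) (ε a + ε b) (κ a + κ b)
change-cut 1 _ (s≤s ()) _ _ _
change-cut _ 1 _ (s≤s ()) _ _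
change-cut 2 2 _ _ _ _ = clear refl refl refl
change-cut 2 4 _ _ _ _ = trim
change-cut 2 5 _ _ _ _ = trim′ refl refl
change-cut 2 6 _ _ _ _ = trim″ refl refl
change-cut 4 2 _ _ _ _ = trim
change-cut 4 4 _ _ _ _ = waste′
change-cut 4 5 _ _ _ _ = waste
change-cut 4 6 _ _ _ _ = even refl
change-cut 5 2 _ _ _ _ = trim′ refl refl
change-cut 5 4 _ _ _ _ = waste
change-cut 5 5 _ _ _ _ = even′ refl refl
change-cut 5 6 _ _ _ _ = even refl
change-cut 6 2 _ _ _ _ = trim″ refl refl
change-cut 6 4 _ _ _ _ = even refl
change-cut 6 5 _ _ _ _ = even refl
change-cut 6 6 _ _ _ _ = even refl
change-cut 2 (suc (suc (suc b@(suc (suc (suc (suc _))))))) 2≤a _ τa _ =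
  change-suc (change-cut 2 b 2≤a (s≤s (s≤s z≤n)) τa refl)
change-cut 4 (suc (suc (suc b@(suc (suc (suc (suc _))))))) 2≤a _ τa _ =
  change-suc (change-cut 4 b 2≤a (s≤s (s≤s z≤n)) τa refl)
change-cut 5 (suc (suc (suc b@(suc (suc (suc (suc _))))))) 2≤a _ τa _ =
  change-suc (change-cut 5 b 2≤a (s≤s (s≤s z≤n)) τa refl)
change-cut 6 (suc (suc (suc b@(suc (suc (suc (suc _))))))) 2≤a _ τa _ =
  change-suc (change-cut 6 b 2≤a (s≤s (s≤s z≤n)) τa refl)
change-cut (suc (suc (suc a@(suc (suc (suc (suc _))))))) b _ 2≤b _ τb =
  change-suc (change-cut a b (s≤s (s≤s z≤n)) 2≤b refl τb)

change-step : ∀ {ℓ ℓ′} → Step Rgt ℓ ℓ′ → threes ℓ′ ≡ 0 →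
  Change (rank ℓ) (excess ℓ) (count ℓ) (rank ℓ′) (excess ℓ′) (count ℓ′)
change-step (cut a b {ℓ} 2≤a 2≤b) t
  rewrite sym (+-assoc (ρ a) (ρ b) (rank ℓ)) | sym (+-assoc (ε a) (ε b) (excess ℓ)) | sym (+-assoc (κ a) (κ b) (count ℓ)) =
  change-+ (rank ℓ) (excess ℓ) (count ℓ)
    (change-cut a b 2≤a 2≤b (m+n≡0⇒m≡0 (τ a) t) (m+n≡0⇒m≡0 (τ b) (m+n≡0⇒n≡0 (τ a) t)))
change-step (skip {n = n} st) t = change-+ʳ (ρ n) (ε n) (κ n) (change-step st (m+n≡0⇒n≡0 (τ n) t))

ρ-cut : ∀ a b → ρ (a + b) ≤ suc (ρ a + ρ b)
ρ-cut 0 b = n≤1+n _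
ρ-cut 1 b = ρ-suc b
ρ-cut 2 b = ≤-trans (ρ-mono-suc _) (ρ-+3 b)
ρ-cut 3 b = ρ-+3 b
ρ-cut (suc (suc (suc (suc a)))) b = s≤s (ρ-cut (suc a) b)

cut-lowers-rank : ∀ {ℓ ℓ′} → Step Rgt ℓ ℓ′ → rank ℓ ≤ suc (rank ℓ′)
cut-lowers-rank (cut a b {ℓ} _ _) = ≤-trans (+-monoˡ-≤ (rank ℓ) (ρ-cut a b)) (s≤s (≤-reflexive (+-assoc (ρ a) (ρ b) (rank ℓ))))
cut-lowers-rank (skip {n = n} {ℓ′ = ℓ′} st) = ≤-trans (+-monoʳ-≤ (ρ n) (cut-lowers-rank st)) (≤-reflexive (+-suc (ρ n) (rank ℓ′)))

-- A P₃ cannot be cut, so Left's spare moves survive.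
cut-threes : ∀ {ℓ ℓ′} → Step Rgt ℓ ℓ′ → threes ℓ ≤ threes ℓ′
cut-threes (cut (suc (suc a)) (suc (suc b)) {ℓ} (s≤s (s≤s _)) (s≤s (s≤s _))) = ≤-trans
  (≤-reflexive (cong (_+ threes ℓ) (cong (τ ∘ suc ∘ suc) (trans (+-suc a (suc b)) (cong suc (+-suc a b))))))
  (≤-trans (m≤n+m (threes ℓ) (τ (suc (suc b)))) (m≤n+m _ (τ (suc (suc a)))))
cut-threes (skip {n = n} st) = +-monoʳ-≤ (τ n) (cut-threes st)

cut-count : ∀ {ℓ ℓ′} → Step Rgt ℓ ℓ′ → 1 ≤ count ℓ
cut-count (cut (suc (suc a)) (suc (suc b)) {ℓ} (s≤s (s≤s _)) (s≤s (s≤s _))) =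
  subst (λ t → 1 ≤ κ t + count ℓ) (cong (suc ∘ suc) (sym (trans (+-suc a (suc b)) (cong suc (+-suc a b))))) (s≤s z≤n)
cut-count (skip {n = n} st) = ≤-trans (cut-count st) (m≤n+m _ (κ n))

total-mono : ∀ {f g} → (∀ n → f n ≤ g n) → ∀ ℓ → total f ℓ ≤ total g ℓ
total-mono f≤g []      = z≤n
total-mono f≤g (n ∷ ℓ) = +-mono-≤ (f≤g n) (total-mono f≤g ℓ)

total-* : ∀ k f ℓ → total (λ n → k * f n) ℓ ≡ k * total f ℓ
total-* k f []      = sym (*-zeroʳ k)
total-* k f (n ∷ ℓ) = trans (cong (k * f n +_) (total-* k f ℓ)) (sym (*-distribˡ-+ k (f n) (total f ℓ)))

count≤rank : ∀ ℓ → count ℓ ≤ rank ℓ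
count≤rank = total-mono κ≤ρ
  where
  κ≤ρ : ∀ n → κ n ≤ ρ n
  κ≤ρ 0 = z≤n
  κ≤ρ 1 = z≤n
  κ≤ρ 2 = z≤n
  κ≤ρ 3 = z≤n
  κ≤ρ (suc (suc (suc (suc n)))) = s≤s z≤n

ε≤5 : ∀ n → ε n ≤ 5
ε≤5 0 = z≤n
ε≤5 1 = z≤n
ε≤5 2 = z≤n
ε≤5 3 = z≤n
ε≤5 4 = ≤-refl
ε≤5 5 = s≤s (s≤s z≤n)
ε≤5 6 = z≤n
ε≤5 (suc (suc (suc n@(suc (suc (suc (suc _))))))) = ε≤5 n

excess≤5*count : ∀ ℓ → excess ℓ ≤ 5 * count ℓ
excess≤5*count ℓ = ≤-trans (total-mono ε≤5*κ ℓ) (≤-reflexive (total-* 5 κ ℓ))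
  where
  ε≤5*κ : ∀ n → ε n ≤ 5 * κ n
  ε≤5*κ 0 = z≤n
  ε≤5*κ 1 = z≤n
  ε≤5*κ 2 = z≤n
  ε≤5*κ 3 = z≤n
  ε≤5*κ (suc (suc (suc (suc n)))) = ε≤5 (4 + n)

-- A cut lowers the bound by at most one

allBelow : ℕ → (ℕ → Bool) → Bool
allBelow zero    p = true
allBelow (suc n) p = p n ∧ allBelow n p

allBelow⁻ : ∀ n p → T (allBelow n p) → ∀ {i} → i < n → T (p i)
allBelow⁻ (suc n) p t {i} (s≤s i≤n) with m≤n⇒m<n∨m≡n i≤n
... | inj₁ i<n  = allBelow⁻ n p (proj₂ (Equivalence.to (T-∧ {p n}) t)) i<n
... | inj₂ refl = proj₁ (Equivalence.to (T-∧ {p n}) t)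

-- True of all positions, and needed for the finite check: an `even` cut from rank 3, excess 10 and
-- count 1 would otherwise lead to the triple of P₄ + P₄ and lower the bound by two.
consistent : ℕ → ℕ → ℕ → Bool
consistent r e c = (c ≤ᵇ r) ∧ (e ≤ᵇ 5 * c)

consistent⁺ : ∀ {r e c} → c ≤ r → e ≤ 5 * c → T (consistent r e c)
consistent⁺ c≤r e≤5c = Equivalence.from T-∧ (≤⇒≤ᵇ c≤r , ≤⇒≤ᵇ e≤5c)

admissible : ℕ → ℕ → ℕ → ℕ → ℕ → ℕ → Bool
admissible r e c r′ e′ c′ =
  if consistent r e c ∧ consistent r′ e′ c′ then value r e c ≤ᵇ suc (value r′ e′ c′) else true

admissible⁻ : ∀ r e c r′ e′ c′ → T (admissible r e c r′ e′ c′) → T (consistent r e c) → T (consistent r′ e′ c′) →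
              value r e c ≤ suc (value r′ e′ c′)
admissible⁻ r e c r′ e′ c′ t p q with consistent r e c | consistent r′ e′ c′
... | true | true = ≤ᵇ⇒≤ _ _ t

-- Covers ranks and counts from 1 to 4, shifted down by one, and excesses up to 5 * 4; the check
-- itself is evaluation.
everywhere : (ℕ → ℕ → ℕ → Bool) → Bool
everywhere p = allBelow 4 λ r → allBelow 4 λ c → allBelow 21 λ e → p r e c

everywhere⁻ : ∀ p → T (everywhere p) → ∀ {r e c} → r < 4 → e < 21 → c < 4 → T (p r e c)
everywhere⁻ p t {r} {e} {c} r< e< c< =
  allBelow⁻ 21 (λ e → p r e c) (allBelow⁻ 4 (λ c → allBelow 21 λ e → p r e c)
    (allBelow⁻ 4 (λ r → allBelow 4 λ c → allBelow 21 λ e → p r e c) t r<) c<) e<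

baseDefect≤2 : ∀ e → baseDefect e ≤ 2
baseDefect≤2 e with e ≤ᵇ 5
... | true  = z≤n
... | false with e ≤ᵇ 13
... | true  = s≤s z≤n
... | false = ≤-refl

data Band (e : ℕ) : ℕ → Set where
  low    : e ≤ 5 → Band e 0
  middle : 6 ≤ e → e ≤ 13 → Band e 1
  high   : 14 ≤ e → Band e 2

band : ∀ e → Band e (baseDefect e)
band e with e ≤ᵇ 5 in eq₁
... | true  = low (≤ᵇ⇒≤ e 5 (subst T (sym eq₁) tt))
... | false with e ≤ᵇ 13 in eq₂
... | true  = middle (≰⇒> (λ le → subst T eq₁ (≤⇒≤ᵇ le))) (≤ᵇ⇒≤ e 13 (subst T (sym eq₂) tt))
... | false = high (≰⇒> (λ le → subst T eq₂ (≤⇒≤ᵇ le)))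

baseDefect-mono : ∀ {e e′} → e ≤ e′ → baseDefect e ≤ baseDefect e′
baseDefect-mono {e} {e′} e≤e′ with baseDefect e | band e | baseDefect e′ | band e′
... | _ | low _      | _ | _          = z≤n
... | _ | middle l _ | _ | low h      = ⊥-elim (1+n≰n (≤-trans l (≤-trans e≤e′ h)))
... | _ | middle _ _ | _ | middle _ _ = ≤-refl
... | _ | middle _ _ | _ | high _     = s≤s z≤n
... | _ | high l     | _ | low h      = ⊥-elim (<⇒≱ {5} {14} (s≤s (s≤s (s≤s (s≤s (s≤s (s≤s z≤n)))))) (≤-trans l (≤-trans e≤e′ h)))
... | _ | high l     | _ | middle _ h = ⊥-elim (1+n≰n (≤-trans l (≤-trans e≤e′ h)))
... | _ | high _     | _ | high _     = ≤-refl

baseDefect-+8 : ∀ e → baseDefect (8 + e) ≤ suc (baseDefect e)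
baseDefect-+8 e with baseDefect e | band e
... | _ | low e≤5    = baseDefect-mono (+-monoʳ-≤ 8 e≤5)
... | _ | middle _ _ = baseDefect≤2 (8 + e)
... | _ | high _     = ≤-trans (baseDefect≤2 (8 + e)) (n≤1+n 2)

-- The special entries of `defect` have rank at most 3. From rank 5 a cut ends at rank at least 4,
-- so only `baseDefect` is involved; smaller ranks are left to evaluation.
value-change : ∀ {r e c r′ e′ c′} → Change r e c r′ e′ c′ → 1 ≤ c → c ≤ r → e ≤ 5 * c → c′ ≤ r′ → e′ ≤ 5 * c′ →
               value r e c ≤ suc (value r′ e′ c′)
value-change {r} ch 1≤c c≤r e≤ c′≤ e′≤ with r ≤? 4
value-change {zero} ch 1≤c c≤r e≤ c′≤ e′≤ | yes _ = ⊥-elim (1+n≰n (≤-trans 1≤c c≤r))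
value-change {suc r} {e} {suc c} ch 1≤c (s≤s c≤r) e≤ c′≤ e′≤ | yes (s≤s r≤3) =
  small ch (≤-trans e≤ (*-monoʳ-≤ 5 (s≤s c≤3))) (consistent⁺ (s≤s c≤r) e≤) (consistent⁺ c′≤ e′≤)
  where
  c≤3 : c ≤ 3
  c≤3 = ≤-trans c≤r r≤3
  small : ∀ {e r′ e′ c′} → Change (suc r) e (suc c) r′ e′ c′ → e ≤ 20 → T (consistent (suc r) e (suc c)) →
          T (consistent r′ e′ c′) → value (suc r) e (suc c) ≤ suc (value r′ e′ c′)
  small {e} (even refl) e≤20 = admissible⁻ (suc r) e (suc c) r e (2 + c)
    (everywhere⁻ (λ r e c → admissible (suc r) e (suc c) r e (2 + c)) tt (s≤s r≤3) (s≤s e≤20) (s≤s c≤3))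
  small (even′ {e′ = e′} refl refl) e≤20 = admissible⁻ (suc r) (suc e′) (suc c) r e′ (2 + c)
    (everywhere⁻ (λ r e c → admissible (suc r) (suc e) (suc c) r e (2 + c)) tt (s≤s r≤3) (s≤s (≤-trans (m≤n+m e′ 1) e≤20)) (s≤s c≤3))
  small {e} waste e≤20 = admissible⁻ (suc r) e (suc c) (suc r) (7 + e) (2 + c)
    (everywhere⁻ (λ r e c → admissible (suc r) e (suc c) (suc r) (7 + e) (2 + c)) tt (s≤s r≤3) (s≤s e≤20) (s≤s c≤3))
  small {e} waste′ e≤20 = admissible⁻ (suc r) e (suc c) (suc r) (8 + e) (2 + c)
    (everywhere⁻ (λ r e c → admissible (suc r) e (suc c) (suc r) (8 + e) (2 + c)) tt (s≤s r≤3) (s≤s e≤20) (s≤s c≤3))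
  small {e} trim e≤20 = admissible⁻ (suc r) e (suc c) (suc r) (5 + e) (suc c)
    (everywhere⁻ (λ r e c → admissible (suc r) e (suc c) (suc r) (5 + e) (suc c)) tt (s≤s r≤3) (s≤s e≤20) (s≤s c≤3))
  small (trim′ {e′ = e′} refl refl) e≤20 = admissible⁻ (suc r) (3 + e′) (suc c) r e′ (suc c)
    (everywhere⁻ (λ r e c → admissible (suc r) (3 + e) (suc c) r e (suc c)) tt (s≤s r≤3) (s≤s (≤-trans (m≤n+m e′ 3) e≤20)) (s≤s c≤3))
  small (trim″ {e′ = e′} refl refl) e≤20 = admissible⁻ (suc r) (2 + e′) (suc c) r e′ (suc c)
    (everywhere⁻ (λ r e c → admissible (suc r) (2 + e) (suc c) r e (suc c)) tt (s≤s r≤3) (s≤s (≤-trans (m≤n+m e′ 2) e≤20)) (s≤s c≤3))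
  small (clear {e′ = e′} refl refl refl) e≤20 = admissible⁻ (suc r) (5 + e′) (suc c) r e′ c
    (everywhere⁻ (λ r e c → admissible (suc r) (5 + e) (suc c) r e c) tt (s≤s r≤3) (s≤s (≤-trans (m≤n+m e′ 5) e≤20)) (s≤s c≤3))
value-change {r} ch 1≤c c≤r e≤ c′≤ e′≤ | no r≰4 with ≰⇒> r≰4
... | s≤s (s≤s (s≤s (s≤s (s≤s _)))) = large ch
  where
  one-less : ∀ r {d d′} → d′ ≤ d → suc r ∸ d ≤ suc (r ∸ d′)
  one-less r {d} {d′} d′≤d = ≤-trans (∸-monoʳ-≤ (suc r) d′≤d) (m∸n≤1 r d′)
    where
    m∸n≤1 : ∀ r d → suc r ∸ d ≤ suc (r ∸ d)
    m∸n≤1 r       zero    = ≤-refl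
    m∸n≤1 zero    (suc d) = ≤-trans (m∸n≤m 0 d) z≤n
    m∸n≤1 (suc r) (suc d) = m∸n≤1 r d
  large : ∀ {r e c r′ e′ c′} → Change (5 + r) e c r′ e′ c′ → value (5 + r) e c ≤ suc (value r′ e′ c′)
  large {r} {e} (even refl)         = one-less (4 + r) (≤-refl {baseDefect e})
  large {r} {suc e} (even′ refl refl)     = one-less (4 + r) (baseDefect-mono (n≤1+n e))
  large {r} {e} waste               = one-less (5 + r) {suc (baseDefect e)} (≤-trans (baseDefect-mono (+-monoˡ-≤ e (n≤1+n 7))) (baseDefect-+8 e))
  large {r} {e} waste′              = one-less (5 + r) {suc (baseDefect e)} (baseDefect-+8 e)
  large {r} {e} trim                = one-less (5 + r) {suc (baseDefect e)}
    (≤-trans (baseDefect-mono {5 + e} {8 + e} (+-monoˡ-≤ e (s≤s (s≤s (s≤s (s≤s (s≤s z≤n))))))) (baseDefect-+8 e))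
  large {r} (trim′ {e′ = e} refl refl)    = one-less (4 + r) (baseDefect-mono (m≤n+m e 3))
  large {r} (trim″ {e′ = e} refl refl)    = one-less (4 + r) (baseDefect-mono (m≤n+m e 2))
  large {r} (clear {e′ = e} refl refl refl) = one-less (4 + r) (baseDefect-mono (m≤n+m e 5))

-- If the result contains a P₃, its full rank counts, and a cut lowers the rank by at most one. If
-- not, there was none before either, and `value-change` applies.
lower-cut : ∀ {ℓ ℓ′ w} → Lower ℓ (suc w) → Step Rgt ℓ ℓ′ → Lower ℓ′ w
lower-cut {ℓ} {ℓ′} {w} lo st with threes ℓ′ in eq
... | suc t = some-three (subst (1 ≤_) (sym eq) (s≤s z≤n)) (≤-pred (≤-trans (lower-rank lo) (cut-lowers-rank st)))
... | zero  = no-three eq (≤-pred (≤-trans (source lo) (value-change (change-step st eq) (cut-count st)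
                (count≤rank ℓ) (excess≤5*count ℓ) (count≤rank ℓ′) (excess≤5*count ℓ′))))
  where
  source : Lower ℓ (suc w) → suc w ≤ value (rank ℓ) (excess ℓ) (count ℓ)
  source (some-three t _) = ⊥-elim (1+n≰n (≤-trans (≤-trans t (cut-threes st)) (≤-reflexive eq)))
  source (no-three _ le)  = le

-- Left's strategy

data Stats (ℓ : List ℕ) : ℕ → ℕ → ℕ → Set where
  stats : ∀ {r e c} → threes ℓ ≡ 0 → rank ℓ ≡ r → excess ℓ ≡ e → count ℓ ≡ c → Stats ℓ r e c

stats-light : ∀ {ℓ} → Light ℓ → Stats ℓ 0 0 0
stats-light li = stats (total-light τ refl refl refl li) (rank-light li) (total-light ε refl refl refl li) (total-light κ refl refl refl li)

stats-pick : ∀ {n ℓ s r e c} → Pick n ℓ s → τ n ≡ 0 → Stats s r e c → Stats ℓ (ρ n + r) (ε n + e) (κ n + c)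
stats-pick {n} p τ0 (stats t refl refl refl) =
  stats (trans (pick-total τ p) (cong₂ _+_ τ0 t)) (pick-total ρ p) (pick-total ε p) (pick-total κ p)

stats-pick₂ : ∀ {a b ℓ t s r e c} → Pick a ℓ t → Pick b t s → τ a ≡ 0 → τ b ≡ 0 → Stats s r e c →
              Stats ℓ (ρ a + (ρ b + r)) (ε a + (ε b + e)) (κ a + (κ b + c))
stats-pick₂ p q τa τb st = stats-pick p τa (stats-pick q τb st)

lower-stats : ∀ {ℓ r e c w} → Stats ℓ r e c → w ≤ value r e c → Lower ℓ w
lower-stats (stats t refl refl refl) le = no-three t le

stats-lower : ∀ {ℓ r e c w} → Stats ℓ r e c → Lower ℓ w → w ≤ value r e c
stats-lower (stats t refl refl refl) (no-three _ le)    = le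
stats-lower (stats t refl refl refl) (some-three t′ _) = ⊥-elim (1+n≰n (≤-trans t′ (≤-reflexive t)))

rank0⇒light : ∀ ℓ → rank ℓ ≡ 0 → threes ℓ ≡ 0 → Light ℓ
rank0⇒light []      _  _  = []
rank0⇒light (0 ∷ ℓ) eq t = z≤n ∷ rank0⇒light ℓ eq t
rank0⇒light (1 ∷ ℓ) eq t = s≤s z≤n ∷ rank0⇒light ℓ eq t
rank0⇒light (2 ∷ ℓ) eq t = ≤-refl ∷ rank0⇒light ℓ eq t
rank0⇒light (3 ∷ ℓ) eq ()

rank0⇒short : ∀ ℓ → rank ℓ ≡ 0 → Short ℓ
rank0⇒short []      _  = []
rank0⇒short (0 ∷ ℓ) eq = z≤n ∷ rank0⇒short ℓ eq
rank0⇒short (1 ∷ ℓ) eq = s≤s z≤n ∷ rank0⇒short ℓ eq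
rank0⇒short (2 ∷ ℓ) eq = s≤s (s≤s z≤n) ∷ rank0⇒short ℓ eq
rank0⇒short (3 ∷ ℓ) eq = s≤s (s≤s (s≤s z≤n)) ∷ rank0⇒short ℓ eq

4≤5 : 4 ≤ 5
4≤5 = n≤1+n 4

3≤3+ : ∀ {n} → 3 ≤ 3 + n
3≤3+ = s≤s (s≤s (s≤s z≤n))

shorten : ∀ {n ℓ s} → Pick (4 + n) ℓ s → ∃[ ℓ′ ] ∃[ t ] Step Lft ℓ ℓ′ × Pick 0 ℓ′ t × Pick (3 + n) t s
shorten {n} = pick-delete 0 (3 + n) (λ ()) (λ ()) 3≤3+

pick-three : ∀ ℓ → 1 ≤ threes ℓ → ∃[ s ] Pick 3 ℓ s
pick-three (0 ∷ ℓ) t = let (_ , p) = pick-three ℓ t in _ , there p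
pick-three (1 ∷ ℓ) t = let (_ , p) = pick-three ℓ t in _ , there p
pick-three (2 ∷ ℓ) t = let (_ , p) = pick-three ℓ t in _ , there p
pick-three (3 ∷ ℓ) t = ℓ , here
pick-three (suc (suc (suc (suc n))) ∷ ℓ) t = let (_ , p) = pick-three ℓ t in _ , there p

all-pick : ∀ {Q : ℕ → Set} {n ℓ s} → Pick n ℓ s → All Q ℓ → All Q s
all-pick here      (_ ∷ qs) = qs
all-pick (there p) (q ∷ qs) = q ∷ all-pick p qs

-- The spare move: P₃ becomes P₂ at no cost in rank.
spend-three : ∀ ℓ → 1 ≤ threes ℓ → ∃[ ℓ′ ] Step Lft ℓ ℓ′ × rank ℓ′ ≡ rank ℓ × (Short ℓ → Short ℓ′)
spend-three ℓ t =
  let (s , p) = pick-three ℓ t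
      (ℓ′ , _ , st , pa , pb) = pick-delete 0 2 (λ ()) (λ ()) ≤-refl p
  in ℓ′ , st , trans (pick-total₂ ρ pa pb) (sym (pick-total ρ p)) ,
     λ sh → pick-all pa z≤n (pick-all pb (s≤s (s≤s z≤n)) (all-pick p sh))

-- At rank one the only path to break has 4, 5 or 6 vertices, and one deletion leaves pieces of at
-- most three.
lowering-delete : ∀ ℓ → rank ℓ ≡ 1 → ∃[ ℓ′ ] Step Lft ℓ ℓ′ × rank ℓ′ ≡ 0
lowering-delete ℓ eq with rank≥1⇒pick ℓ (≤-reflexive (sym eq))
... | 0 , s , p = let (ℓ′ , _ , st , pa , pb) = pick-delete 0 3 (λ ()) (λ ()) 3≤3+ p in
  ℓ′ , st , trans (pick-total₂ ρ pa pb) (suc-injective (trans (sym (pick-total ρ p)) eq))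
... | 1 , s , p = let (ℓ′ , _ , st , pa , pb) = pick-delete 2 2 (λ ()) (λ ()) 3≤3+ p in
  ℓ′ , st , trans (pick-total₂ ρ pa pb) (suc-injective (trans (sym (pick-total ρ p)) eq))
... | 2 , s , p = let (ℓ′ , _ , st , pa , pb) = pick-delete 2 3 (λ ()) (λ ()) 3≤3+ p in
  ℓ′ , st , trans (pick-total₂ ρ pa pb) (suc-injective (trans (sym (pick-total ρ p)) eq))
... | suc (suc (suc n)) , s , p = ⊥-elim (1+n≰n (≤-trans (s≤s (s≤s z≤n)) (≤-reflexive (trans (sym (pick-total ρ p)) eq))))

Five : List ℕ → Set
Five ℓ = ∃[ s ] Pick 5 ℓ s × Light s

-- Positions that Left holds, moving second, against every nonzero heap. The smallest examples, P₅
-- and P₃ + P₄, both equal ↑*.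
Stable : List ℕ → Set
Stable ℓ = (1 ≤ threes ℓ × 1 ≤ rank ℓ) ⊎ Five ℓ

-- A winning first move for Left in ℓ + *j, for every j.
data LeftPlan (ℓ : List ℕ) : Set where
  advance         : ∀ {ℓ′} → Step Lft ℓ ℓ′ → Lower ℓ′ 2 → LeftPlan ℓ
  finish-or-nim   : ∀ {ℓ′} → Lower ℓ 2 → Step Lft ℓ ℓ′ → rank ℓ′ ≡ 0 → LeftPlan ℓ
  balance-or-nim  : ∀ {ℓ′} → Lower ℓ 2 → Step Lft ℓ ℓ′ → Short ℓ′ → rank ℓ′ ≡ 2 → LeftPlan ℓ
  stabilise       : ∀ {ℓ′} → rank ℓ ≡ 1 → Step Lft ℓ ℓ′ → Stable ℓ′ → LeftPlan ℓ
  stable          : ∀ {ℓ′} → rank ℓ ≡ 1 → Stable ℓ → Step Lft ℓ ℓ′ → Short ℓ′ → rank ℓ′ ≡ 1 → LeftPlan ℓ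

threes-pick : ∀ {n ℓ s} → Pick (4 + n) ℓ s → threes ℓ ≡ threes s
threes-pick = pick-total τ

rank-rest : ∀ {n ℓ s r} → Pick (4 + n) ℓ s → rank ℓ ≡ r → suc (ρ (suc n) + rank s) ≡ r
rank-rest p eq = trans (sym (pick-total ρ p)) eq

threes-after : ∀ {a b ℓ t s} → Pick a ℓ t → Pick b t s → 1 ≤ threes s → 1 ≤ threes ℓ
threes-after {a} {b} pa pb t = ≤-trans t (≤-trans (m≤n+m _ (τ b)) (≤-trans (m≤n+m _ (τ a)) (≤-reflexive (sym (pick-total₂ τ pa pb)))))

rank-after : ∀ {a b ℓ t s w} → Pick a ℓ t → Pick b t s → w ≤ ρ a + (ρ b + rank s) → w ≤ rank ℓ
rank-after pa pb le = ≤-trans le (≤-reflexive (sym (pick-total₂ ρ pa pb)))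

-- Left would keep the P₃ and a rank of at least two. Shortening a path costs at most one rank, so
-- only ranks one and two can require another plan.
plan-with-three : ∀ ℓ → 1 ≤ threes ℓ → 1 ≤ rank ℓ → LeftPlan ℓ
plan-with-three ℓ t r≥1 with rank≥1⇒pick ℓ r≥1
... | n , s , p = go n p (rank ℓ) refl
  where
  ts : ∀ {n s} → Pick (4 + n) ℓ s → 1 ≤ threes s
  ts p = ≤-trans t (≤-reflexive (threes-pick p))
  keep : ∀ {n s} → Pick (4 + n) ℓ s → 2 ≤ ρ (3 + n) + rank s → LeftPlan ℓ
  keep p le = let (_ , _ , st , pa , pb) = shorten p in
    advance st (some-three (threes-after pa pb (ts p)) (rank-after pa pb le))
  reuse : rank ℓ ≡ 2 → Short ℓ → LeftPlan ℓ
  reuse eq sh = let (_ , st , eq′ , sh′) = spend-three ℓ t in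
    balance-or-nim (some-three t (≤-reflexive (sym eq))) st (sh′ sh) (trans eq′ eq)
  last : rank ℓ ≡ 1 → Short ℓ → LeftPlan ℓ
  last eq sh = let (_ , st , eq′ , sh′) = spend-three ℓ t in
    stable eq (inj₁ (t , r≥1)) st (sh′ sh) (trans eq′ eq)
  go : ∀ n {s} → Pick (4 + n) ℓ s → ∀ r → rank ℓ ≡ r → LeftPlan ℓ
  go n p 0 eq = ⊥-elim (1+n≰n (subst (1 ≤_) eq r≥1))
  go 0 p 1 eq = last eq (pick-all p 4≤5 (rank0⇒short _ (suc-injective (rank-rest p eq))))
  go 1 p 1 eq = last eq (pick-all p ≤-refl (rank0⇒short _ (suc-injective (rank-rest p eq))))
  go 2 p 1 eq = let (_ , _ , st , pa , pb) = shorten p in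
    stabilise eq st (inj₁ (threes-after pa pb (ts p) , rank-after pa pb (s≤s z≤n)))
  go (suc (suc (suc n))) p 1 eq = ⊥-elim (1+n≢0 (suc-injective (rank-rest p eq)))
  go 0 {s} p 2 eq with rank≥1⇒pick s (≤-reflexive (sym (suc-injective (rank-rest p eq))))
  ... | 0 , s′ , q = reuse eq (pick-all p 4≤5 (pick-all q 4≤5 (rank0⇒short _ (suc-injective (rank-rest q (suc-injective (rank-rest p eq)))))))
  ... | 1 , s′ , q = reuse eq (pick-all p 4≤5 (pick-all q ≤-refl (rank0⇒short _ (suc-injective (rank-rest q (suc-injective (rank-rest p eq)))))))
  ... | 2 , s′ , q = let (_ , q′ , p′) = pick-swap p q in
    keep q′ (≤-reflexive (sym (trans (cong suc (pick-total ρ p′)) (cong (suc ∘ suc) (suc-injective (rank-rest q (suc-injective (rank-rest p eq))))))))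
  ... | suc (suc (suc m)) , s′ , q = ⊥-elim (1+n≢0 (suc-injective (rank-rest q (suc-injective (rank-rest p eq)))))
  go 1 p 2 eq = keep p (≤-reflexive (sym (rank-rest p eq)))
  go 2 p 2 eq = keep p (≤-reflexive (sym (rank-rest p eq)))
  -- Deleting the middle of P₇ takes the rank from 2 to 0 in one move, which ends the game.
  go 3 p 2 eq = let (_ , _ , st , pa , pb) = pick-delete 3 3 (λ ()) (λ ()) 3≤3+ p in
    finish-or-nim (some-three t (≤-reflexive (sym eq))) st (trans (pick-total₂ ρ pa pb) (suc-injective (suc-injective (rank-rest p eq))))
  go 4 p 2 eq = keep p (s≤s (s≤s z≤n))
  go (suc (suc (suc (suc (suc n))))) p 2 eq = keep p (s≤s (s≤s z≤n))
  go n {s} p (suc (suc (suc r))) eq = keep p (≤-trans (s≤s (s≤s z≤n)) (≤-pred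
    (≤-trans (≤-reflexive (sym (rank-rest p eq))) (+-monoˡ-≤ (rank s) (ρ-suc (3 + n))))))

lower-four : ∀ {ℓ} → 4 ≤ rank ℓ → Lower ℓ 2
lower-four {ℓ} le with threes ℓ in eq
... | suc t = some-three (subst (1 ≤_) (sym eq) (s≤s z≤n)) (≤-trans (s≤s (s≤s z≤n)) le)
... | zero  = no-three eq (large (rank ℓ) le)
  where
  large : ∀ r → 4 ≤ r → 2 ≤ value r (excess ℓ) (count ℓ)
  large 1 (s≤s ())
  large 2 (s≤s (s≤s ()))
  large 3 (s≤s (s≤s (s≤s ())))
  large (suc (suc (suc (suc r)))) _ = ≤-trans (s≤s (s≤s z≤n)) (∸-monoʳ-≤ (4 + r) (baseDefect≤2 (excess ℓ)))

-- P₄ alone has an excess above three per unit of rank: P₅ has 2 at rank 1, P₆ has 0, and from P₇ on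
-- it is at most 5 at rank 2 or more.
four-or-excess≤ : ∀ ℓ → (∃[ s ] Pick 4 ℓ s) ⊎ excess ℓ ≤ 3 * rank ℓ
four-or-excess≤ [] = inj₂ z≤n
four-or-excess≤ (n ∷ ℓ) with head n | four-or-excess≤ ℓ
  where
  3*ρ : ∀ n → ε (4 + n) ≤ 2 ⊎ 1 ≤ ρ (1 + n) → ε (4 + n) ≤ 3 * suc (ρ (1 + n))
  3*ρ n (inj₁ le) = ≤-trans le (≤-trans (n≤1+n 2) (*-monoʳ-≤ 3 (s≤s z≤n)))
  3*ρ n (inj₂ le) = ≤-trans (ε≤5 (4 + n)) (≤-trans (n≤1+n 5) (*-monoʳ-≤ 3 (s≤s le)))
  head : ∀ n → n ≡ 4 ⊎ ε n ≤ 3 * ρ n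
  head 0 = inj₂ z≤n
  head 1 = inj₂ z≤n
  head 2 = inj₂ z≤n
  head 3 = inj₂ z≤n
  head 4 = inj₁ refl
  head 5 = inj₂ (3*ρ 1 (inj₁ ≤-refl))
  head 6 = inj₂ z≤n
  head (suc (suc (suc n@(suc (suc (suc (suc m))))))) = inj₂ (3*ρ (3 + m) (inj₂ (s≤s z≤n)))
... | inj₁ refl | _ = inj₁ (ℓ , here)
... | inj₂ _ | inj₁ (s , p) = inj₁ (_ , there p)
... | inj₂ le | inj₂ le′ = inj₂ (≤-trans (+-mono-≤ le le′) (≤-reflexive (sym (*-distribˡ-+ 3 (ρ n) (rank ℓ)))))

defect-three : ∀ {d} e c → 1 ≤ d → baseDefect e ≤ d → defect 3 e c ≤ d
defect-three 0 c _ le = le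
defect-three 1 c _ le = le
defect-three 2 c _ le = le
defect-three 3 c _ le = le
defect-three 4 0 _ le = le
defect-three 4 1 le _ = le
defect-three 4 (suc (suc c)) _ le = le
defect-three 5 0 _ le = le
defect-three 5 1 le _ = le
defect-three 5 (suc (suc c)) _ le = le
defect-three (suc (suc (suc (suc (suc (suc e)))))) c _ le = le

value-three : ∀ e c → e ≤ 13 → 2 ≤ value 3 e c
value-three e c e≤13 = ∸-monoʳ-≤ {_} {1} 3 (defect-three e c ≤-refl (baseDefect-mono e≤13))

value-large : ∀ r e c → 1 ≤ value (3 + r) e c
value-large zero    e c = ∸-monoʳ-≤ {_} {2} 3 (defect-three e c (s≤s z≤n) (baseDefect≤2 e))
value-large (suc r) e c = ≤-trans (s≤s z≤n) (∸-monoʳ-≤ (4 + r) (baseDefect≤2 e))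

value-two : ∀ e → e ≤ 4 → 2 ≤ value 2 e 2
value-two 0 _ = ≤-refl
value-two 1 _ = ≤-refl
value-two 2 _ = ≤-refl
value-two 3 _ = ≤-refl
value-two 4 _ = ≤-refl
value-two (suc (suc (suc (suc (suc e))))) (s≤s (s≤s (s≤s (s≤s ()))))

value-two-one : ∀ e → e ≤ 5 → 1 ≤ value 2 e 2
value-two-one 5 _ = ≤-refl
value-two-one 0 _ = s≤s z≤n
value-two-one 1 _ = s≤s z≤n
value-two-one 2 _ = s≤s z≤n
value-two-one 3 _ = s≤s z≤n
value-two-one 4 _ = s≤s z≤n
value-two-one (suc (suc (suc (suc (suc (suc e)))))) (s≤s (s≤s (s≤s (s≤s (s≤s ())))))

rank1⇒count : ∀ ℓ → rank ℓ ≡ 1 → count ℓ ≡ 1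
rank1⇒count ℓ eq with rank≥1⇒pick ℓ (≤-reflexive (sym eq))
... | n , s , p = ≤-antisym (≤-trans (count≤rank ℓ) (≤-reflexive eq))
  (≤-trans (s≤s z≤n) (≤-reflexive (sym (pick-total κ p))))

shorten-light : ∀ {n ℓ s r e c} → Pick (5 + n) ℓ s → Stats s r e c →
  ∃[ ℓ′ ] Step Lft ℓ ℓ′ × Stats ℓ′ (ρ (4 + n) + r) (ε (4 + n) + e) (κ (4 + n) + c)
shorten-light p st = let (_ , _ , step , pa , pb) = shorten p in _ , step , stats-pick₂ pa pb refl refl st

light-rest : ∀ {n ℓ s} → Pick (4 + n) ℓ s → threes ℓ ≡ 0 → rank ℓ ≡ suc (ρ (suc n)) → Light s
light-rest {n} p t eq = rank0⇒light _
  (+-cancelˡ-≡ (ρ (suc n)) _ _ (suc-injective (trans (rank-rest p eq) (cong suc (sym (+-identityʳ _))))))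
  (trans (sym (threes-pick p)) t)

threes-0 : ∀ {n ℓ s} → Pick (4 + n) ℓ s → threes ℓ ≡ 0 → threes s ≡ 0
threes-0 p t = trans (sym (threes-pick p)) t

-- Shortening works except near P₄ + P₄, which the hypothesis excludes. From P₅ + P₄ it leads to P₄
-- + P₄ = 0 and wins only when there is no heap; otherwise Left removes the heap.
plan-pair : ∀ {m n ℓ s t} → Lower ℓ 1 → Pick (4 + m) ℓ s → Pick (4 + n) s t → Light t → m ≤ 2 → n ≤ 2 → LeftPlan ℓ
plan-pair lo p q li m≤2 n≤2 = go _ _ lo p q m≤2 n≤2
  where
  pair : ∀ {m n ℓ s t} → Pick (5 + m) ℓ s → Pick (4 + n) s t → Light t →
         2 ≤ value (ρ (4 + m) + (ρ (4 + n) + 0)) (ε (4 + m) + (ε (4 + n) + 0)) 2 → LeftPlan ℓ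
  pair p q li le = let (_ , step , st) = shorten-light p (stats-pick q refl (stats-light li)) in
    advance step (lower-stats st le)
  five-four : ∀ {ℓ s t} → Pick 5 ℓ s → Pick 4 s t → Light t → LeftPlan ℓ
  five-four p q li = let (_ , _ , step , pa , pb) = shorten p in
    balance-or-nim (lower-stats (stats-pick p refl (stats-pick q refl (stats-light li))) (s≤s (s≤s z≤n))) step
      (pick-all pa z≤n (pick-all pb 4≤5 (pick-all q 4≤5 (light⇒short li))))
      (trans (pick-total₂ ρ pa pb) (cong suc (trans (pick-total ρ q) (cong suc (rank-light li)))))
  go : ∀ m n {ℓ s} → Lower ℓ 1 → Pick (4 + m) ℓ s → Pick (4 + n) s _ → m ≤ 2 → n ≤ 2 → LeftPlan ℓ
  go 0 0 lo p q _ _ = ⊥-elim (1+n≰n (stats-lower (stats-pick p refl (stats-pick q refl (stats-light li))) lo))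
  go 0 1 lo p q _ _ = let (_ , q′ , p′) = pick-swap p q in five-four q′ p′ li
  go 0 2 lo p q _ _ = let (_ , q′ , p′) = pick-swap p q in pair q′ p′ li (s≤s (s≤s z≤n))
  go 1 0 lo p q _ _ = five-four p q li
  go 1 1 lo p q _ _ = pair p q li (s≤s (s≤s z≤n))
  go 1 2 lo p q _ _ = let (_ , q′ , p′) = pick-swap p q in pair q′ p′ li (s≤s (s≤s z≤n))
  go 2 0 lo p q _ _ = pair p q li (s≤s (s≤s z≤n))
  go 2 1 lo p q _ _ = pair p q li (s≤s (s≤s z≤n))
  go 2 2 lo p q _ _ = pair p q li (s≤s (s≤s z≤n))
  go (suc (suc (suc m))) n lo p q (s≤s (s≤s ())) _
  go 0 (suc (suc (suc n))) lo p q _ (s≤s (s≤s ()))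
  go 1 (suc (suc (suc n))) lo p q _ (s≤s (s≤s ()))
  go 2 (suc (suc (suc n))) lo p q _ (s≤s (s≤s ()))

-- Once a P₃ exists the full rank is a lower bound, so any defect disappears.
create-three : ∀ {n ℓ s} → Pick (6 + n) ℓ s → 2 ≤ ρ (2 + n) + rank s → LeftPlan ℓ
create-three {n} p le = let (_ , _ , step , pa , pb) = pick-delete 3 (2 + n) (λ ()) (λ ()) 3≤3+ p in
  advance step (some-three (≤-trans (s≤s z≤n) (≤-reflexive (sym (pick-total₂ τ pa pb)))) (rank-after pa pb le))

four-to-three : ∀ {ℓ s} → Pick 4 ℓ s → 2 ≤ rank s → LeftPlan ℓ
four-to-three p le = let (_ , _ , step , pa , pb) = shorten p in
  advance step (some-three (≤-trans (s≤s z≤n) (≤-reflexive (sym (pick-total₂ τ pa pb)))) (rank-after pa pb le))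

-- From rank four on, either a P₃ is created with rank at least two remaining, or P₅ is shortened
-- without loss of rank. The smaller ranks go case by case.
plan-without-three : ∀ ℓ → Lower ℓ 1 → threes ℓ ≡ 0 → LeftPlan ℓ
plan-without-three ℓ lo t with rank≥1⇒pick ℓ (lower-rank lo)
... | n , s , p = go (rank ℓ) refl n p
  where
  rank3 : rank ℓ ≡ 3 → excess ℓ ≤ 9 → ∀ n {s} → Pick (4 + n) ℓ s → LeftPlan ℓ
  rank3 eq e≤ 0 p = four-to-three p (≤-reflexive (sym (suc-injective (rank-rest p eq))))
  -- P₅ becomes P₄. The rest has excess at most 9 - 2, so the new excess is at most 12 and the
  -- defect at most one.
  rank3 eq e≤ 1 {s} p = let (_ , _ , step , pa , pb) = shorten p in
    advance step (lower-stats
      (stats-pick₂ pa pb refl refl (stats (threes-0 p t) (suc-injective (rank-rest p eq)) refl refl))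
      (value-three (5 + excess s) (1 + count s)
        (+-monoʳ-≤ 5 (m≤n⇒m≤1+n (+-cancelˡ-≤ 2 _ _ (≤-trans (≤-reflexive (sym (pick-total ε p))) e≤))))))
  rank3 eq e≤ 2 p = create-three p (≤-reflexive (sym (suc-injective (rank-rest p eq))))
  -- The rest has rank 1 and excess at most 9 - 5 = 4, so shortening P₇ to P₆ cannot produce P₄ +
  -- P₆.
  rank3 eq e≤ 3 {s} p =
    let r1 = suc-injective (suc-injective (rank-rest p eq))
        (_ , step , st) = shorten-light p (stats (threes-0 p t) r1 refl (rank1⇒count s r1)) in
    advance step (lower-stats st (value-two (excess s) (+-cancelˡ-≤ 5 _ _ (≤-trans (≤-reflexive (sym (pick-total ε p))) e≤))))
  rank3 eq e≤ 4 p = create-three p (≤-reflexive (sym (suc-injective (rank-rest p eq))))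
  rank3 eq e≤ 5 p = create-three p (≤-reflexive (sym (suc-injective (rank-rest p eq))))
  rank3 eq e≤ 6 p = let (_ , step , st) = shorten-light p (stats-light (light-rest p t eq)) in
    advance step (lower-stats st (s≤s (s≤s z≤n)))
  rank3 eq e≤ 7 p = create-three p (s≤s (s≤s z≤n))
  rank3 eq e≤ 8 p = create-three p (s≤s (s≤s z≤n))
  rank3 eq e≤ (suc (suc (suc (suc (suc (suc (suc (suc (suc n))))))))) p =
    create-three p (s≤s (s≤s z≤n))
  second : ∀ {n s} → n ≤ 2 → Pick (4 + n) ℓ s → rank s ≡ 1 → LeftPlan ℓ
  second {s = s} n≤2 p r1 with rank≥1⇒pick s (≤-reflexive (sym r1))
  ... | 0 , _ , q = plan-pair lo p q (light-rest q (threes-0 p t) r1) n≤2 z≤n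
  ... | 1 , _ , q = plan-pair lo p q (light-rest q (threes-0 p t) r1) n≤2 (s≤s z≤n)
  ... | 2 , _ , q = plan-pair lo p q (light-rest q (threes-0 p t) r1) n≤2 ≤-refl
  ... | suc (suc (suc m)) , _ , q = ⊥-elim (1+n≢0 (suc-injective (rank-rest q r1)))
  go : ∀ r → rank ℓ ≡ r → ∀ n {s} → Pick (4 + n) ℓ s → LeftPlan ℓ
  go 0 eq n p = ⊥-elim (1+n≰n (≤-trans (lower-rank lo) (≤-reflexive eq)))
  go 1 eq 0 p = ⊥-elim (1+n≰n (stats-lower (stats-pick p refl (stats-light (light-rest p t eq))) lo))
  go 1 eq 1 p = let li = light-rest p t eq
                    (_ , _ , step , pa , pb) = shorten p in
    stable eq (inj₂ (_ , p , li)) step (pick-all pa z≤n (pick-all pb 4≤5 (light⇒short li)))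
      (trans (pick-total₂ ρ pa pb) (cong suc (rank-light li)))
  go 1 eq 2 p = let (_ , _ , step , pa , pb) = shorten p
                    (_ , pb′ , pa′) = pick-swap pa pb in
    stabilise eq step (inj₂ (_ , pb′ , pick-all pa′ z≤n (light-rest p t eq)))
  go 1 eq (suc (suc (suc n))) p = ⊥-elim (1+n≢0 (suc-injective (rank-rest p eq)))
  go 2 eq 3 p = let (_ , _ , step , pa , pb) = pick-delete 3 3 (λ ()) (λ ()) 3≤3+ p
                    li = light-rest p t eq in
    finish-or-nim (lower-stats (stats-pick p refl (stats-light li)) (s≤s (s≤s z≤n))) step (trans (pick-total₂ ρ pa pb) (rank-light li))
  go 2 eq 4 p = let (_ , step , st) = shorten-light p (stats-light (light-rest p t eq)) in
    advance step (lower-stats st (s≤s (s≤s z≤n)))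
  -- Without a heap, the middle deletion hands Right P₄ + P₄ = 0.
  go 2 eq 5 p = let (_ , _ , step , pa , pb) = pick-delete 4 4 (λ ()) (λ ()) 3≤3+ p
                    li = light-rest p t eq in
    balance-or-nim (lower-stats (stats-pick p refl (stats-light li)) (s≤s (s≤s z≤n))) step
      (pick-all pa 4≤5 (pick-all pb 4≤5 (light⇒short li))) (trans (pick-total₂ ρ pa pb) (cong (suc ∘ suc) (rank-light li)))
  go 2 eq 0 p = second z≤n p (suc-injective (rank-rest p eq))
  go 2 eq 1 p = second (s≤s z≤n) p (suc-injective (rank-rest p eq))
  go 2 eq 2 p = second ≤-refl p (suc-injective (rank-rest p eq))
  go 2 eq (suc (suc (suc (suc (suc (suc n)))))) p = ⊥-elim (1+n≢0 (suc-injective (suc-injective (rank-rest p eq))))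
  go 3 eq n p with four-or-excess≤ ℓ
  ... | inj₁ (_ , q) = four-to-three q (≤-reflexive (sym (suc-injective (rank-rest q eq))))
  ... | inj₂ e≤ = rank3 eq (≤-trans e≤ (≤-reflexive (cong (3 *_) eq))) n p
  go (suc (suc (suc (suc r)))) eq 0 p = four-to-three p (≤-trans (s≤s (s≤s z≤n)) (≤-reflexive (sym (suc-injective (rank-rest p eq)))))
  go (suc (suc (suc (suc r)))) eq 1 p = let (_ , _ , step , pa , pb) = shorten p in
    advance step (lower-four (rank-after pa pb (≤-trans (s≤s (s≤s (s≤s (s≤s z≤n)))) (≤-reflexive (sym (rank-rest p eq))))))
  go (suc (suc (suc (suc r)))) eq (suc (suc n)) {s} p = create-three p (≤-pred (≤-pred (≤-trans
    (≤-trans (s≤s (s≤s (s≤s (s≤s z≤n)))) (≤-reflexive (sym (rank-rest p eq)))) (s≤s (+-monoˡ-≤ (rank s) (ρ-suc (2 + n)))))))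

leftPlan : ∀ ℓ → Lower ℓ 1 → LeftPlan ℓ
leftPlan ℓ lo with threes ℓ in eq
... | zero  = plan-without-three ℓ lo eq
... | suc t = plan-with-three ℓ (subst (1 ≤_) (sym eq) (s≤s z≤n)) (lower-rank lo)

-- Left's play in G + c·↓ + *j

data Class (ℓ : List ℕ) : Set where
  done      : rank ℓ ≡ 0 → Class ℓ
  ahead     : Lower ℓ 1 → Class ℓ
  short-one : Short ℓ → rank ℓ ≡ 1 → Class ℓ
  short-two : Short ℓ → rank ℓ ≡ 2 → Class ℓ

short-or-long : ∀ ℓ → Short ℓ ⊎ ∃[ n ] ∃[ s ] Pick (6 + n) ℓ s
short-or-long [] = inj₁ []
short-or-long (n ∷ ℓ) with n ≤? 5 | short-or-long ℓ
... | yes n≤5 | inj₁ sh = inj₁ (n≤5 ∷ sh)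
... | yes n≤5 | inj₂ (k , s , p) = inj₂ (k , _ , there p)
... | no n≰5  | _ with ≰⇒> n≰5
... | s≤s (s≤s (s≤s (s≤s (s≤s (s≤s {n = k} _))))) = inj₂ (k , ℓ , here)

-- At positive rank and without a P₃, the lower bound can fail to be positive only if the rank is 1
-- or 2 and no path is longer than five.
classify : ∀ ℓ → Class ℓ
classify ℓ = go (threes ℓ) (rank ℓ) refl refl
  where
  ahead₁ : threes ℓ ≡ 0 → rank ℓ ≡ 1 → ∀ n {s} → Pick (6 + n) ℓ s → Lower ℓ 1
  ahead₁ t r 0       p = lower-stats (stats-pick p refl (stats-light (light-rest p t r))) ≤-refl
  ahead₁ t r (suc n) p = ⊥-elim (1+n≢0 (suc-injective (rank-rest p r)))
  ahead₂ : threes ℓ ≡ 0 → rank ℓ ≡ 2 → ∀ n {s} → Pick (6 + n) ℓ s → Lower ℓ 1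
  ahead₂ t r 0 {s} p =
    let r1 = suc-injective (rank-rest p r)
        c1 = rank1⇒count s r1 in
    lower-stats (stats-pick p refl (stats (threes-0 p t) r1 refl c1))
      (value-two-one (excess s) (≤-trans (excess≤5*count s) (≤-reflexive (cong (5 *_) c1))))
  ahead₂ t r 1 p = lower-stats (stats-pick p refl (stats-light (light-rest p t r))) (s≤s z≤n)
  ahead₂ t r 2 p = lower-stats (stats-pick p refl (stats-light (light-rest p t r))) (s≤s z≤n)
  ahead₂ t r 3 p = lower-stats (stats-pick p refl (stats-light (light-rest p t r))) (s≤s z≤n)
  ahead₂ t r (suc (suc (suc (suc n)))) p = ⊥-elim (1+n≢0 (suc-injective (suc-injective (rank-rest p r))))
  go : ∀ k r → threes ℓ ≡ k → rank ℓ ≡ r → Class ℓ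
  go k 0 t r = done r
  go (suc k) (suc n) t r = ahead (some-three (≤-trans (s≤s z≤n) (≤-reflexive (sym t))) (≤-trans (s≤s z≤n) (≤-reflexive (sym r))))
  go 0 1 t r with short-or-long ℓ
  ... | inj₁ sh          = short-one sh r
  ... | inj₂ (n , _ , p) = ahead (ahead₁ t r n p)
  go 0 2 t r with short-or-long ℓ
  ... | inj₁ sh          = short-two sh r
  ... | inj₂ (n , _ , p) = ahead (ahead₂ t r n p)
  go 0 (suc (suc (suc n))) t r = ahead (no-three t (subst (λ r → 1 ≤ value r (excess ℓ) (count ℓ)) (sym r) (value-large n (excess ℓ) (count ℓ))))

left-plays : ∀ {ℓ ℓ′ G} j → Plays ℓ G → 1 ≤ rank ℓ → Step Lft ℓ ℓ′ →
             (∀ {H} → Plays ℓ′ H → LeftHolds H 0 j) → LeftWins G 0 j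
left-plays j pl r≥1 st holds = let (_ , x∈ , pl′) = plays-step Lft pl r≥1 st in
  left-plays-component 0 j x∈ (holds pl′)

left-holds-done : ∀ {ℓ G} → Plays ℓ G → rank ℓ ≡ 0 → LeftHolds G 0 0
left-holds-done {G = G} pl eq = left-holds G 0 0
  (λ H∈ → ⊥-elim (noOption Rgt (subst (_ ∈_) (cong (options Rgt) (rank0⇒zeroG pl eq)) H∈)))
  (λ ()) (λ ())

left-wins-done : ∀ {ℓ G} j → Plays ℓ G → rank ℓ ≡ 0 → LeftWins G 0 (suc j)
left-wins-done j pl eq = left-plays-nim 0 (s≤s z≤n) (left-holds-done pl eq)

left-wins-rank1 : ∀ {ℓ G} → Plays ℓ G → rank ℓ ≡ 1 → LeftWins G 0 0
left-wins-rank1 {ℓ} pl eq = let (_ , st , eq′) = lowering-delete ℓ eq in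
  left-plays 0 pl (≤-reflexive (sym eq)) st λ pl′ → left-holds-done pl′ eq′

left-holds-short-one : ∀ {ℓ G} → Plays ℓ G → Short ℓ → rank ℓ ≡ 1 → LeftHolds G 0 1
left-holds-short-one {G = G} pl sh eq = left-holds G 0 1
  (λ H∈ → let (_ , st , pl′) = plays-option Rgt pl H∈ in
    left-wins-done 0 pl′ (suc-injective (trans (sym (short-cut sh st)) eq)))
  (λ ())
  (λ { {zero} _ → left-wins-rank1 pl eq ; {suc i} (s≤s ()) })

left-holds-short-two : ∀ {ℓ G} → Plays ℓ G → Short ℓ → rank ℓ ≡ 2 → LeftHolds G 0 0
left-holds-short-two {G = G} pl sh eq = left-holds G 0 0
  (λ H∈ → let (_ , st , pl′) = plays-option Rgt pl H∈ in
    left-wins-rank1 pl′ (suc-injective (trans (sym (short-cut sh st)) eq)))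
  (λ ()) (λ ())

-- The answer depends on the heap Right leaves beside P₅: 0 is met by ending the game, 1 by
-- shortening to P₄ = *, and a larger heap by moving it to 1.
left-holds-five : ∀ {ℓ G} j → Plays ℓ G → Five ℓ → LeftHolds G 0 (suc j)
left-holds-five {ℓ} {G} j pl (s , p , li) = left-holds G 0 (suc j)
  (λ H∈ → let (_ , st , pl′) = plays-option Rgt pl H∈ in
    left-wins-done j pl′ (suc-injective (trans (sym (short-cut short st)) rank≡1)))
  (λ ())
  (λ { {0} _ → left-wins-rank1 pl rank≡1
     ; {1} _ → let (_ , _ , st , pa , pb) = shorten p in
         left-plays 1 pl (≤-reflexive (sym rank≡1)) st λ pl′ → left-holds-short-one pl′
           (pick-all pa z≤n (pick-all pb 4≤5 (light⇒short li)))
           (trans (pick-total₂ ρ pa pb) (cong suc (rank-light li)))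
     ; {suc (suc i)} _ → left-plays-nim 0 (s≤s (s≤s z≤n)) (left-holds-short-one pl short rank≡1) })
  where
  short : Short ℓ
  short = pick-all p ≤-refl (light⇒short li)
  rank≡1 : rank ℓ ≡ 1
  rank≡1 = trans (pick-total ρ p) (cong suc (rank-light li))

-- Left's lead is w - c. Turning a ↓ into * raises it by one and a cut lowers it by at most one.
-- When no ↓ is left, `leftPlan` supplies the move at lead one and `classify` at lead zero.
mutual
  left-holds-two : ∀ n {ℓ G} c j → measure ℓ c j < n → Plays ℓ G → Lower ℓ (2 + c) → LeftHolds G c j
  left-holds-two (suc n) {ℓ} {G} c j m pl lo = left-holds G c j
    (λ H∈ → let (_ , st , pl′) = plays-option Rgt pl H∈ in
      left-wins-one n c j (measure-step c j st m) pl′ (lower-cut lo st))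
    (λ { {c′} refl → left-wins-one n c′ j (measure-down ℓ c′ (n≤1+n j) m) pl (lower-≤ (m≤n+m (suc c′) 2) lo) })
    (λ {i} i<j → left-wins-one n c i (measure-nim ℓ c i<j m) pl (lower-≤ (n≤1+n (suc c)) lo))

  left-holds-one : ∀ n {ℓ G} c j → measure ℓ c j < n → Plays ℓ G → Lower ℓ (1 + c) → 2 ≤ j → LeftHolds G c j
  left-holds-one (suc n) {ℓ} {G} c j m pl lo 2≤j = left-holds G c j
    (λ H∈ → let (_ , st , pl′) = plays-option Rgt pl H∈ in
      left-wins-level n c j (measure-step c j st m) pl′ (lower-cut lo st) 2≤j)
    (λ { {c′} refl → left-wins-one n c′ j (measure-down ℓ c′ (n≤1+n j) m) pl (lower-≤ (n≤1+n (suc c′)) lo) })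
    (λ {i} i<j → left-wins-one n c i (measure-nim ℓ c i<j m) pl lo)

  left-wins-level : ∀ n {ℓ G} c j → measure ℓ c j < n → Plays ℓ G → Lower ℓ c → 2 ≤ j → LeftWins G c j
  left-wins-level (suc n) {ℓ} (suc c) j m pl lo 2≤j =
    left-plays-down c j (left-holds-one n c (flip j) (measure-down ℓ c (flip≤ j) m) pl lo (flip≥2 2≤j))
  left-wins-level (suc n) {ℓ} zero j m pl lo 2≤j with classify ℓ
  ... | done eq         = left-plays-nim 0 (≤-trans (s≤s z≤n) 2≤j) (left-holds-done pl eq)
  ... | ahead lo′       = left-wins-one (suc n) zero j m pl lo′
  ... | short-one sh eq = left-plays-nim 0 2≤j (left-holds-short-one pl sh eq)
  ... | short-two sh eq = left-plays-nim 0 (≤-trans (s≤s z≤n) 2≤j) (left-holds-short-two pl sh eq)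

  left-wins-one : ∀ n {ℓ G} c j → measure ℓ c j < n → Plays ℓ G → Lower ℓ (1 + c) → LeftWins G c j
  left-wins-one (suc n) {ℓ} (suc c) j m pl lo =
    left-plays-down c j (left-holds-two n c (flip j) (measure-down ℓ c (flip≤ j) m) pl lo)
  left-wins-one (suc n) {ℓ} zero j m pl lo = go j m (leftPlan ℓ lo)
    where
    r≥1 : 1 ≤ rank ℓ
    r≥1 = lower-rank lo
    go : ∀ j → measure ℓ 0 j < suc n → LeftPlan ℓ → LeftWins _ 0 j
    go j m (advance st lo′) = left-plays j pl r≥1 st λ pl′ → left-holds-two n 0 j (measure-step 0 j st m) pl′ lo′
    go zero m (finish-or-nim lo₂ st eq) = left-plays 0 pl r≥1 st λ pl′ → left-holds-done pl′ eq
    go (suc j) m (finish-or-nim lo₂ st eq) = left-plays-nim 0 (s≤s z≤n) (left-holds-two n 0 0 (measure-nim ℓ 0 (s≤s z≤n) m) pl lo₂)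
    go zero m (balance-or-nim lo₂ st sh eq) = left-plays 0 pl r≥1 st λ pl′ → left-holds-short-two pl′ sh eq
    go (suc j) m (balance-or-nim lo₂ st sh eq) = left-plays-nim 0 (s≤s z≤n) (left-holds-two n 0 0 (measure-nim ℓ 0 (s≤s z≤n) m) pl lo₂)
    go zero m (stabilise eq _ _) = left-wins-rank1 pl eq
    go (suc j) m (stabilise _ st sb) = left-plays (suc j) pl r≥1 st λ pl′ → left-holds-stable n j (measure-step 0 (suc j) st m) pl′ sb
    go zero m (stable eq _ _ _ _) = left-wins-rank1 pl eq
    go (suc zero) m (stable _ _ st sh eq) = left-plays 1 pl r≥1 st λ pl′ → left-holds-short-one pl′ sh eq
    go (suc (suc j)) m (stable _ sb _ _ _) = left-plays-nim 0 (s≤s (s≤s z≤n)) (left-holds-stable n 0 (measure-nim ℓ 0 (s≤s (s≤s z≤n)) m) pl sb)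

  left-holds-stable : ∀ n {ℓ G} j → measure ℓ 0 (suc j) < n → Plays ℓ G → Stable ℓ → LeftHolds G 0 (suc j)
  left-holds-stable n j m pl (inj₂ five) = left-holds-five j pl five
  left-holds-stable (suc n) {ℓ} {G} j m pl (inj₁ (t , r≥1)) = left-holds G 0 (suc j)
    (λ H∈ → let (_ , st , pl′) = plays-option Rgt pl H∈ in reply st pl′)
    (λ ())
    (λ {i} i<j → left-wins-one n 0 i (measure-nim ℓ 0 i<j m) pl (some-three t r≥1))
    where
    reply : ∀ {ℓ′ H} → Step Rgt ℓ ℓ′ → Plays ℓ′ H → LeftWins H 0 (suc j)
    reply {ℓ′} st pl′ with rank ℓ′ in eq
    ... | zero  = left-wins-done j pl′ eq
    ... | suc r = left-wins-one n 0 (suc j) (measure-step 0 (suc j) st m) pl′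
                    (some-three (≤-trans t (cut-threes st)) (≤-trans (s≤s z≤n) (≤-reflexive (sym eq))))

-- w + 1 is the atomic weight: the rank, less one for P₈ and P₁₀.
path-bounds : ∀ n → 5 ≤ n → ∃[ w ] Lower (n ∷ []) (suc w) × Upper (n ∷ []) (suc w)
path-bounds 0 ()
path-bounds 1 (s≤s ())
path-bounds 2 (s≤s (s≤s ()))
path-bounds 3 (s≤s (s≤s (s≤s ())))
path-bounds 4 (s≤s (s≤s (s≤s (s≤s ()))))
path-bounds 5 _ = 0 , no-three refl ≤-refl , general ≤-refl
path-bounds 6 _ = 0 , no-three refl ≤-refl , general ≤-refl
path-bounds 7 _ = 1 , no-three refl ≤-refl , general ≤-refl
path-bounds 8 _ = 0 , no-three refl ≤-refl , eight here [] ≤-refl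
path-bounds 9 _ = 1 , no-three refl ≤-refl , general ≤-refl
path-bounds 10 _ = 1 , no-three refl ≤-refl , ten here [] ≤-refl
path-bounds 11 _ = 2 , no-three refl ≤-refl , general ≤-refl
path-bounds 12 _ = 2 , no-three refl ≤-refl , general ≤-refl
-- From 13 vertices on the rank is at least four, where only `baseDefect` acts, and the excess of a
-- single path stays below its first step.
path-bounds (suc (suc (suc (suc (suc (suc (suc (suc (suc (suc (suc (suc (suc n))))))))))))) _ =
  3 + ρ (1 + n) , no-three refl (≤-trans (≤-reflexive (sym (+-identityʳ _))) (∸-monoʳ-≤ (4 + (ρ (1 + n) + 0)) no-defect)) ,
  general (≤-reflexive (+-identityʳ _))
  where
  no-defect : baseDefect (ε (4 + n) + 0) ≤ 0
  no-defect = baseDefect-mono {_} {5} (≤-trans (≤-reflexive (+-identityʳ _)) (ε≤5 (4 + n)))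

open import Data.Integer using (ℤ; +_; +≤+) renaming (_≤_ to _≤ℤ_)

farStarEquiv : ∀ {G k m} → LeftHolds G k m → LeftWins G k m →
  RightHolds G (suc (suc k)) m → RightWins G (suc (suc k)) m →
  ((down ⊕ nim m) <G (G ⊖ ((+ suc k) ·↑))) × ((G ⊖ ((+ suc k) ·↑)) <G (up ⊕ nim m))
farStarEquiv lh lw rh rw = down<difference lh lw , difference<up rh rw

theorem3p16 : (n : ℕ) → 5 ≤ n →
    FarStarGt (P n) × Σ ℤ (λ k → (+ 1 ≤ℤ k) × HasAtomicWeight (P n) k)
theorem3p16 n 5≤n with path-bounds n 5≤n
-- Dominating far star is the case without any ↓, for which the bound w + 1 is weakened to 1.
... | w , lo , up =
  (2 , λ m 2≤m → farStarGt (left-holds-one _ 0 m ≤-refl pl (lower-≤ (s≤s z≤n) lo) 2≤m)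
                           (left-wins-one _ 0 m ≤-refl pl (lower-≤ (s≤s z≤n) lo))) ,
  + suc w , +≤+ (s≤s z≤n) ,
  (2 , λ m 2≤m → farStarEquiv {k = w}
    (left-holds-one _ w m ≤-refl pl lo 2≤m) (left-wins-one _ w m ≤-refl pl lo)
    (right-holds-one _ (2 + w) m ≤-refl pl up ≤-refl 2≤m) (right-wins-one _ (2 + w) m ≤-refl pl up ≤-refl))
  where
  pl : Plays (n ∷ []) (P n)
  pl = plays-P n λ { refl → 1+n≰n (≤-trans (s≤s (s≤s z≤n)) 5≤n) }
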